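{- (Region counting formula for arrangements of tropical hypersurfaces.) Let $g_1,\dots,g_m:\mathbb{R}^d\to\mathbb{R}$ be tropical polynomials. Then $$\mathrm{mComp}(g_1\odot\cdots\odot g_m)=\mathrm{fComp}(g_1,\dots,g_m)+\sum_{k=2}^m(-1)^{k+d}\sum_{S\in\binom{[m]}{k}}\chi\Big(\bigcap_{i\in S}\mathcal{V}(g_i)\Big).$$
   Context: A tropical polynomial on $\mathbb{R}^d$ is a function $g(x)=\max_{1\le i\le n}(\langle b_i,x\rangle+a_i)$ with $a_i\in\mathbb{R}$, $b_i\in\mathbb{R}^d$; $g\odot h$ denotes $g+h$. $\mathcal{V}(g)=\{x\in\mathbb{R}^d:g\text{ is not affine in any neighbourhood of }x\}$, the tropical hypersurface of $g$; it is a polyhedral complex. $\mathrm{mComp}(g)$ is the number of linear regions of $g$, i.e. the number of connected components of $\mathbb{R}^d\setminus\mathcal{V}(g)$. $\mathrm{fComp}(g_1,\dots,g_m)=\sum_{i=1}^m\mathrm{mComp}(g_i)-(m-1)$. $\binom{[m]}{k}$ is the set of $k$-element subsets of $\{1,\dots,m\}$. The Euler characteristic $\chi(X)$ of a polyhedral complex $X$ (possibly with unbounded faces) is $\sum_{i=0}^d(-1)^i\cdot(\text{number of }i\text{ -dimensional faces of }X)$, counting bounded and unbounded faces; it does not depend on the polyhedral structure chosen, and $\chi(\emptyset)=0$. -}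

module Defs where

open import Algebra.Bundles using (CommutativeRing)
open import Algebra.Definitions using (Invertible)
open import Algebra.Structures using (IsCommutativeRing)
open import Axiom.ExcludedMiddle using (ExcludedMiddle)
open import Data.Bool.Base using (true; false)
open import Data.Fin.Base using (Fin)
open import Data.Fin.Subset using (Subset; _∈_; ∣_∣)
open import Data.Integer.Base as ℤ using (ℤ; +_; 0ℤ; 1ℤ; -1ℤ)
open import Data.List.Base as List using (List; []; _∷_; _++_; allFin; upTo)
open import Data.Maybe.Base using (maybe′)
open import Data.Nat.Base using (ℕ; zero; suc)
open import Data.Nat.Properties using (_≟_)
open import Data.Product.Base using (Σ; ∃; _×_; _,_; proj₁)
import Data.Vec.Base as Vec
open import Data.Vec.Functional using (Vector; head; tail; foldr)
open import Level using (0ℓ)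
open import Relation.Binary.Bundles using (StrictTotalOrder; TotalOrder; DecTotalOrder)
import Relation.Binary.Construct.StrictToNonStrict as StrictToNonStrict
import Relation.Binary.Properties.StrictTotalOrder as StrictTotalOrderProperties
open import Relation.Binary.PropositionalEquality using (_≡_)
open import Relation.Binary.Structures using (IsStrictTotalOrder)
open import Relation.Nullary.Decidable using (dec⇒maybe)
open import Relation.Nullary.Negation using (¬_)
open import Relation.Unary using (Pred; _⊆_; _≐_; _∩_; _∪_; ∁; Satisfiable)
import Algebra.Construct.NaturalChoice.Max as Max
import Algebra.Definitions.RawMonoid as RawMonoidSum

-- The real numbers, characterised (uniquely up to isomorphism) as the
-- Dedekind-complete ordered field.  Equality is a setoid equality.
record CompleteOrderedField : Set₁ where
  infix  4 _≈_ _<_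
  infixl 6 _+_
  infixl 7 _*_
  infix  8 -_
  field
    Carrier            : Set
    _≈_ _<_            : Carrier → Carrier → Set
    _+_ _*_            : Carrier → Carrier → Carrier
    -_                 : Carrier → Carrier
    0# 1#              : Carrier
    isCommutativeRing  : IsCommutativeRing _≈_ _+_ _*_ -_ 0# 1#
    isStrictTotalOrder : IsStrictTotalOrder _≈_ _<_
    0<1                : 0# < 1#
    invertible         : ∀ x → ¬ (x ≈ 0#) → Invertible _≈_ 1# _*_ x
    +-monoˡ-<          : ∀ z {x y} → x < y → x + z < y + z
    *-pos              : ∀ {x y} → 0# < x → 0# < y → 0# < x * y

  open StrictToNonStrict _≈_ _<_ public using (_≤_)

  IsUpperBound : Pred Carrier 0ℓ → Carrier → Set
  IsUpperBound P b = ∀ x → P x → x ≤ b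

  field
    supremum : ∀ (P : Pred Carrier 0ℓ) → Satisfiable P → ∃ (IsUpperBound P) →
               ∃ λ s → IsUpperBound P s × (∀ b → IsUpperBound P b → s ≤ b)

  commutativeRing : CommutativeRing 0ℓ 0ℓ
  commutativeRing = record { isCommutativeRing = isCommutativeRing }

  strictTotalOrder : StrictTotalOrder 0ℓ 0ℓ 0ℓ
  strictTotalOrder = record { isStrictTotalOrder = isStrictTotalOrder }

  totalOrder : TotalOrder 0ℓ 0ℓ 0ℓ
  totalOrder = DecTotalOrder.totalOrder
    (StrictTotalOrderProperties.decTotalOrder strictTotalOrder)

  open CommutativeRing commutativeRing public using (_-_; +-rawMonoid)
  open Max totalOrder public using (_⊔_)
  open RawMonoidSum +-rawMonoid public using (sum)

∑ : {A : Set} → List A → (A → ℤ) → ℤ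
∑ xs f = List.foldr ℤ._+_ 0ℤ (List.map f xs)

infix 5 ∑
syntax ∑ xs (λ x → e) = ∑[ x ← xs ] e

subsets : ∀ m → List (Subset m)
subsets zero    = Vec.[] ∷ []
subsets (suc m) = List.map (true Vec.∷_) (subsets m) ++ List.map (false Vec.∷_) (subsets m)

subsetsOfSize : ℕ → ∀ m → List (Subset m)
subsetsOfSize k m = List.filter (λ S → ∣ S ∣ ≟ k) (subsets m)

module Euclidean (ℝ : CompleteOrderedField) where
  open CompleteOrderedField ℝ

  Point : ℕ → Set
  Point d = Vector Carrier d

  ⟨_,_⟩ : ∀ {d} → Point d → Point d → Carrier
  ⟨ b , x ⟩ = sum (λ i → b i * x i)

  -- The ball of the sup norm, which induces the usual topology.
  Ball : ∀ {d} → Point d → Carrier → Pred (Point d) 0ℓ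
  Ball x ε y = ∀ i → (x i - ε < y i) × (y i < x i + ε)

  Open : ∀ {d} → Pred (Point d) 0ℓ → Set
  Open U = ∀ {x} → U x → ∃ λ ε → (0# < ε) × (Ball x ε ⊆ U)

  Connected : ∀ {d} → Pred (Point d) 0ℓ → Set₁
  Connected {d} A = (U W : Pred (Point d) 0ℓ) → Open U → Open W → A ⊆ U ∪ W →
    Satisfiable (A ∩ U) → Satisfiable (A ∩ W) → Satisfiable (A ∩ (U ∩ W))

  record IsComponent {d} (X C : Pred (Point d) 0ℓ) : Set₁ where
    field
      nonempty  : Satisfiable C
      inside    : C ⊆ X
      connected : Connected C
      maximal   : ∀ (D : Pred (Point d) 0ℓ) → D ⊆ X → Connected D → C ⊆ D → D ⊆ C

  record HasComponentCount {d} (X : Pred (Point d) 0ℓ) (n : ℕ) : Set₁ where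
    field
      component   : Fin n → Pred (Point d) 0ℓ
      isComponent : ∀ i → IsComponent X (component i)
      distinct    : ∀ i j → component i ≐ component j → i ≡ j
      exhaustive  : ∀ C → IsComponent X C → ∃ λ i → C ≐ component i

  record Polyhedron (d : ℕ) : Set where
    field
      size   : ℕ
      normal : Fin size → Point d
      offset : Fin size → Carrier

  ⟦_⟧ : ∀ {d} → Polyhedron d → Pred (Point d) 0ℓ
  ⟦ P ⟧ x = ∀ i → ⟨ normal i , x ⟩ ≤ offset i
    where open Polyhedron P

  -- The case c = 0, β = 0 makes P a face of itself.
  _IsFaceOf_ : ∀ {d} → Pred (Point d) 0ℓ → Pred (Point d) 0ℓ → Set
  F IsFaceOf P = ∃ λ c → ∃ λ β →
    (P ⊆ λ x → ⟨ c , x ⟩ ≤ β) × (F ≐ P ∩ λ x → ⟨ c , x ⟩ ≈ β)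

  AffinelyIndependent : ∀ {d n} → Vector (Point d) n → Set
  AffinelyIndependent {d} {n} p = (t : Vector Carrier n) → sum t ≈ 0# →
    (∀ (j : Fin d) → sum (λ i → t i * p i j) ≈ 0#) → ∀ i → t i ≈ 0#

  HasDimension : ∀ {d} → Pred (Point d) 0ℓ → ℕ → Set
  HasDimension {d} P k =
    (Σ (Vector (Point d) (suc k)) λ p → (∀ i → P (p i)) × AffinelyIndependent p) ×
    (∀ (p : Vector (Point d) (suc (suc k))) → (∀ i → P (p i)) → ¬ AffinelyIndependent p)

  -- The listed faces are the nonempty ones; they may be unbounded.
  record PolyhedralComplex (d : ℕ) : Set₁ where
    field
      size         : ℕ
      face         : Fin size → Polyhedron d
      dim          : Fin size → ℕ
      nonempty     : ∀ i → Satisfiable ⟦ face i ⟧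
      hasDimension : ∀ i → HasDimension ⟦ face i ⟧ (dim i)
      distinct     : ∀ i j → ⟦ face i ⟧ ≐ ⟦ face j ⟧ → i ≡ j
      faceClosed   : ∀ i (F : Pred (Point d) 0ℓ) → F IsFaceOf ⟦ face i ⟧ → Satisfiable F →
                     ∃ λ j → F ≐ ⟦ face j ⟧
      intersection : ∀ i j → Satisfiable (⟦ face i ⟧ ∩ ⟦ face j ⟧) →
                     ((⟦ face i ⟧ ∩ ⟦ face j ⟧) IsFaceOf ⟦ face i ⟧) ×
                     ((⟦ face i ⟧ ∩ ⟦ face j ⟧) IsFaceOf ⟦ face j ⟧)

    support : Pred (Point d) 0ℓ
    support x = ∃ λ i → ⟦ face i ⟧ x

    faceCount : ℕ → ℕ
    faceCount k = List.length (List.filter (λ i → dim i ≟ k) (allFin size))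

    euler : ℤ
    euler = ∑[ k ← upTo (suc d) ] (-1ℤ ℤ.^ k) ℤ.* (+ faceCount k)

-- Excluded middle turns the number of components and the Euler
-- characteristic into total functions; the default value 0 is used only
-- for infinitely many components and for sets supporting no polyhedral complex.
module TropicalGeometry (em : ExcludedMiddle (Level.suc 0ℓ)) (ℝ : CompleteOrderedField) where
  open CompleteOrderedField ℝ
  open Euclidean ℝ public

  Function : ℕ → Set
  Function d = Point d → Carrier

  maximum : ∀ {n} → Vector Carrier (suc n) → Carrier
  maximum v = foldr _⊔_ (head v) (tail v)

  IsTropicalPolynomial : ∀ {d} → Function d → Set
  IsTropicalPolynomial {d} g =
    ∃ λ n → Σ (Vector Carrier (suc n)) λ a → Σ (Vector (Point d) (suc n)) λ b →
    ∀ x → g x ≈ maximum (λ i → ⟨ b i , x ⟩ + a i)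

  ⨀ : ∀ {d m} → (Fin m → Function d) → Function d
  ⨀ g x = sum (λ i → g i x)

  AffineOn : ∀ {d} → Function d → Pred (Point d) 0ℓ → Set
  AffineOn g U = ∃ λ c → ∃ λ a → ∀ y → U y → g y ≈ ⟨ c , y ⟩ + a

  -- Balls suffice: being affine passes to smaller neighbourhoods.
  𝒱 : ∀ {d} → Function d → Pred (Point d) 0ℓ
  𝒱 g x = ¬ (∃ λ ε → (0# < ε) × AffineOn g (Ball x ε))

  mComp : ∀ {d} → Function d → ℕ
  mComp g = maybe′ proj₁ 0 (dec⇒maybe (em {∃ (HasComponentCount (∁ (𝒱 g)))}))

  fComp : ∀ {d m} → (Fin m → Function d) → ℤ
  fComp {m = m} g = (∑[ i ← allFin m ] (+ mComp (g i))) ℤ.- (+ m ℤ.- 1ℤ)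

  χ : ∀ {d} → Pred (Point d) 0ℓ → ℤ
  χ {d} X = maybe′ (λ (C , _) → PolyhedralComplex.euler C) 0ℤ
    (dec⇒maybe (em {Σ (PolyhedralComplex d) λ C → PolyhedralComplex.support C ≐ X}))

  ⋂[_] : ∀ {d m} → Subset m → (Fin m → Pred (Point d) 0ℓ) → Pred (Point d) 0ℓ
  ⋂[ S ] X x = ∀ i → i ∈ S → X i x

{-# OPTIONS --safe #-}
module Submission where

-- With compact supports the Euler characteristic is additive: if X is a union of cells of a hyperplane
-- arrangement, χ(X) is the sum of (-1)^dim over the cells contained in X.  Cutting a relatively open convex set
-- by a hyperplane replaces (-1)^k by (-1)^k + (-1)^(k-1) + (-1)^k, so this number does not depend on the
-- arrangement; in particular it agrees with the alternating face count of every polyhedral complex supported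
-- on X, whose relatively open faces partition X.  The linear regions of g are open convex sets, each of
-- characteristic (-1)^d, hence χ(𝒱 g) = (-1)^d (1 - mComp g).  Finally 𝒱 (⨀ g) is the union of the 𝒱 (g i), and
-- the formula is inclusion-exclusion for this union.

open import Defs
open import Algebra.Bundles using (CommutativeRing; RawRing)
import Algebra.Construct.NaturalChoice.Max as Max
import Algebra.Properties.Ring as RingProperties
import Algebra.Properties.Semiring.Mult.TCOptimised as Mult
import Algebra.Properties.Semiring.Sum as SemiringSum
import Algebra.Solver.Ring as RingSolver
open import Algebra.Solver.Ring.AlmostCommutativeRing using (fromCommutativeRing; _-Raw-AlmostCommutative⟶_)
open import Axiom.ExcludedMiddle using (ExcludedMiddle)
open import Data.Bool.Base using (true; false)
open import Data.Empty using (⊥-elim)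
open import Data.Fin.Base
  using (Fin; zero; suc; toℕ; punchIn; _↑ˡ_; _↑ʳ_; splitAt; remQuot; combine; finToFun; funToFin)
open import Data.Fin.Patterns using (0F; 1F; 2F)
import Data.Fin.Properties as Finₚ
open import Data.Fin.Subset using (Subset; ∣_∣; ⁅_⁆; ⊥)
import Data.Fin.Subset.Properties as Subsetₚ
import Data.Integer.Base as ℤ
import Data.Integer.Properties as ℤₚ
import Data.Integer.Tactic.RingSolver as ℤ-Solver
open import Data.List.Base as List using (List; []; _∷_; _++_; allFin; upTo; filter)
import Data.List.Properties as Listₚ
open import Data.List.Relation.Unary.All as All using (All; []; _∷_)
import Data.List.Relation.Unary.All.Properties as Allₚ
open import Data.Maybe.Base as Maybe using (maybe′)
import Data.Nat.Base as ℕ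
open import Data.Nat.Base using (ℕ; zero; suc)
import Data.Nat.Properties as ℕₚ
open import Data.Nat.Properties using (_≤?_)
open import Data.Product.Base using (∃; _×_; _,_; proj₁; proj₂; Σ)
open import Data.Sum.Base using (_⊎_; inj₁; inj₂; [_,_]′)
open import Data.Unit.Base using (tt)
import Data.Vec.Base as Vec
open import Data.Vec.Functional using (Vector; insertAt; removeAt; foldr; head; tail)
import Data.Vec.Functional as F
import Data.Vec.Functional.Properties as Fₚ
open import Function.Base using (_∘_; id; const)
open import Level using (0ℓ; lift)
open import Relation.Binary.Definitions using (Tri; tri<; tri≈; tri>)
open import Relation.Binary.PropositionalEquality as ≡ using (_≡_; _≢_)
import Relation.Binary.Reasoning.Setoid as SetoidReasoning
open import Relation.Binary.Structures using (IsStrictTotalOrder)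
open import Relation.Nullary.Decidable using (Dec; yes; no; ¬?; map′; dec⇒maybe)
open import Relation.Nullary.Negation using (¬_)
open import Relation.Unary using (Pred; _⊆_; _≐_; _∩_; _∪_; ∁; Satisfiable; U; Decidable)

-- `χ` and `mComp` pick a complex and a family of components by excluded middle. Hence every complex
-- supported on a set must be shown to give the same number, and for the sets in the formula a
-- complex must be constructed, since otherwise the default 0 would be taken. The number is handled
-- as an integral `∫` of an integer-valued function constant on the cells of an arrangement: for a
-- fixed arrangement linearity is immediate, so inclusion-exclusion need only be checked at each
-- point, and the geometric input is the effect of adding one hyperplane. That input is stated for
-- convex sets whose segments can be prolonged slightly beyond their ends. This condition replaces
-- relative topology, is kept by cutting with a hyperplane, and holds for cells, relative interiors
-- of faces and linear regions alike. The terms absent from the formula are k = 0, where the empty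
-- intersection is the whole space and contributes (-1)^d, and k = 1, where each hypersurface
-- contributes through its number of regions; together they make up `fComp`. The sign (-1)^(k+d) is
-- (-1)^k times the inverse of (-1)^d.

-- Ring solver with integer coefficients over a commutative ring

module IntegerCoefficientSolver {c ℓ} (R : CommutativeRing c ℓ) where
  open CommutativeRing R
  open RingProperties ring
  open Mult semiring using () renaming (_×_ to _·_; ×-homo-+ to ·-homo-+; ×1-homo-* to ·1-homo-*)
  open SetoidReasoning setoid

  private
    ⟦_⟧ : ℤ.ℤ → Carrier
    ⟦ ℤ.+ n      ⟧ = n · 1#
    ⟦ ℤ.-[1+ n ] ⟧ = - (suc n · 1#)

    -homo : ∀ i → ⟦ ℤ.- i ⟧ ≈ - ⟦ i ⟧
    -homo (ℤ.+ zero)  = sym -0#≈0#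
    -homo ℤ.+[1+ n ]  = refl
    -homo ℤ.-[1+ n ]  = sym (-‿involutive _)

    -cancel : ∀ x y z → (x + y) - (x + z) ≈ y - z
    -cancel x y z = begin
      (x + y) - (x + z)      ≈⟨ +-congˡ (-‿+-comm x z) ⟨
      (x + y) + (- x + - z)  ≈⟨ +-assoc _ _ _ ⟨
      ((x + y) + - x) + - z  ≈⟨ +-congʳ (xyx⁻¹≈y x y) ⟩
      y - z                  ∎

    ⊖-homo : ∀ m n → ⟦ m ℤ.⊖ n ⟧ ≈ m · 1# - n · 1#
    ⊖-homo zero zero = sym (-‿inverseʳ 0#)
    ⊖-homo zero (suc n) = sym (+-identityˡ _)
    ⊖-homo (suc m) zero = sym (trans (+-congˡ -0#≈0#) (+-identityʳ _))
    ⊖-homo (suc m) (suc n) = begin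
      ⟦ suc m ℤ.⊖ suc n ⟧               ≡⟨ ≡.cong ⟦_⟧ (ℤₚ.[1+m]⊖[1+n]≡m⊖n m n) ⟩
      ⟦ m ℤ.⊖ n ⟧                       ≈⟨ ⊖-homo m n ⟩
      m · 1# - n · 1#                   ≈⟨ -cancel 1# _ _ ⟨
      (1# + m · 1#) - (1# + n · 1#)     ≈⟨ +-cong (·-homo-+ 1# 1 m) (-‿cong (·-homo-+ 1# 1 n)) ⟨
      suc m · 1# - suc n · 1#           ∎

    +-homo : ∀ i j → ⟦ i ℤ.+ j ⟧ ≈ ⟦ i ⟧ + ⟦ j ⟧
    +-homo (ℤ.+ m) (ℤ.+ n) = ·-homo-+ 1# m n
    +-homo (ℤ.+ m) ℤ.-[1+ n ] = ⊖-homo m (suc n)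
    +-homo ℤ.-[1+ m ] (ℤ.+ n) = trans (⊖-homo n (suc m)) (+-comm _ _)
    +-homo ℤ.-[1+ m ] ℤ.-[1+ n ] = begin
      ⟦ ℤ.- ℤ.+[1+ m ] ℤ.+ ℤ.- ℤ.+[1+ n ] ⟧  ≡⟨ ≡.cong ⟦_⟧ (ℤₚ.neg-distrib-+ ℤ.+[1+ m ] ℤ.+[1+ n ]) ⟨
      - ((suc m ℕ.+ suc n) · 1#)               ≈⟨ -‿cong (·-homo-+ 1# (suc m) (suc n)) ⟩
      - (suc m · 1# + suc n · 1#)            ≈⟨ -‿+-comm _ _ ⟨
      - (suc m · 1#) - (suc n · 1#)          ∎

    +*-homo : ∀ m j → ⟦ ℤ.+ m ℤ.* j ⟧ ≈ m · 1# * ⟦ j ⟧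
    +*-homo m (ℤ.+ n) = trans (reflexive (≡.cong ⟦_⟧ (≡.sym (ℤₚ.pos-* m n)))) (·1-homo-* m n)
    +*-homo m ℤ.-[1+ n ] = begin
      ⟦ ℤ.+ m ℤ.* ℤ.-[1+ n ] ⟧      ≡⟨ ≡.cong ⟦_⟧ (ℤₚ.neg-distribʳ-* (ℤ.+ m) ℤ.+[1+ n ]) ⟨
      ⟦ ℤ.- (ℤ.+ m ℤ.* ℤ.+[1+ n ]) ⟧  ≈⟨ -homo (ℤ.+ m ℤ.* ℤ.+[1+ n ]) ⟩
      - ⟦ ℤ.+ m ℤ.* ℤ.+[1+ n ] ⟧    ≈⟨ -‿cong (+*-homo m ℤ.+[1+ n ]) ⟩
      - (m · 1# * (suc n · 1#))     ≈⟨ -‿distribʳ-* _ _ ⟩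
      m · 1# * - (suc n · 1#)       ∎

    *-homo : ∀ i j → ⟦ i ℤ.* j ⟧ ≈ ⟦ i ⟧ * ⟦ j ⟧
    *-homo (ℤ.+ m) j = +*-homo m j
    *-homo ℤ.-[1+ m ] j = begin
      ⟦ ℤ.-[1+ m ] ℤ.* j ⟧          ≡⟨ ≡.cong ⟦_⟧ (ℤₚ.neg-distribˡ-* ℤ.+[1+ m ] j) ⟨
      ⟦ ℤ.- (ℤ.+[1+ m ] ℤ.* j) ⟧    ≈⟨ -homo (ℤ.+[1+ m ] ℤ.* j) ⟩
      - ⟦ ℤ.+[1+ m ] ℤ.* j ⟧        ≈⟨ -‿cong (+*-homo (suc m) j) ⟩
      - (suc m · 1# * ⟦ j ⟧)        ≈⟨ -‿distribˡ-* _ _ ⟩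
      - (suc m · 1#) * ⟦ j ⟧        ∎

    coefficients : RawRing 0ℓ 0ℓ
    coefficients = ℤ.+-*-rawRing

    morphism : coefficients -Raw-AlmostCommutative⟶ fromCommutativeRing R
    morphism = record
      { ⟦_⟧ = ⟦_⟧ ; +-homo = +-homo ; *-homo = *-homo ; -‿homo = -homo
      ; 0-homo = refl ; 1-homo = refl }

  open RingSolver coefficients (fromCommutativeRing R) morphism
    (λ i j → Maybe.map (reflexive ∘ ≡.cong ⟦_⟧) (dec⇒maybe (i ℤₚ.≟ j))) public
    using (solve; _:=_; _:+_; _:*_; _:-_; :-_; con)

-- Ordered field arithmetic and properties of all small positive numbers

module OrderedField (ℝ : CompleteOrderedField) where
  open CompleteOrderedField ℝ hiding (_-_)
  open CommutativeRing commutativeRing public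
    using (_-_; refl; sym; trans; +-cong; +-congˡ; +-congʳ; *-congˡ; *-congʳ; -‿cong;
           +-identityˡ; +-identityʳ; *-identityˡ; *-identityʳ; zeroˡ; zeroʳ; *-comm; +-comm; +-assoc;
           *-assoc; setoid; semiring; reflexive)
  open IsStrictTotalOrder isStrictTotalOrder public
    using (compare; <-resp-≈; irrefl; asym) renaming (trans to <-trans)
  open IntegerCoefficientSolver commutativeRing public
  open SemiringSum semiring public
    using (sum-cong-≋; sum-remove; sum-replicate-zero)
  open SetoidReasoning setoid

  <-respʳ : ∀ {x y z} → y ≈ z → x < y → x < z
  <-respʳ = proj₁ <-resp-≈

  <-respˡ : ∀ {x y z} → y ≈ z → y < x → z < x
  <-respˡ = proj₂ <-resp-≈

  <⇒0<- : ∀ {x y} → x < y → 0# < y - x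
  <⇒0<- {x} {y} x<y = <-respˡ (solve 1 (λ x → x :- x := con ℤ.0ℤ) refl x) (+-monoˡ-< (- x) x<y)

  0<-⇒< : ∀ {x y} → 0# < y - x → x < y
  0<-⇒< {x} {y} p = <-respˡ (+-identityˡ x)
    (<-respʳ (solve 2 (λ x y → y :- x :+ x := y) refl x y) (+-monoˡ-< x p))

  -- The usual route to an inequality below: an expression known to be positive is identified with
  -- `y - x` by the ring solver.
  by-< : ∀ {e x y} → 0# < e → e ≈ y - x → x < y
  by-< p eq = 0<-⇒< (<-respʳ eq p)

  ≤⇒0≤- : ∀ {x y} → x ≤ y → 0# ≤ y - x
  ≤⇒0≤- (inj₁ x<y) = inj₁ (<⇒0<- x<y)
  ≤⇒0≤- {x} {y} (inj₂ x≈y) = inj₂ (trans (solve 1 (λ x → con ℤ.0ℤ := x :- x) refl x) (+-congʳ x≈y))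

  by-≤ : ∀ {e x y} → 0# ≤ e → e ≈ y - x → x ≤ y
  by-≤ (inj₁ p) eq = inj₁ (by-< p eq)
  by-≤ {e} {x} {y} (inj₂ p) eq = inj₂ (begin
    x                  ≈⟨ +-identityʳ x ⟨
    x + 0#             ≈⟨ +-congˡ (trans p eq) ⟩
    x + (y - x)        ≈⟨ solve 2 (λ x y → x :+ (y :- x) := y) refl x y ⟩
    y                  ∎)

  by-≈ : ∀ {e x y} → e ≈ 0# → e ≈ y - x → x ≈ y
  by-≈ {e} {x} {y} p q = begin
    x            ≈⟨ +-identityʳ x ⟨
    x + 0#       ≈⟨ +-congˡ (trans (sym p) q) ⟩
    x + (y - x)  ≈⟨ solve 2 (λ x y → x :+ (y :- x) := y) refl x y ⟩
    y            ∎

  ≤-respʳ : ∀ {x y z} → y ≈ z → x ≤ y → x ≤ z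
  ≤-respʳ eq (inj₁ p) = inj₁ (<-respʳ eq p)
  ≤-respʳ eq (inj₂ p) = inj₂ (trans p eq)

  ≤-respˡ : ∀ {x y z} → y ≈ z → y ≤ x → z ≤ x
  ≤-respˡ eq (inj₁ p) = inj₁ (<-respˡ eq p)
  ≤-respˡ eq (inj₂ p) = inj₂ (trans (sym eq) p)

  ≤-<-trans : ∀ {x y z} → x ≤ y → y < z → x < z
  ≤-<-trans (inj₁ p) q = <-trans p q
  ≤-<-trans (inj₂ p) q = <-respˡ (sym p) q

  <-≤-trans : ∀ {x y z} → x < y → y ≤ z → x < z
  <-≤-trans p (inj₁ q) = <-trans p q
  <-≤-trans p (inj₂ q) = <-respʳ q p

  ≤-trans : ∀ {x y z} → x ≤ y → y ≤ z → x ≤ z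
  ≤-trans (inj₁ p) q = inj₁ (<-≤-trans p q)
  ≤-trans (inj₂ p) q = ≤-respˡ (sym p) q

  ≤⇒≯ : ∀ {x y} → x ≤ y → ¬ (y < x)
  ≤⇒≯ p q = irrefl refl (≤-<-trans p q)

  ≮⇒≥ : ∀ {x y} → ¬ (x < y) → y ≤ x
  ≮⇒≥ {x} {y} p with compare x y
  ... | tri< a _ _ = ⊥-elim (p a)
  ... | tri≈ _ b _ = inj₂ (sym b)
  ... | tri> _ _ c = inj₁ c

  ≤-antisym : ∀ {x y} → x ≤ y → y ≤ x → x ≈ y
  ≤-antisym (inj₂ p) _ = p
  ≤-antisym (inj₁ p) q = ⊥-elim (≤⇒≯ q p)

  ≤-total : ∀ x y → x ≤ y ⊎ y ≤ x
  ≤-total x y with compare x y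
  ... | tri< a _ _ = inj₁ (inj₁ a)
  ... | tri≈ _ b _ = inj₁ (inj₂ b)
  ... | tri> _ _ c = inj₂ (inj₁ c)

  +-nonneg-pos : ∀ {x y} → 0# ≤ x → 0# < y → 0# < x + y
  +-nonneg-pos {x} {y} p q = ≤-<-trans p (by-< q (solve 2 (λ x y → y := x :+ y :- x) refl x y))

  +-pos : ∀ {x y} → 0# < x → 0# < y → 0# < x + y
  +-pos = +-nonneg-pos ∘ inj₁

  +-nonneg : ∀ {x y} → 0# ≤ x → 0# ≤ y → 0# ≤ x + y
  +-nonneg p (inj₁ q) = inj₁ (+-nonneg-pos p q)
  +-nonneg {x} {y} p (inj₂ q) = ≤-respʳ (trans (sym (+-identityʳ x)) (+-congˡ q)) p

  *-nonneg : ∀ {x y} → 0# ≤ x → 0# ≤ y → 0# ≤ x * y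
  *-nonneg (inj₁ p) (inj₁ q) = inj₁ (*-pos p q)
  *-nonneg {x} (inj₁ p) (inj₂ q) = inj₂ (trans (sym (zeroʳ x)) (*-congˡ q))
  *-nonneg {x} {y} (inj₂ p) q = inj₂ (trans (sym (zeroˡ y)) (*-congʳ p))

  neg-pos : ∀ {x} → x < 0# → 0# < - x
  neg-pos {x} p = <-respʳ (+-identityˡ (- x)) (<⇒0<- p)

  neg-neg : ∀ {x} → 0# < x → - x < 0#
  neg-neg {x} p = by-< p (solve 1 (λ x → x := con ℤ.0ℤ :- (:- x)) refl x)

  recip : ∀ {x} → ¬ (x ≈ 0#) → ∃ λ y → x * y ≈ 1#
  recip {x} x≉0 = let y , _ , xy = invertible x x≉0 in y , xy

  <⇒≉ : ∀ {x y} → x < y → ¬ (x ≈ y)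
  <⇒≉ p q = irrefl q p

  0<⇒≉0 : ∀ {x} → 0# < x → ¬ (x ≈ 0#)
  0<⇒≉0 p q = irrefl (sym q) p

  recip-pos : ∀ {x} → 0# < x → ∃ λ y → (0# < y) × (x * y ≈ 1#)
  recip-pos {x} 0<x with recip (0<⇒≉0 0<x)
  ... | y , xy≈1 with compare 0# y
  ...   | tri< 0<y _ _ = y , 0<y , xy≈1
  ...   | tri≈ _ 0≈y _ = ⊥-elim (irrefl (trans (sym (zeroʳ x)) (trans (*-congˡ 0≈y) xy≈1)) 0<1)
  ...   | tri> _ _ y<0 = ⊥-elim (asym 0<1 (by-< (*-pos 0<x (neg-pos y<0)) (begin
            x * - y     ≈⟨ solve 2 (λ x y → x :* (:- y) := con ℤ.0ℤ :- x :* y) refl x y ⟩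
            0# - x * y  ≈⟨ +-congˡ (-‿cong xy≈1) ⟩
            0# - 1#     ∎)))

  *-cancelˡ-0 : ∀ {x y} → ¬ (x ≈ 0#) → x * y ≈ 0# → y ≈ 0#
  *-cancelˡ-0 {x} {y} x≉0 xy≈0 = let z , xz≈1 = recip x≉0 in begin
    y              ≈⟨ *-identityˡ y ⟨
    1# * y         ≈⟨ *-congʳ xz≈1 ⟨
    (x * z) * y    ≈⟨ solve 3 (λ x y z → (x :* z) :* y := z :* (x :* y)) refl x y z ⟩
    z * (x * y)    ≈⟨ *-congˡ xy≈0 ⟩
    z * 0#         ≈⟨ zeroʳ z ⟩
    0#             ∎

  _≈?_ : ∀ x y → Dec (x ≈ y)
  x ≈? y with compare x y
  ... | tri< _ b _ = no b
  ... | tri≈ _ b _ = yes b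
  ... | tri> _ b _ = no b

  half : ∃ λ h → (0# < h) × (h < 1#) × (h + h ≈ 1#)
  half = let h , 0<h , eq = recip-pos (+-pos 0<1 0<1)
             2h : h + h ≈ 1#
             2h = trans (sym (solve 1 (λ h → (con ℤ.1ℤ :+ con ℤ.1ℤ) :* h := h :+ h) refl h)) eq
         in h , 0<h , by-< 0<h (trans (solve 1 (λ h → h := h :+ h :- h) refl h) (+-congʳ 2h)) , 2h

  -- For all sufficiently small positive t.
  Small : (Carrier → Set) → Set
  Small Q = ∃ λ δ → (0# < δ) × (∀ t → 0# < t → t < δ → Q t)

  small-map : ∀ {P Q : Carrier → Set} → (∀ t → 0# < t → P t → Q t) → Small P → Small Q
  small-map f (δ , 0<δ , p) = δ , 0<δ , λ t 0<t t<δ → f t 0<t (p t 0<t t<δ)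

  small-∧ : ∀ {P Q : Carrier → Set} → Small P → Small Q → Small (λ t → P t × Q t)
  small-∧ (δ , 0<δ , p) (ε , 0<ε , q) with ≤-total δ ε
  ... | inj₁ δ≤ε = δ , 0<δ , λ t 0<t t<δ → p t 0<t t<δ , q t 0<t (<-≤-trans t<δ δ≤ε)
  ... | inj₂ ε≤δ = ε , 0<ε , λ t 0<t t<ε → p t 0<t (<-≤-trans t<ε ε≤δ) , q t 0<t t<ε

  small-true : ∀ {P : Carrier → Set} → (∀ t → 0# < t → P t) → Small P
  small-true p = 1# , 0<1 , λ t 0<t _ → p t 0<t

  small-∀ : ∀ {n} {P : Fin n → Carrier → Set} → (∀ i → Small (P i)) → Small (λ t → ∀ i → P i t)
  small-∀ {zero} p = small-true λ _ _ ()
  small-∀ {suc n} p = small-map (λ { t _ (p₀ , ps) zero → p₀ ; t _ (p₀ , ps) (suc i) → ps i })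
    (small-∧ (p zero) (small-∀ (p ∘ suc)))

  small-witness : ∀ {P : Carrier → Set} → Small P → ∃ λ t → (0# < t) × P t
  small-witness (δ , 0<δ , p) =
    let h , 0<h , h<1 , _ = half
        hδ = *-pos 0<h 0<δ
    in h * δ , hδ , p (h * δ) hδ (by-< (*-pos (<⇒0<- h<1) 0<δ)
         (solve 2 (λ h δ → (con ℤ.1ℤ :- h) :* δ := δ :- h :* δ) refl h δ))

  small-< : ∀ {ε} → 0# < ε → Small (_< ε)
  small-< {ε} 0<ε = ε , 0<ε , λ _ _ t<ε → t<ε

  -- An affine function that is positive at 0 stays so: everywhere for nonnegative slope, and up to
  -- its zero `a * c` for slope `b < 0`, where `c` inverts `- b`.
  small-pos : ∀ {a} → 0# < a → ∀ b → Small (λ t → 0# < a + t * b)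
  small-pos {a} 0<a b with compare b 0#
  ... | tri≈ _ b≈0 _ = small-true λ t _ →
          <-respʳ (trans (sym (+-identityʳ a)) (+-congˡ (sym (trans (*-congˡ b≈0) (zeroʳ t))))) 0<a
  ... | tri> _ _ 0<b = small-true λ t 0<t → +-pos 0<a (*-pos 0<t 0<b)
  ... | tri< b<0 _ _ = let c , 0<c , bc≈1 = recip-pos (neg-pos b<0) in
          a * c , *-pos 0<a 0<c , λ t 0<t t<ac → <-respʳ (begin
            - b * (a * c - t)      ≈⟨ solve 4 (λ a b c t → (:- b) :* (a :* c :- t) := a :* ((:- b) :* c) :+ t :* b) refl a b c t ⟩
            a * (- b * c) + t * b  ≈⟨ +-congʳ (trans (*-congˡ bc≈1) (*-identityʳ a)) ⟩
            a + t * b              ∎) (*-pos (neg-pos b<0) (<⇒0<- t<ac))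

-- Affine forms, segments and affine independence

module AffineGeometry (em : ExcludedMiddle 0ℓ) (ℝ : CompleteOrderedField) where
  open CompleteOrderedField ℝ hiding (_-_)
  open OrderedField ℝ public
  open Euclidean ℝ public
  open SetoidReasoning setoid

  ¬¬-elim : ∀ {P : Set} → ¬ ¬ P → P
  ¬¬-elim {P} ¬¬p with em {P}
  ... | yes p = p
  ... | no ¬p = ⊥-elim (¬¬p ¬p)

  ⟨⟩-cong : ∀ {d} (b : Point d) {x y : Point d} → (∀ i → x i ≈ y i) → ⟨ b , x ⟩ ≈ ⟨ b , y ⟩
  ⟨⟩-cong b x≈y = sum-cong-≋ λ i → *-congˡ (x≈y i)

  ⟨⟩-zeroʳ : ∀ {d} (b : Point d) → ⟨ b , (λ _ → 0#) ⟩ ≈ 0#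
  ⟨⟩-zeroʳ {d} b = trans (sum-cong-≋ λ i → zeroʳ (b i)) (sum-replicate-zero d)

  ⟨⟩-linear : ∀ {d} (b : Point d) s x y → ⟨ b , (λ j → s * x j + y j) ⟩ ≈ s * ⟨ b , x ⟩ + ⟨ b , y ⟩
  ⟨⟩-linear {zero} b s x y = solve 1 (λ s → con ℤ.0ℤ := s :* con ℤ.0ℤ :+ con ℤ.0ℤ) refl s
  ⟨⟩-linear {suc d} b s x y = trans (+-congˡ (⟨⟩-linear (tail b) s (tail x) (tail y)))
    (solve 6 (λ b s x y X Y → b :* (s :* x :+ y) :+ (s :* X :+ Y) := s :* (b :* x :+ X) :+ (b :* y :+ Y)) refl
      (head b) s (head x) (head y) _ _)

  -- Negative parameters are points of the prolongation beyond `x`, by which relative openness is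
  -- expressed below.
  line : ∀ {d} → Point d → Point d → Carrier → Point d
  line x y t i = x i + t * (y i - x i)

  Form : ℕ → Set
  Form d = Point d × Carrier

  eval : ∀ {d} → Form d → Point d → Carrier
  eval (b , a) x = ⟨ b , x ⟩ + a

  eval-cong : ∀ {d} (h : Form d) {x y} → (∀ i → x i ≈ y i) → eval h x ≈ eval h y
  eval-cong (b , a) x≈y = +-congʳ (⟨⟩-cong b x≈y)

  ⟨⟩-line : ∀ {d} (b : Point d) x y t → ⟨ b , line x y t ⟩ ≈ ⟨ b , x ⟩ + t * (⟨ b , y ⟩ - ⟨ b , x ⟩)
  ⟨⟩-line {zero} b x y t = solve 1 (λ t → con ℤ.0ℤ := con ℤ.0ℤ :+ t :* (con ℤ.0ℤ :- con ℤ.0ℤ)) refl t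
  ⟨⟩-line {suc d} b x y t = trans (+-congˡ (⟨⟩-line (tail b) (tail x) (tail y) t))
    (solve 6 (λ b x y t X Y → b :* (x :+ t :* (y :- x)) :+ (X :+ t :* (Y :- X))
                := b :* x :+ X :+ t :* (b :* y :+ Y :- (b :* x :+ X))) refl
      (head b) (head x) (head y) t _ _)

  eval-line : ∀ {d} (h : Form d) x y t → eval h (line x y t) ≈ eval h x + t * (eval h y - eval h x)
  eval-line (b , a) x y t = trans (+-congʳ (⟨⟩-line b x y t))
    (solve 4 (λ X Y t a → X :+ t :* (Y :- X) :+ a := X :+ a :+ t :* (Y :+ a :- (X :+ a))) refl _ _ t a)

  negate : ∀ {d} → Form d → Form d
  negate (b , a) = (λ i → - b i) , - a

  ⟨⟩-neg : ∀ {d} (b x : Point d) → ⟨ (λ i → - b i) , x ⟩ ≈ - ⟨ b , x ⟩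
  ⟨⟩-neg {zero} b x = solve 0 (con ℤ.0ℤ := :- con ℤ.0ℤ) refl
  ⟨⟩-neg {suc d} b x = trans (+-congˡ (⟨⟩-neg (tail b) (tail x)))
    (solve 3 (λ b x X → (:- b) :* x :- X := :- (b :* x :+ X)) refl (head b) (head x) _)

  eval-negate : ∀ {d} (h : Form d) x → eval (negate h) x ≈ - eval h x
  eval-negate (b , a) x = trans (+-congʳ (⟨⟩-neg b x)) (solve 2 (λ X a → :- X :- a := :- (X :+ a)) refl _ a)

  ⟨⟩-+ : ∀ {d} (b c x : Point d) → ⟨ (λ i → b i + c i) , x ⟩ ≈ ⟨ b , x ⟩ + ⟨ c , x ⟩
  ⟨⟩-+ {zero} b c x = sym (+-identityˡ 0#)
  ⟨⟩-+ {suc d} b c x = trans (+-congˡ (⟨⟩-+ (tail b) (tail c) (tail x)))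
    (solve 5 (λ b c x B C → (b :+ c) :* x :+ (B :+ C) := b :* x :+ B :+ (c :* x :+ C)) refl
      (head b) (head c) (head x) _ _)

  _⊕_ _⊖_ : ∀ {d} → Form d → Form d → Form d
  (b , a) ⊕ (b′ , a′) = (λ i → b i + b′ i) , a + a′
  h ⊖ k = h ⊕ negate k

  eval-⊕ : ∀ {d} (h k : Form d) x → eval (h ⊕ k) x ≈ eval h x + eval k x
  eval-⊕ (b , a) (b′ , a′) x = trans (+-congʳ (⟨⟩-+ b b′ x))
    (solve 4 (λ B C a a′ → B :+ C :+ (a :+ a′) := B :+ a :+ (C :+ a′)) refl _ _ a a′)

  eval-⊖ : ∀ {d} (h k : Form d) x → eval (h ⊖ k) x ≈ eval h x - eval k x
  eval-⊖ h k x = trans (eval-⊕ h (negate k) x) (+-congˡ (eval-negate k x))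

  sum-insertAt : ∀ {n} (t : Vector Carrier n) i a (w : Vector Carrier (suc n)) →
    sum (λ k → insertAt t i a k * w k) ≈ a * w i + sum (λ k → t k * w (punchIn i k))
  sum-insertAt t i a w = trans (sum-remove {i = i} (λ k → insertAt t i a k * w k))
    (+-cong (*-congʳ (reflexive (Fₚ.insertAt-lookup t i a)))
            (sum-cong-≋ λ k → *-congʳ (reflexive (Fₚ.insertAt-punchIn t i a k))))

  -- Gaussian elimination: a relation `t` among vectors reduced by the pivot `y` becomes one among
  -- the unreduced vectors once the pivot gets the coefficient `- sum (λ k → t k * s k)`.
  sum-eliminate : ∀ {n} (t x s : Vector Carrier n) y →
    sum (λ k → t k * (x k - s k * y)) ≈ - sum (λ k → t k * s k) * y + sum (λ k → t k * x k)
  sum-eliminate {zero} t x s y = solve 1 (λ y → con ℤ.0ℤ := :- con ℤ.0ℤ :* y :+ con ℤ.0ℤ) refl y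
  sum-eliminate {suc n} t x s y = trans (+-congˡ (sum-eliminate (tail t) (tail x) (tail s) y))
    (solve 6 (λ t x s y S X → t :* (x :- s :* y) :+ (:- S :* y :+ X) := :- (t :* s :+ S) :* y :+ (t :* x :+ X))
      refl (head t) (head x) (head s) y _ _)

  sum-zero : ∀ {n} {w : Vector Carrier n} → (∀ i → w i ≈ 0#) → sum w ≈ 0#
  sum-zero {n} w≈0 = trans (sum-cong-≋ w≈0) (sum-replicate-zero n)

  -- Induction by eliminating coordinate `zero` with a pivot. If no vector has a nonzero coordinate
  -- `zero`, one vector is left out with coefficient 0 instead.
  linearly-dependent : ∀ n (v : Fin (suc n) → Point n) →
    ∃ λ (t : Vector Carrier (suc n)) → (∃ λ i → ¬ (t i ≈ 0#)) × (∀ j → sum (λ i → t i * v i j) ≈ 0#)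
  linearly-dependent zero v = (λ _ → 1#) , (zero , 0<⇒≉0 0<1) , λ ()
  linearly-dependent (suc n) v with Finₚ.any? (λ i → ¬? (v i zero ≈? 0#))
  ... | no none =
    let t , (i , tᵢ≉0) , eq = linearly-dependent n (λ i → tail (v (suc i))) in
    (0# F.∷ t) , (suc i , tᵢ≉0) , λ
      { zero → sum-zero λ i → trans (*-congˡ (¬¬-elim λ p → none (i , p))) (zeroʳ ((0# F.∷ t) i))
      ; (suc j) → trans (+-cong (zeroˡ _) (eq j)) (+-identityˡ 0#) }
  ... | yes (i , vᵢ≉0) = insertAt t i a , (punchIn i k₀ , nonzero) , λ j →
      trans (sum-insertAt t i a (λ k → v k j)) (trans (sym (sum-eliminate t (λ k → u k j) s (v i j))) (reduced j))
    where
    c = proj₁ (recip vᵢ≉0)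
    u : Fin (suc n) → Point (suc n)
    u k = v (punchIn i k)
    s : Fin (suc n) → Carrier
    s k = u k zero * c
    w : Fin (suc n) → Point (suc n)
    w k j = u k j - s k * v i j
    w₀ : ∀ k → w k zero ≈ 0#
    w₀ k = begin
      u k zero - (u k zero * c) * v i zero  ≈⟨ solve 3 (λ u c v → u :- (u :* c) :* v := u :- u :* (v :* c)) refl _ c _ ⟩
      u k zero - u k zero * (v i zero * c)  ≈⟨ +-congˡ (-‿cong (*-congˡ (proj₂ (recip vᵢ≉0)))) ⟩
      u k zero - u k zero * 1#              ≈⟨ solve 1 (λ u → u :- u :* con ℤ.1ℤ := con ℤ.0ℤ) refl _ ⟩
      0#                                    ∎
    IH = linearly-dependent n (λ k → tail (w k))
    t = proj₁ IH
    k₀ = proj₁ (proj₁ (proj₂ IH))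
    a = - sum (λ k → t k * s k)
    nonzero : ¬ (insertAt t i a (punchIn i k₀) ≈ 0#)
    nonzero p = proj₂ (proj₁ (proj₂ IH)) (trans (sym (reflexive (Fₚ.insertAt-punchIn t i a k₀))) p)
    reduced : ∀ j → sum (λ k → t k * w k j) ≈ 0#
    reduced zero = sum-zero λ k → trans (*-congˡ (w₀ k)) (zeroʳ (t k))
    reduced (suc j) = proj₂ (proj₂ IH) j

  hom : ∀ {d} → Point d → Point (suc d)
  hom x = 1# F.∷ x

  hom-line : ∀ {d} (x y : Point d) s j → hom (line x y s) j ≈ line (hom x) (hom y) s j
  hom-line x y s zero = solve 2 (λ o s → o := o :+ s :* (o :- o)) refl 1# s
  hom-line x y s (suc j) = refl

  Null : ∀ {d n} → Vector Carrier n → Vector (Point d) n → Set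
  Null t p = ∀ j → sum (λ i → t i * hom (p i) j) ≈ 0#

  -- Affine independence of p is linear independence of the vectors (1 , p i).
  Independent : ∀ {d n} → Vector (Point d) n → Set
  Independent p = ∀ t → Null t p → ∀ i → t i ≈ 0#

  sum-*1 : ∀ {n} (t : Vector Carrier n) → sum (λ i → t i * 1#) ≈ sum t
  sum-*1 t = sum-cong-≋ λ i → *-identityʳ (t i)

  independent⇒affine : ∀ {d n} (p : Vector (Point d) n) → Independent p → AffinelyIndependent p
  independent⇒affine p ind t Σt≈0 Σtp≈0 = ind t λ { zero → trans (sum-*1 t) Σt≈0 ; (suc j) → Σtp≈0 j }

  affine⇒independent : ∀ {d n} (p : Vector (Point d) n) → AffinelyIndependent p → Independent p
  affine⇒independent p aff t null = aff t (trans (sym (sum-*1 t)) (null zero)) (null ∘ suc)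

  ¬independent : ∀ {d} (p : Vector (Point d) (suc (suc d))) → ¬ Independent p
  ¬independent p ind = let t , (i , tᵢ≉0) , null = linearly-dependent _ (hom ∘ p) in tᵢ≉0 (ind t null i)

  -- An affine form is linear in the homogeneous coordinates `hom x`, with coefficient vector
  -- `a F.∷ b`, so it annihilates every affine relation.
  null-form : ∀ {d n} (h : Form d) (t : Vector Carrier n) p → Null t p → sum (λ i → t i * eval h (p i)) ≈ 0#
  null-form (b , a) t p null = begin
    sum (λ i → t i * (⟨ b , p i ⟩ + a))                  ≈⟨ expand t p ⟩
    ⟨ a F.∷ b , (λ j → sum (λ i → t i * hom (p i) j)) ⟩     ≈⟨ ⟨⟩-cong (a F.∷ b) null ⟩
    ⟨ a F.∷ b , (λ _ → 0#) ⟩                               ≈⟨ ⟨⟩-zeroʳ (a F.∷ b) ⟩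
    0#                                                   ∎
    where
    expand : ∀ {n} (t : Vector Carrier n) p →
      sum (λ i → t i * (⟨ b , p i ⟩ + a)) ≈ ⟨ a F.∷ b , (λ j → sum (λ i → t i * hom (p i) j)) ⟩
    expand {zero} t p = sym (⟨⟩-zeroʳ (a F.∷ b))
    expand {suc n} t p = begin
      t zero * (⟨ b , p zero ⟩ + a) + sum (λ i → t (suc i) * (⟨ b , p (suc i) ⟩ + a))
        ≈⟨ +-cong (*-congˡ (solve 2 (λ B a → B :+ a := a :* con ℤ.1ℤ :+ B) refl _ a)) (expand (tail t) (tail p)) ⟩
      t zero * ⟨ a F.∷ b , hom (p zero) ⟩ + ⟨ a F.∷ b , (λ j → sum (λ i → t (suc i) * hom (p (suc i)) j)) ⟩
        ≈⟨ ⟨⟩-linear (a F.∷ b) (t zero) (hom (p zero)) (λ j → sum (λ i → t (suc i) * hom (p (suc i)) j)) ⟨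
      ⟨ a F.∷ b , (λ j → sum (λ i → t i * hom (p i) j)) ⟩ ∎

  independent-tail : ∀ {d n} (p : Vector (Point d) (suc n)) → Independent p → Independent (tail p)
  independent-tail p ind t null i = ind (0# F.∷ t) (λ j → trans (+-cong (zeroˡ _) (null j)) (+-identityˡ 0#)) (suc i)

  -- In an affine relation the coefficients sum to zero, so the contributions of the centre `q`
  -- cancel and only the factor `s` remains.
  independent-homothety : ∀ {d n} (q : Point d) {s} (p : Vector (Point d) n) → ¬ (s ≈ 0#) →
    Independent p → Independent (λ i → line q (p i) s)
  independent-homothety q {s} p s≉0 ind t null = ind t λ j → *-cancelˡ-0 s≉0 (begin
      s * sum (λ i → t i * hom (p i) j)
        ≈⟨ solve 3 (λ q s X → s :* X := q :* (con ℤ.1ℤ :- s) :* con ℤ.0ℤ :+ s :* X) refl (hom q j) s _ ⟩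
      hom q j * (1# - s) * 0# + s * sum (λ i → t i * hom (p i) j)
        ≈⟨ +-congʳ (*-congˡ (trans (sym (sum-*1 t)) (null zero))) ⟨
      hom q j * (1# - s) * sum t + s * sum (λ i → t i * hom (p i) j)
        ≈⟨ expand (hom q j) t (λ i → hom (p i) j) ⟨
      sum (λ i → t i * line (hom q) (hom (p i)) s j)
        ≈⟨ sum-cong-≋ (λ i → *-congˡ (hom-line q (p i) s j)) ⟨
      sum (λ i → t i * hom (line q (p i) s) j)
        ≈⟨ null j ⟩
      0# ∎)
    where
    expand : ∀ {n} q (t x : Vector Carrier n) →
      sum (λ i → t i * (q + s * (x i - q))) ≈ q * (1# - s) * sum t + s * sum (λ i → t i * x i)
    expand {zero} q t x = solve 2 (λ q s → con ℤ.0ℤ := q :* (con ℤ.1ℤ :- s) :* con ℤ.0ℤ :+ s :* con ℤ.0ℤ) refl q s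
    expand {suc n} q t x = trans (+-congˡ (expand q (tail t) (tail x)))
      (solve 6 (λ q s t x T X → t :* (q :+ s :* (x :- q)) :+ (q :* (con ℤ.1ℤ :- s) :* T :+ s :* X)
         := q :* (con ℤ.1ℤ :- s) :* (t :+ T) :+ s :* (t :* x :+ X)) refl q s (head t) (head x) _ _)

  -- The ratio may vary with the point, at the price that `q` belongs to the independent family: a
  -- relation among the moved points is one of `q F.∷ p` with coefficients `t i * s i` and the rest
  -- on `q`.
  independent-project : ∀ {d n} (q : Point d) (s : Vector Carrier n) (p : Vector (Point d) n) →
    (∀ i → ¬ (s i ≈ 0#)) → Independent (q F.∷ p) → Independent (λ i → line q (p i) (s i))
  independent-project q s p s≉0 ind t null i =
    *-cancelˡ-0 (s≉0 i) (trans (*-comm _ _) (ind (sum (λ i → t i * (1# - s i)) F.∷ λ i → t i * s i) null′ (suc i)))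
    where
    expand : ∀ {n} q (s t x : Vector Carrier n) →
      sum (λ i → t i * (1# - s i)) * q + sum (λ i → t i * s i * x i) ≈ sum (λ i → t i * (q + s i * (x i - q)))
    expand {zero} q s t x = solve 1 (λ q → con ℤ.0ℤ :* q :+ con ℤ.0ℤ := con ℤ.0ℤ) refl q
    expand {suc n} q s t x = trans
      (solve 6 (λ q s t x T X → (t :* (con ℤ.1ℤ :- s) :+ T) :* q :+ (t :* s :* x :+ X)
         := t :* (q :+ s :* (x :- q)) :+ (T :* q :+ X)) refl q (head s) (head t) (head x) _ _)
      (+-congˡ (expand q (tail s) (tail t) (tail x)))
    null′ : Null (sum (λ i → t i * (1# - s i)) F.∷ λ i → t i * s i) (q F.∷ p)
    null′ j = trans (expand (hom q j) s t (λ i → hom (p i) j))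
      (trans (sum-cong-≋ λ i → *-congˡ (sym (hom-line q (p i) (s i) j))) (null j))

  -- Applying `h` to a relation leaves only the term of `q`.
  independent-∷ : ∀ {d n} (h : Form d) (q : Point d) (p : Vector (Point d) n) → ¬ (eval h q ≈ 0#) →
    (∀ i → eval h (p i) ≈ 0#) → Independent p → Independent (q F.∷ p)
  independent-∷ h q p hq≉0 hp≈0 ind t null = λ { zero → t₀≈0 ; (suc i) → ind (tail t) null′ i }
    where
    t₀≈0 : t zero ≈ 0#
    t₀≈0 = *-cancelˡ-0 hq≉0 (begin
      eval h q * t zero         ≈⟨ solve 2 (λ a b → a :* b := b :* a :+ con ℤ.0ℤ) refl _ _ ⟩
      t zero * eval h q + 0#    ≈⟨ +-congˡ (sum-zero λ i → trans (*-congˡ (hp≈0 i)) (zeroʳ (t (suc i)))) ⟨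
      t zero * eval h q + sum (λ i → t (suc i) * eval h (p i))  ≈⟨ null-form h t (q F.∷ p) null ⟩
      0#                        ∎)
    null′ : Null (tail t) p
    null′ j = trans (sym (trans (+-congʳ (trans (*-congʳ t₀≈0) (zeroˡ _))) (+-identityˡ _))) (null j)

  -- Steinitz exchange: `q` takes part in a relation with the points `p`, and a point with nonzero
  -- coefficient in it can be replaced by `q`.
  exchange : ∀ {d n} (q : Point d) (p : Vector (Point d) (suc n)) → Independent p → ¬ Independent (q F.∷ p) →
    ∃ λ i → Independent (q F.∷ removeAt p i)
  exchange {n = n} q p ind ¬ind = i , independent
    where
    relation : ∃ λ (T : Vector Carrier (suc (suc n))) → Null T (q F.∷ p) × (∃ λ i → ¬ (T i ≈ 0#))
    relation = ¬¬-elim λ ¬r → ¬ind λ T null i → ¬¬-elim λ Tᵢ≉0 → ¬r (T , null , i , Tᵢ≉0)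
    T = proj₁ relation
    null = proj₁ (proj₂ relation)
    tail-null : T zero ≈ 0# → Null (tail T) p
    tail-null T₀≈0 j = trans (sym (trans (+-congʳ (trans (*-congʳ T₀≈0) (zeroˡ _))) (+-identityˡ _))) (null j)
    T₀≉0 : ¬ (T zero ≈ 0#)
    T₀≉0 T₀≈0 with proj₂ (proj₂ relation)
    ... | zero , Tᵢ≉0 = Tᵢ≉0 T₀≈0
    ... | suc i , Tᵢ≉0 = Tᵢ≉0 (ind (tail T) (tail-null T₀≈0) i)
    -- The coefficients of `T` sum to zero, so that of `q` cannot be the only nonzero one.
    pivot : ∃ λ i → ¬ (T (suc i) ≈ 0#)
    pivot = ¬¬-elim λ none → T₀≉0 (begin
      T zero                                ≈⟨ solve 1 (λ t → t := t :* con ℤ.1ℤ :+ con ℤ.0ℤ) refl _ ⟩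
      T zero * 1# + 0#                      ≈⟨ +-congˡ (sum-zero λ i →
        trans (*-congʳ (¬¬-elim λ Tᵢ≉0 → none (i , Tᵢ≉0))) (zeroˡ 1#)) ⟨
      T zero * 1# + sum (λ i → T (suc i) * 1#)  ≈⟨ null zero ⟩
      0#                                    ∎)
    i = proj₁ pivot
    expand : ∀ {n} u v (a b x : Vector Carrier n) →
      sum (λ k → (u * a k - v * b k) * x k) ≈ u * sum (λ k → a k * x k) - v * sum (λ k → b k * x k)
    expand {zero} u v a b x = solve 2 (λ u v → con ℤ.0ℤ := u :* con ℤ.0ℤ :- v :* con ℤ.0ℤ) refl u v
    expand {suc n} u v a b x = trans (+-congˡ (expand u v (tail a) (tail b) (tail x)))
      (solve 7 (λ u v a b x A B → (u :* a :- v :* b) :* x :+ (u :* A :- v :* B) := u :* (a :* x :+ A) :- v :* (b :* x :+ B))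
        refl u v (head a) (head b) (head x) _ _)
    independent : Independent (q F.∷ removeAt p i)
    independent U nullU = λ { zero → U₀≈0 ; (suc k) → Uₖ≈0 k }
      where
      I = insertAt (tail U) i 0#
      -- Combining the relations `T` and `U` so that `q` drops out leaves a relation of `p`, which
      -- must be trivial.
      V≈0 : ∀ k → U zero * T (suc k) - T zero * I k ≈ 0#
      V≈0 = ind _ λ j → begin
        sum (λ k → (U zero * T (suc k) - T zero * I k) * hom (p k) j)
          ≈⟨ expand (U zero) (T zero) (tail T) I (λ k → hom (p k) j) ⟩
        U zero * sum (λ k → T (suc k) * hom (p k) j) - T zero * sum (λ k → I k * hom (p k) j)
          ≈⟨ +-congˡ (-‿cong (*-congˡ (sum-insertAt (tail U) i 0# (λ k → hom (p k) j)))) ⟩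
        U zero * sum (λ k → T (suc k) * hom (p k) j) -
          T zero * (0# * hom (p i) j + sum (λ k → U (suc k) * hom (p (punchIn i k)) j))
          ≈⟨ solve 6 (λ u t Q P A B → u :* A :- t :* (con ℤ.0ℤ :* P :+ B) := u :* (t :* Q :+ A) :- t :* (u :* Q :+ B)) refl
               (U zero) (T zero) (hom q j) (hom (p i) j) _ _ ⟩
        U zero * (T zero * hom q j + sum (λ k → T (suc k) * hom (p k) j)) -
          T zero * (U zero * hom q j + sum (λ k → U (suc k) * hom (p (punchIn i k)) j))
          ≈⟨ +-cong (*-congˡ (null j)) (-‿cong (*-congˡ (nullU j))) ⟩
        U zero * 0# - T zero * 0#
          ≈⟨ solve 2 (λ u v → u :* con ℤ.0ℤ :- v :* con ℤ.0ℤ := con ℤ.0ℤ) refl _ _ ⟩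
        0# ∎
      U₀≈0 : U zero ≈ 0#
      U₀≈0 = *-cancelˡ-0 (proj₂ pivot) (begin
        T (suc i) * U zero                     ≈⟨ solve 3 (λ a b c → a :* b := b :* a :- c :* con ℤ.0ℤ) refl _ _ (T zero) ⟩
        U zero * T (suc i) - T zero * 0#       ≈⟨ +-congˡ (-‿cong (*-congˡ (reflexive (Fₚ.insertAt-lookup (tail U) i 0#)))) ⟨
        U zero * T (suc i) - T zero * I i      ≈⟨ V≈0 i ⟩
        0#                                     ∎)
      Uₖ≈0 : ∀ k → U (suc k) ≈ 0#
      Uₖ≈0 k = *-cancelˡ-0 T₀≉0 (begin
        T zero * U (suc k)                     ≈⟨ solve 3 (λ a b c → a :* b := con ℤ.0ℤ :* c :- (con ℤ.0ℤ :* c :- a :* b)) refl _ _ (T (suc (punchIn i k))) ⟩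
        0# * T (suc (punchIn i k)) - (0# * T (suc (punchIn i k)) - T zero * U (suc k))
          ≈⟨ +-congˡ (-‿cong (+-cong (*-congʳ U₀≈0) (-‿cong (*-congˡ (reflexive (Fₚ.insertAt-punchIn (tail U) i 0# k)))))) ⟨
        0# * T (suc (punchIn i k)) - (U zero * T (suc (punchIn i k)) - T zero * I (punchIn i k))
          ≈⟨ +-congˡ (-‿cong (V≈0 (punchIn i k))) ⟩
        0# * T (suc (punchIn i k)) - 0#        ≈⟨ solve 1 (λ a → con ℤ.0ℤ :* a :- con ℤ.0ℤ := con ℤ.0ℤ) refl _ ⟩
        0#                                     ∎)

-- Dimension and its behaviour under cutting by a hyperplane

module Dimension (em : ExcludedMiddle 0ℓ) (ℝ : CompleteOrderedField) where
  open CompleteOrderedField ℝ hiding (_-_)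
  open AffineGeometry em ℝ public
  open SetoidReasoning setoid

  record HasIndependent {d} (K : Pred (Point d) 0ℓ) (n : ℕ) : Set where
    constructor family
    field
      points      : Vector (Point d) n
      inside      : ∀ i → K (points i)
      independent : Independent points

  -- HasDimension as a record, so that K can be inferred.
  record Dimension {d} (K : Pred (Point d) 0ℓ) (k : ℕ) : Set where
    constructor dimension
    field
      independent : HasIndependent K (suc k)
      maximal     : ¬ HasIndependent K (suc (suc k))

  open Dimension

  fromDimension : ∀ {d} {K : Pred (Point d) 0ℓ} {k} → Dimension K k → HasDimension K k
  fromDimension (dimension (family p Kp ind) max) =
    (p , Kp , independent⇒affine p ind) , λ q Kq aff → max (family q Kq (affine⇒independent q aff))

  toDimension : ∀ {d} {K : Pred (Point d) 0ℓ} {k} → HasDimension K k → Dimension K k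
  toDimension ((p , Kp , aff) , max) =
    dimension (family p Kp (affine⇒independent p aff)) λ (family q Kq ind) → max q Kq (independent⇒affine q ind)

  hasIndependent-⊆ : ∀ {d} {K L : Pred (Point d) 0ℓ} {n} → K ⊆ L → HasIndependent K n → HasIndependent L n
  hasIndependent-⊆ K⊆L (family p Kp ind) = family p (K⊆L ∘ Kp) ind

  hasIndependent-≤ : ∀ {d} {K : Pred (Point d) 0ℓ} {m n} → m ℕ.≤ n → HasIndependent K n → HasIndependent K m
  hasIndependent-≤ {K = K} m≤n = go (ℕₚ.≤⇒≤′ m≤n)
    where
    go : ∀ {m n} → m ℕ.≤′ n → HasIndependent K n → HasIndependent K m
    go (ℕ.≤′-reflexive ≡.refl) ind = ind
    go (ℕ.≤′-step m≤n) (family p Kp ind) = go m≤n (family (tail p) (Kp ∘ suc) (independent-tail p ind))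

  ¬family : ∀ {d} {K : Pred (Point d) 0ℓ} → ¬ HasIndependent K (suc (suc d))
  ¬family (family p _ ind) = ¬independent p ind

  dimension-≤ : ∀ {d} {K : Pred (Point d) 0ℓ} {k} → Dimension K k → k ℕ.≤ d
  dimension-≤ {d} {K} {k} dim with k ℕₚ.≤? d
  ... | yes k≤d = k≤d
  ... | no k≰d = ⊥-elim (¬family (hasIndependent-≤ (ℕ.s≤s (ℕₚ.≰⇒> k≰d)) (independent dim)))

  dimension-mono : ∀ {d} {K L : Pred (Point d) 0ℓ} {k l} → K ⊆ L → Dimension K k → Dimension L l → k ℕ.≤ l
  dimension-mono {k = k} {l} K⊆L dimK dimL with k ℕₚ.≤? l
  ... | yes k≤l = k≤l
  ... | no k≰l = ⊥-elim (maximal dimL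
    (hasIndependent-≤ (ℕ.s≤s (ℕₚ.≰⇒> k≰l)) (hasIndependent-⊆ K⊆L (independent dimK))))

  dimension-unique : ∀ {d} {K L : Pred (Point d) 0ℓ} {k l} → K ≐ L → Dimension K k → Dimension L l → k ≡ l
  dimension-unique (K⊆L , L⊆K) dimK dimL =
    ℕₚ.≤-antisym (dimension-mono K⊆L dimK dimL) (dimension-mono L⊆K dimL dimK)

  -- No `d + 2` points are independent, so the search downwards from `d` starts at a valid bound; it
  -- ends at the latest with a single point.
  dimension-exists : ∀ {d} {K : Pred (Point d) 0ℓ} → Satisfiable K → ∃ (Dimension K)
  dimension-exists {d} {K} (x , Kx) = search d ¬family
    where
    one : HasIndependent K 1
    one = family (λ _ → x) (λ _ → Kx) λ { t null zero →
      trans (solve 1 (λ t → t := t :* con ℤ.1ℤ :+ con ℤ.0ℤ) refl (t zero)) (null zero) }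
    search : ∀ n → ¬ HasIndependent K (suc (suc n)) → ∃ (Dimension K)
    search zero max = zero , dimension one max
    search (suc n) max with em {HasIndependent K (suc (suc n))}
    ... | yes ind = suc n , dimension ind max
    ... | no ¬ind = search n ¬ind

  -- Finitely many points of `K` can be contracted towards `q` by one common small ratio; they then
  -- lie in `L` and are still independent.
  dimension-dense : ∀ {d} {K L : Pred (Point d) 0ℓ} {k} q → L ⊆ K →
    (∀ p → K p → Small (λ s → L (line q p s))) → Dimension K k → Dimension L k
  dimension-dense q L⊆K near dim =
    let family p Kp ind = independent dim
        s , 0<s , Ls = small-witness (small-∀ λ i → near (p i) (Kp i))
    in dimension (family (λ i → line q (p i) s) Ls (independent-homothety q p (0<⇒≉0 0<s) ind))
         (maximal dim ∘ hasIndependent-⊆ L⊆K)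

  -- `Neg h` is `Pos` of the negated form, so that a statement about the positive side serves both
  -- sides.
  Pos Zero Neg : ∀ {d} → Form d → Pred (Point d) 0ℓ
  Pos h x = 0# < eval h x
  Zero h x = eval h x ≈ 0#
  Neg h = Pos (negate h)

  neg⇒<0 : ∀ {d} (h : Form d) x → Neg h x → eval h x < 0#
  neg⇒<0 h x p = by-< (<-respʳ (eval-negate h x) p) (solve 1 (λ e → :- e := con ℤ.0ℤ :- e) refl _)

  <0⇒neg : ∀ {d} (h : Form d) x → eval h x < 0# → Neg h x
  <0⇒neg h x p = <-respʳ (sym (eval-negate h x)) (neg-pos p)

  side : ∀ {d} (h : Form d) x → Pos h x ⊎ Zero h x ⊎ Neg h x
  side h x with compare (eval h x) 0#
  ... | tri< a _ _ = inj₂ (inj₂ (<0⇒neg h x a))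
  ... | tri≈ _ b _ = inj₂ (inj₁ b)
  ... | tri> _ _ c = inj₁ c

  pos-zero : ∀ {d} (h : Form d) {x} → Pos h x → ¬ Zero h x
  pos-zero h = 0<⇒≉0

  neg-zero : ∀ {d} (h : Form d) {x} → Neg h x → ¬ Zero h x
  neg-zero h {x} p = <⇒≉ (neg⇒<0 h x p)

  pos-neg : ∀ {d} (h : Form d) {x} → Pos h x → ¬ Neg h x
  pos-neg h {x} p q = asym p (neg⇒<0 h x q)

  -- Along the segment `h` is affine with end values `u` and `v`, so its zero is at `u / (u - v)`.
  crossing : ∀ {d} (h : Form d) x y → Pos h x → eval h y < 0# →
    ∃ λ s → (0# < s) × (s < 1#) × Zero h (line x y s)
  crossing h x y hx hy =
    let u = eval h x
        v = eval h y
        r , 0<r , eq = recip-pos (+-pos hx (neg-pos hy))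
    in u * r , *-pos hx 0<r ,
       by-< (*-pos (neg-pos hy) 0<r) (trans (solve 3 (λ u v r → :- v :* r := (u :- v) :* r :- u :* r) refl u v r) (+-congʳ eq)) ,
       (begin
         eval h (line x y (u * r))   ≈⟨ eval-line h x y (u * r) ⟩
         u + u * r * (v - u)         ≈⟨ solve 3 (λ u v r → u :+ u :* r :* (v :- u) := u :- u :* ((u :- v) :* r)) refl u v r ⟩
         u - u * ((u - v) * r)       ≈⟨ +-congˡ (-‿cong (*-congˡ eq)) ⟩
         u - u * 1#                  ≈⟨ solve 1 (λ u → u :- u :* con ℤ.1ℤ := con ℤ.0ℤ) refl u ⟩
         0#                          ∎)

  eval-line-zero : ∀ {d} (h : Form d) x y t → Zero h x → Zero h y → Zero h (line x y t)
  eval-line-zero h x y t hx hy = begin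
    eval h (line x y t)                ≈⟨ eval-line h x y t ⟩
    eval h x + t * (eval h y - eval h x) ≈⟨ +-cong hx (*-congˡ (+-cong hy (-‿cong hx))) ⟩
    0# + t * (0# - 0#)                 ≈⟨ solve 1 (λ t → con ℤ.0ℤ :+ t :* (con ℤ.0ℤ :- con ℤ.0ℤ) := con ℤ.0ℤ) refl t ⟩
    0#                                 ∎

  pos-line : ∀ {d} (h : Form d) x y → Pos h x → Small (λ t → Pos h (line x y t))
  pos-line h x y hx = small-map (λ t _ → <-respʳ (sym (eval-line h x y t))) (small-pos hx (eval h y - eval h x))

  pos-prolong : ∀ {d} (h : Form d) x y → Pos h x → Small (λ t → Pos h (line x y (- t)))
  pos-prolong h x y hx = small-map
    (λ t _ → <-respʳ (trans (solve 3 (λ u v t → u :+ t :* (u :- v) := u :+ (:- t) :* (v :- u)) refl (eval h x) (eval h y) t)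
      (sym (eval-line h x y (- t))))) (small-pos hx (eval h x - eval h y))

  pos-convex : ∀ {d} (h : Form d) x y t → 0# < t → t < 1# → 0# ≤ eval h x → Pos h y → Pos h (line x y t)
  pos-convex h x y t 0<t t<1 hx hy = <-respʳ
    (trans (solve 3 (λ u v t → (con ℤ.1ℤ :- t) :* u :+ t :* v := u :+ t :* (v :- u)) refl (eval h x) (eval h y) t)
      (sym (eval-line h x y t)))
    (+-nonneg-pos (*-nonneg (inj₁ (<⇒0<- t<1)) hx) (*-pos 0<t hy))

  -- For a convex set the second field expresses relative openness without an affine hull or a
  -- topology. Both fields survive intersection with `Pos h` and `Zero h`, so all cells of an
  -- arrangement inherit them.
  record RelativelyOpenConvex {d} (K : Pred (Point d) 0ℓ) : Set where
    field
      convex  : ∀ {x y} → K x → K y → ∀ t → 0# < t → t < 1# → K (line x y t)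
      prolong : ∀ {x y} → K x → K y → Small (λ t → K (line x y (- t)))

  open RelativelyOpenConvex

  roc-Pos : ∀ {d} {K : Pred (Point d) 0ℓ} h → RelativelyOpenConvex K → RelativelyOpenConvex (K ∩ Pos h)
  roc-Pos h roc .convex {x} {y} (Kx , hx) (Ky , hy) t 0<t t<1 =
    convex roc Kx Ky t 0<t t<1 , pos-convex h x y t 0<t t<1 (inj₁ hx) hy
  roc-Pos h roc .prolong {x} {y} (Kx , hx) (Ky , hy) = small-∧ (prolong roc Kx Ky) (pos-prolong h x y hx)

  roc-Zero : ∀ {d} {K : Pred (Point d) 0ℓ} h → RelativelyOpenConvex K → RelativelyOpenConvex (K ∩ Zero h)
  roc-Zero h roc .convex {x} {y} (Kx , hx) (Ky , hy) t 0<t t<1 =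
    convex roc Kx Ky t 0<t t<1 , eval-line-zero h x y t hx hy
  roc-Zero h roc .prolong {x} {y} (Kx , hx) (Ky , hy) =
    small-map (λ t _ Kt → Kt , eval-line-zero h x y (- t) hx hy) (prolong roc Kx Ky)

  dimension-Pos : ∀ {d} {K : Pred (Point d) 0ℓ} {k} h q → RelativelyOpenConvex K → K q → Pos h q →
    Dimension K k → Dimension (K ∩ Pos h) k
  dimension-Pos h q roc Kq hq = dimension-dense q proj₁ λ p Kp →
    small-∧ (1# , 0<1 , convex roc Kq Kp) (pos-line h q p hq)

  -- The dimension drops by at least one because `a`, lying off the hyperplane, extends every
  -- independent family in it. It drops by no more: of `suc k` independent points on the side of `a`
  -- one is exchanged for `b`, and the other `k` are projected from `b` to the hyperplane.
  dimension-Zero : ∀ {d} {K : Pred (Point d) 0ℓ} {k} h a b → RelativelyOpenConvex K →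
    K a → Pos h a → K b → Neg h b → Dimension K k → ∃ λ k′ → (k ≡ suc k′) × Dimension (K ∩ Zero h) k′
  dimension-Zero {d} {K} {k} h a b roc Ka ha Kb hb dim = shift k dim projected
    where
    extend : ∀ {n} → HasIndependent (K ∩ Zero h) n → HasIndependent K (suc n)
    extend (family p Kp ind) = family (a F.∷ p) (λ { zero → Ka ; (suc i) → proj₁ (Kp i) })
      (independent-∷ h a p (0<⇒≉0 ha) (proj₂ ∘ Kp) ind)
    crossed : Satisfiable (K ∩ Zero h)
    crossed = let s , 0<s , s<1 , z = crossing h a b ha (neg⇒<0 h b hb) in
      line a b s , convex roc Ka Kb s 0<s s<1 , z
    projected : HasIndependent (K ∩ Zero h) k
    projected = family (λ l → line b (p′ l) (s l))
      (λ l → convex roc Kb (proj₁ (Kp (punchIn i l))) (s l) (0<s l) (s<1 l) , negate-zero (z l))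
      (independent-project b s p′ (0<⇒≉0 ∘ 0<s) (proj₂ exchanged))
      where
      open HasIndependent (independent (dimension-Pos h a roc Ka ha dim))
        renaming (points to p; inside to Kp; independent to p-independent)
      exchanged = exchange b p p-independent λ ind → maximal dim
        (family (b F.∷ p) (λ { zero → Kb ; (suc i) → proj₁ (Kp i) }) ind)
      i = proj₁ exchanged
      p′ = removeAt p i
      cross : ∀ l → ∃ λ s → (0# < s) × (s < 1#) × Zero (negate h) (line b (p′ l) s)
      cross l = crossing (negate h) b (p′ l) hb (<-respˡ (sym (eval-negate h (p′ l))) (neg-neg (proj₂ (Kp (punchIn i l)))))
      s = proj₁ ∘ cross
      0<s = proj₁ ∘ proj₂ ∘ cross
      s<1 = proj₁ ∘ proj₂ ∘ proj₂ ∘ cross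
      z = proj₂ ∘ proj₂ ∘ proj₂ ∘ cross
      negate-zero : ∀ {x} → Zero (negate h) x → Zero h x
      negate-zero {x} z = trans (solve 1 (λ e → e := :- (:- e)) refl (eval h x))
        (trans (-‿cong (trans (sym (eval-negate h x)) z)) (solve 0 (:- con ℤ.0ℤ := con ℤ.0ℤ) refl))
    shift : ∀ k → Dimension K k → HasIndependent (K ∩ Zero h) k →
      ∃ λ k′ → (k ≡ suc k′) × Dimension (K ∩ Zero h) k′
    shift zero dim _ = ⊥-elim (maximal dim (extend (independent (proj₂ zero-dim))))
      where
      zero-dim : ∃ λ (_ : ℕ) → Dimension (K ∩ Zero h) 0
      zero-dim = let l , diml = dimension-exists crossed in
        l , ≡.subst (Dimension (K ∩ Zero h)) (ℕₚ.n≤0⇒n≡0 (dimension-mono proj₁ diml dim)) diml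
    shift (suc k) dim ind = k , ≡.refl , dimension ind (maximal dim ∘ extend)

-- Finite sums of integers

module FiniteSums where
  ∑-++ : ∀ {A : Set} (xs ys : List A) f → ∑ (xs ++ ys) f ≡ ∑ xs f ℤ.+ ∑ ys f
  ∑-++ [] ys f = ≡.sym (ℤₚ.+-identityˡ _)
  ∑-++ (x ∷ xs) ys f = ≡.trans (≡.cong (λ z → f x ℤ.+ z) (∑-++ xs ys f)) (≡.sym (ℤₚ.+-assoc (f x) _ _))

  ∑-cong : ∀ {A : Set} (xs : List A) {f g : A → ℤ.ℤ} → (∀ x → f x ≡ g x) → ∑ xs f ≡ ∑ xs g
  ∑-cong [] eq = ≡.refl
  ∑-cong (x ∷ xs) eq = ≡.cong₂ ℤ._+_ (eq x) (∑-cong xs eq)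

  ∑-+ : ∀ {A : Set} (xs : List A) (f g : A → ℤ.ℤ) → ∑ xs (λ a → f a ℤ.+ g a) ≡ ∑ xs f ℤ.+ ∑ xs g
  ∑-+ [] f g = ≡.refl
  ∑-+ (x ∷ xs) f g = ≡.trans (≡.cong (λ z → f x ℤ.+ g x ℤ.+ z) (∑-+ xs f g))
    (rearrange (f x) (g x) _ _)
    where
    rearrange : ∀ a b c d → a ℤ.+ b ℤ.+ (c ℤ.+ d) ≡ (a ℤ.+ c) ℤ.+ (b ℤ.+ d)
    rearrange = ℤ-Solver.solve-∀

  ∑-zero : ∀ {A : Set} (xs : List A) {f : A → ℤ.ℤ} → (∀ a → f a ≡ ℤ.0ℤ) → ∑ xs f ≡ ℤ.0ℤ
  ∑-zero [] eq = ≡.refl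
  ∑-zero (x ∷ xs) eq = ≡.cong₂ ℤ._+_ (eq x) (∑-zero xs eq)

  ∑-* : ∀ {A : Set} (xs : List A) c (f : A → ℤ.ℤ) → ∑ xs (λ a → c ℤ.* f a) ≡ c ℤ.* ∑ xs f
  ∑-* [] c f = ≡.sym (ℤₚ.*-zeroʳ c)
  ∑-* (x ∷ xs) c f = ≡.trans (≡.cong (λ z → c ℤ.* f x ℤ.+ z) (∑-* xs c f)) (≡.sym (ℤₚ.*-distribˡ-+ c (f x) _))

  ∑-map : ∀ {A B : Set} (φ : A → B) (xs : List A) (f : B → ℤ.ℤ) → ∑ (List.map φ xs) f ≡ ∑ xs (f ∘ φ)
  ∑-map φ [] f = ≡.refl
  ∑-map φ (x ∷ xs) f = ≡.cong (λ z → f (φ x) ℤ.+ z) (∑-map φ xs f)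

  [_]ℤ : ∀ {P : Set} → Dec P → ℤ.ℤ
  [ yes _ ]ℤ = ℤ.1ℤ
  [ no _ ]ℤ = ℤ.0ℤ

  ∑-filter : ∀ {A : Set} {P : Pred A 0ℓ} (P? : Decidable P) xs (f : A → ℤ.ℤ) →
    ∑ (List.filter P? xs) f ≡ ∑ xs (λ a → [ P? a ]ℤ ℤ.* f a)
  ∑-filter P? [] f = ≡.refl
  ∑-filter P? (x ∷ xs) f with P? x
  ... | yes _ = ≡.cong₂ ℤ._+_ (≡.sym (ℤₚ.*-identityˡ (f x))) (∑-filter P? xs f)
  ... | no _ = ≡.trans (∑-filter P? xs f) (≡.sym (ℤₚ.+-identityˡ _))

  ∑-single : ∀ {A : Set} (φ : ℕ → A) {n N} (f : A → ℤ.ℤ) → n ℕ.< N → (∀ k → n ≢ k → f (φ k) ≡ ℤ.0ℤ) →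
    ∑ (List.applyUpTo φ N) f ≡ f (φ n)
  ∑-single φ {zero} {suc N} f _ f≡0 = ≡.trans (≡.cong (λ z → f (φ 0) ℤ.+ z) (zeros (φ ∘ suc) N λ k → f≡0 (suc k) λ ()))
    (ℤₚ.+-identityʳ _)
    where
    zeros : ∀ (φ : ℕ → _) N → (∀ k → f (φ k) ≡ ℤ.0ℤ) → ∑ (List.applyUpTo φ N) f ≡ ℤ.0ℤ
    zeros φ zero f≡0 = ≡.refl
    zeros φ (suc N) f≡0 = ≡.cong₂ ℤ._+_ (f≡0 0) (zeros (φ ∘ suc) N (f≡0 ∘ suc))
  ∑-single φ {suc n} {suc N} f (ℕ.s≤s n<N) f≡0 = ≡.trans
    (≡.cong₂ ℤ._+_ (f≡0 0 λ ()) (∑-single (φ ∘ suc) f n<N λ k n≢k → f≡0 (suc k) (n≢k ∘ ℕₚ.suc-injective)))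
    (ℤₚ.+-identityˡ _)

  -- Grouping by the value of `φ`, used for faces by dimension and for subsets of indices by size.
  ∑-fibres : ∀ {A : Set} (φ : A → ℕ) N (c : ℕ → ℤ.ℤ) (xs : List A) (f : A → ℤ.ℤ) → (∀ a → φ a ℕ.< N) →
    ∑ (upTo N) (λ k → c k ℤ.* ∑ (List.filter (λ a → φ a ℕₚ.≟ k) xs) f) ≡ ∑ xs (λ a → c (φ a) ℤ.* f a)
  ∑-fibres φ N c [] f φ<N = ∑-zero (upTo N) λ k → ℤₚ.*-zeroʳ (c k)
  ∑-fibres φ N c (a ∷ xs) f φ<N = ≡.trans
    (∑-cong (upTo N) λ k → ≡.trans (≡.cong (c k ℤ.*_) (∑-filter-∷ k)) (ℤₚ.*-distribˡ-+ (c k) _ _))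
    (≡.trans (∑-+ (upTo N) _ _)
    (≡.cong₂ ℤ._+_ (≡.trans (∑-single id {N = N} _ (φ<N a) off) (diagonal (φ a) ≡.refl)) (∑-fibres φ N c xs f φ<N)))
    where
    ∑-filter-∷ : ∀ k → ∑ (List.filter (λ a → φ a ℕₚ.≟ k) (a ∷ xs)) f ≡
      [ φ a ℕₚ.≟ k ]ℤ ℤ.* f a ℤ.+ ∑ (List.filter (λ a → φ a ℕₚ.≟ k) xs) f
    ∑-filter-∷ k = ≡.trans (∑-filter (λ a → φ a ℕₚ.≟ k) (a ∷ xs) f)
      (≡.cong (λ z → [ φ a ℕₚ.≟ k ]ℤ ℤ.* f a ℤ.+ z) (≡.sym (∑-filter (λ a → φ a ℕₚ.≟ k) xs f)))
    off : ∀ k → φ a ≢ k → c k ℤ.* ([ φ a ℕₚ.≟ k ]ℤ ℤ.* f a) ≡ ℤ.0ℤ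
    off k φa≢k with φ a ℕₚ.≟ k
    ... | yes φa≡k = ⊥-elim (φa≢k φa≡k)
    ... | no _ = ℤₚ.*-zeroʳ (c k)
    diagonal : ∀ k → φ a ≡ k → c k ℤ.* ([ φ a ℕₚ.≟ k ]ℤ ℤ.* f a) ≡ c k ℤ.* f a
    diagonal k φa≡k with φ a ℕₚ.≟ k
    ... | yes _ = ≡.cong (c k ℤ.*_) (ℤₚ.*-identityˡ (f a))
    ... | no φa≢k = ⊥-elim (φa≢k φa≡k)

  ∑-constant : ∀ {A : Set} {n} (φ : Fin n → A) (f : A → ℤ.ℤ) c → (∀ i → f (φ i) ≡ c) → ∑ (List.tabulate φ) f ≡ ℤ.+ n ℤ.* c
  ∑-constant {n = zero} φ f c eq = ≡.refl
  ∑-constant {n = suc n} φ f c eq = ≡.trans (≡.cong₂ ℤ._+_ (eq zero) (∑-constant (φ ∘ suc) f c (eq ∘ suc)))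
    (≡.sym (ℤₚ.suc-* (ℤ.+ n) c))

  length-∑ : ∀ {A : Set} (xs : List A) → ℤ.+ List.length xs ≡ ∑ xs (const ℤ.1ℤ)
  length-∑ [] = ≡.refl
  length-∑ (x ∷ xs) = ≡.trans (ℤₚ.pos-+ 1 (List.length xs)) (≡.cong (λ z → ℤ.1ℤ ℤ.+ z) (length-∑ xs))

-- Integration with respect to the Euler characteristic

module EulerIntegral (em : ExcludedMiddle 0ℓ) (ℝ : CompleteOrderedField) where
  open CompleteOrderedField ℝ hiding (_-_)
  open Dimension em ℝ public
  open FiniteSums public
  open RelativelyOpenConvex

  -1^ : ℕ → ℤ.ℤ
  -1^ k = ℤ.-1ℤ ℤ.^ k

  -1^suc : ∀ k → -1^ (suc k) ≡ ℤ.- -1^ k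
  -1^suc k = ℤₚ.-1*i≡-i (-1^ k)

  𝟏 : ∀ {d} → Pred (Point d) 0ℓ → Point d → ℤ.ℤ
  𝟏 A x with em {A x}
  ... | yes _ = ℤ.1ℤ
  ... | no _  = ℤ.0ℤ

  𝟏-yes : ∀ {d} (A : Pred (Point d) 0ℓ) {x} → A x → 𝟏 A x ≡ ℤ.1ℤ
  𝟏-yes A {x} Ax with em {A x}
  ... | yes _ = ≡.refl
  ... | no ¬Ax = ⊥-elim (¬Ax Ax)

  𝟏-no : ∀ {d} (A : Pred (Point d) 0ℓ) {x} → ¬ A x → 𝟏 A x ≡ ℤ.0ℤ
  𝟏-no A {x} ¬Ax with em {A x}
  ... | yes Ax = ⊥-elim (¬Ax Ax)
  ... | no _ = ≡.refl

  𝟏-cong : ∀ {d} (A B : Pred (Point d) 0ℓ) {x y} → (A x → B y) → (B y → A x) → 𝟏 A x ≡ 𝟏 B y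
  𝟏-cong A B {x} {y} f g with em {A x}
  ... | yes Ax = ≡.sym (𝟏-yes B (f Ax))
  ... | no ¬Ax = ≡.sym (𝟏-no B (¬Ax ∘ g))

  -- Excluded middle supplies some point and some dimension; that the choice is immaterial comes
  -- from constancy of `f` and uniqueness of the dimension. An empty cell counts 0.
  weight : ∀ {d} {K : Pred (Point d) 0ℓ} → (Point d → ℤ.ℤ) → Dec (Satisfiable K × ∃ (Dimension K)) → ℤ.ℤ
  weight f (yes ((x , _) , (k , _))) = f x ℤ.* -1^ k
  weight f (no _) = ℤ.0ℤ

  -- The sum over the cells C of the arrangement of H inside K of f(C) (-1)^dim C,
  -- for a function f that is constant on each of these cells.
  ∫ : ∀ {d} → List (Form d) → Pred (Point d) 0ℓ → (Point d → ℤ.ℤ) → ℤ.ℤ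
  ∫ [] K f = weight {K = K} f em
  ∫ (h ∷ H) K f = ∫ H (K ∩ Pos h) f ℤ.+ ∫ H (K ∩ Zero h) f ℤ.+ ∫ H (K ∩ Neg h) f

  ∫-cong : ∀ {d} H (K : Pred (Point d) 0ℓ) {f g : Point d → ℤ.ℤ} → (∀ x → f x ≡ g x) → ∫ H K f ≡ ∫ H K g
  ∫-cong [] K eq with em {Satisfiable K × ∃ (Dimension K)}
  ... | yes ((x , _) , _) = ≡.cong (ℤ._* _) (eq x)
  ... | no _ = ≡.refl
  ∫-cong (h ∷ H) K eq = ≡.cong₂ ℤ._+_ (≡.cong₂ ℤ._+_ (∫-cong H _ eq) (∫-cong H _ eq)) (∫-cong H _ eq)

  ∫-+ : ∀ {d} H (K : Pred (Point d) 0ℓ) (f g : Point d → ℤ.ℤ) → ∫ H K (λ x → f x ℤ.+ g x) ≡ ∫ H K f ℤ.+ ∫ H K g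
  ∫-+ [] K f g with em {Satisfiable K × ∃ (Dimension K)}
  ... | yes ((x , _) , k , _) = ℤₚ.*-distribʳ-+ (-1^ k) (f x) (g x)
  ... | no _ = ≡.refl
  ∫-+ (h ∷ H) K f g = ≡.trans
    (≡.cong₂ ℤ._+_ (≡.cong₂ ℤ._+_ (∫-+ H _ f g) (∫-+ H _ f g)) (∫-+ H _ f g))
    (rearrange (∫ H (K ∩ Pos h) f) _ (∫ H (K ∩ Zero h) f) _ _ _)
    where
    rearrange : ∀ a b c d e f → (a ℤ.+ b) ℤ.+ (c ℤ.+ d) ℤ.+ (e ℤ.+ f) ≡ (a ℤ.+ c ℤ.+ e) ℤ.+ (b ℤ.+ d ℤ.+ f)
    rearrange = ℤ-Solver.solve-∀

  ∫-* : ∀ {d} H (K : Pred (Point d) 0ℓ) c (f : Point d → ℤ.ℤ) → ∫ H K (λ x → c ℤ.* f x) ≡ c ℤ.* ∫ H K f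
  ∫-* [] K c f with em {Satisfiable K × ∃ (Dimension K)}
  ... | yes ((x , _) , k , _) = ℤₚ.*-assoc c (f x) (-1^ k)
  ... | no _ = ≡.sym (ℤₚ.*-zeroʳ c)
  ∫-* (h ∷ H) K c f = ≡.trans
    (≡.cong₂ ℤ._+_ (≡.cong₂ ℤ._+_ (∫-* H _ c f) (∫-* H _ c f)) (∫-* H _ c f))
    (factor c (∫ H (K ∩ Pos h) f) _ _)
    where
    factor : ∀ c x y z → c ℤ.* x ℤ.+ c ℤ.* y ℤ.+ c ℤ.* z ≡ c ℤ.* (x ℤ.+ y ℤ.+ z)
    factor = ℤ-Solver.solve-∀

  ∫-∑ : ∀ {d} {A : Set} H (K : Pred (Point d) 0ℓ) (xs : List A) (F : A → Point d → ℤ.ℤ) →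
    ∫ H K (λ x → ∑ xs λ a → F a x) ≡ ∑ xs λ a → ∫ H K (F a)
  ∫-∑ H K [] F = ∫-* H K ℤ.0ℤ (const ℤ.0ℤ)
  ∫-∑ H K (a ∷ xs) F = ≡.trans (∫-+ H K (F a) _) (≡.cong (λ z → ∫ H K (F a) ℤ.+ z) (∫-∑ H K xs F))

  SameSign : ∀ {d} → Point d → Point d → Form d → Set
  SameSign x y h = (Pos h x × Pos h y) ⊎ (Zero h x × Zero h y) ⊎ (Neg h x × Neg h y)

  sameSign-sym : ∀ {d} {x y : Point d} {h} → SameSign x y h → SameSign y x h
  sameSign-sym (inj₁ (p , q)) = inj₁ (q , p)
  sameSign-sym (inj₂ (inj₁ (p , q))) = inj₂ (inj₁ (q , p))
  sameSign-sym (inj₂ (inj₂ (p , q))) = inj₂ (inj₂ (q , p))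

  -- Comparing points sign by sign expresses that `f` takes one value on each cell without naming
  -- the cells.
  record Constant {d} (H : List (Form d)) (K : Pred (Point d) 0ℓ) (f : Point d → ℤ.ℤ) : Set where
    constructor constant
    field value : ∀ {x y} → K x → K y → All (SameSign x y) H → f x ≡ f y
  open Constant

  constant-⊆ : ∀ {d H} {K L : Pred (Point d) 0ℓ} {f} → L ⊆ K → Constant H K f → Constant H L f
  constant-⊆ L⊆K c = constant λ Lx Ly → value c (L⊆K Lx) (L⊆K Ly)

  constant-Pos : ∀ {d h H} {K : Pred (Point d) 0ℓ} {f} → Constant (h ∷ H) K f → Constant H (K ∩ Pos h) f
  constant-Pos c = constant λ (Kx , hx) (Ky , hy) s → value c Kx Ky (inj₁ (hx , hy) ∷ s)

  constant-Zero : ∀ {d h H} {K : Pred (Point d) 0ℓ} {f} → Constant (h ∷ H) K f → Constant H (K ∩ Zero h) f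
  constant-Zero c = constant λ (Kx , hx) (Ky , hy) s → value c Kx Ky (inj₂ (inj₁ (hx , hy)) ∷ s)

  constant-Neg : ∀ {d h H} {K : Pred (Point d) 0ℓ} {f} → Constant (h ∷ H) K f → Constant H (K ∩ Neg h) f
  constant-Neg c = constant λ (Kx , hx) (Ky , hy) s → value c Kx Ky (inj₂ (inj₂ (hx , hy)) ∷ s)

  constant-[] : ∀ {d H} {K : Pred (Point d) 0ℓ} {f} → Constant [] K f → Constant H K f
  constant-[] c = constant λ Kx Ky _ → value c Kx Ky []

  constant-++ʳ : ∀ {d} H′ {H} {K : Pred (Point d) 0ℓ} {f} → Constant H K f → Constant (H′ ++ H) K f
  constant-++ʳ H′ c = constant λ Kx Ky s → value c Kx Ky (Allₚ.++⁻ʳ H′ s)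

  ∩-congˡ : ∀ {d} (K L M : Pred (Point d) 0ℓ) → K ≐ L → (K ∩ M) ≐ (L ∩ M)
  ∩-congˡ K L M (K⊆L , L⊆K) = (λ (Kx , Mx) → K⊆L Kx , Mx) , (λ (Lx , Mx) → L⊆K Lx , Mx)

  ∫-[]-value : ∀ {d} {K : Pred (Point d) 0ℓ} {f k x} → Constant [] K f → K x → Dimension K k →
    ∫ [] K f ≡ f x ℤ.* -1^ k
  ∫-[]-value {K = K} {f} {k} {x} c Kx dim with em {Satisfiable K × ∃ (Dimension K)}
  ... | yes ((y , Ky) , l , diml) = ≡.cong₂ ℤ._*_ (value c Ky Kx []) (≡.cong -1^ (dimension-unique (id , id) diml dim))
  ... | no ¬K = ⊥-elim (¬K ((x , Kx) , k , dim))

  ∫-[]-empty : ∀ {d} {K : Pred (Point d) 0ℓ} f → ¬ Satisfiable K → ∫ [] K f ≡ ℤ.0ℤ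
  ∫-[]-empty {K = K} f ¬K with em {Satisfiable K × ∃ (Dimension K)}
  ... | yes (s , _) = ⊥-elim (¬K s)
  ... | no _ = ≡.refl

  -- The points chosen in `K` and in `L` may differ even though the sets are equal, hence the
  -- constancy assumption.
  ∫-≐ : ∀ {d} H {K L : Pred (Point d) 0ℓ} {f} → Constant H K f → K ≐ L → ∫ H K f ≡ ∫ H L f
  ∫-≐ [] {K} {L} {f} c (K⊆L , L⊆K) with em {Satisfiable L}
  ... | yes (x , Lx) = let k , dimK = dimension-exists (x , L⊆K Lx)
                           l , dimL = dimension-exists (x , Lx) in ≡.trans
    (∫-[]-value {K = K} c (L⊆K Lx) dimK)
    (≡.trans (≡.cong (λ n → f x ℤ.* -1^ n) (dimension-unique (K⊆L , L⊆K) dimK dimL))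
    (≡.sym (∫-[]-value {K = L} (constant-⊆ L⊆K c) Lx dimL)))
  ... | no ¬L = ≡.trans (∫-[]-empty {K = K} f (λ (x , Kx) → ¬L (x , K⊆L Kx))) (≡.sym (∫-[]-empty {K = L} f ¬L))
  ∫-≐ (h ∷ H) {K} {L} c K≐L = ≡.cong₂ ℤ._+_ (≡.cong₂ ℤ._+_
    (∫-≐ H (constant-Pos c) (∩-congˡ K L (Pos h) K≐L))
    (∫-≐ H (constant-Zero c) (∩-congˡ K L (Zero h) K≐L)))
    (∫-≐ H (constant-Neg c) (∩-congˡ K L (Neg h) K≐L))

  -- If `K` meets the hyperplane, prolongation shows that it lies inside it or reaches both open
  -- sides; if it does not, convexity keeps it on one side. Except when both sides are reached, one
  -- part is all of `K` and the other two are empty.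
  split : ∀ {d} (h : Form d) {K : Pred (Point d) 0ℓ} {f} → RelativelyOpenConvex K → Constant [] K f →
    ∫ (h ∷ []) K f ≡ ∫ [] K f
  split h {K} {f} roc c with em {Satisfiable (K ∩ Zero h)}
  ... | yes (z , Kz , hz) = zero-case em em
    where
    open SetoidReasoning setoid
    -- Prolonging the segment from a point of one side to z beyond z reaches the other side.
    opposite : ∀ (h : Form _) → Zero h z → Satisfiable (K ∩ Pos h) → Satisfiable (K ∩ Neg h)
    opposite h hz (a , Ka , ha) =
      let t , 0<t , Kt = small-witness (prolong roc Kz Ka) in
      line z a (- t) , Kt , <0⇒neg h _ (<-respˡ (begin
        - (t * eval h a)                          ≈⟨ solve 2 (λ t a → :- (t :* a) := con ℤ.0ℤ :+ (:- t) :* (a :- con ℤ.0ℤ)) refl t _ ⟩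
        0# + - t * (eval h a - 0#)                ≈⟨ +-cong hz (*-congˡ (+-congˡ (-‿cong hz))) ⟨
        eval h z + - t * (eval h a - eval h z)    ≈⟨ eval-line h z a (- t) ⟨
        eval h (line z a (- t))                   ∎) (neg-neg (*-pos 0<t ha)))
    negate-zero : Zero (negate h) z
    negate-zero = trans (eval-negate h z) (trans (-‿cong hz) (solve 0 (:- con ℤ.0ℤ := con ℤ.0ℤ) refl))
    neg-neg⇒pos : ∀ {x} → Neg (negate h) x → Pos h x
    neg-neg⇒pos {x} p = <-respʳ (trans (eval-negate (negate h) x) (trans (-‿cong (eval-negate h x))
      (solve 1 (λ e → :- (:- e) := e) refl _))) p
    zero-case : Dec (Satisfiable (K ∩ Pos h)) → Dec (Satisfiable (K ∩ Neg h)) → ∫ (h ∷ []) K f ≡ ∫ [] K f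
    zero-case (no ¬P) (no ¬N) = ≡.trans
      (≡.cong₂ ℤ._+_ (≡.cong₂ ℤ._+_ (∫-[]-empty {K = K ∩ Pos h} f ¬P) (∫-≐ [] {K = K ∩ Zero h} (constant-⊆ proj₁ c)
          (proj₁ , λ {x} Kx → Kx , [ (λ p → ⊥-elim (¬P (x , Kx , p))) , [ id , (λ n → ⊥-elim (¬N (x , Kx , n))) ]′ ]′ (side h x))))
        (∫-[]-empty {K = K ∩ Neg h} f ¬N))
      (≡.trans (ℤₚ.+-identityʳ _) (ℤₚ.+-identityˡ _))
    zero-case (yes P) (no ¬N) = ⊥-elim (¬N (opposite h hz P))
    zero-case (no ¬P) (yes N) = ⊥-elim (¬P (let x , Kx , p = opposite (negate h) negate-zero N in x , Kx , neg-neg⇒pos p))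
    zero-case (yes (a , Ka , ha)) (yes (b , Kb , hb)) =
      let k , dim = dimension-exists (a , Ka)
          k′ , k≡ , dim′ = dimension-Zero h a b roc Ka ha Kb hb dim
          kP = ∫-[]-value {K = K ∩ Pos h} (constant-⊆ proj₁ c) (Ka , ha) (dimension-Pos h a roc Ka ha dim)
          kZ = ∫-[]-value {K = K ∩ Zero h} (constant-⊆ proj₁ c) (Kz , hz) dim′
          kN = ∫-[]-value {K = K ∩ Neg h} (constant-⊆ proj₁ c) (Kb , hb) (dimension-Pos (negate h) b roc Kb hb dim)
          v = f a
          -1^k = ≡.trans (≡.cong -1^ k≡) (-1^suc k′)
          same : ∀ {x} → K x → ∀ s → f x ℤ.* s ≡ v ℤ.* s
          same Kx s = ≡.cong (ℤ._* s) (value c Kx Ka [])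
      in ≡.trans (≡.cong₂ ℤ._+_ (≡.cong₂ ℤ._+_
            (≡.trans kP (≡.cong (v ℤ.*_) -1^k)) (≡.trans kZ (same Kz _)))
            (≡.trans kN (≡.trans (same Kb _) (≡.cong (v ℤ.*_) -1^k))))
          (≡.trans (cancel v (-1^ k′)) (≡.sym (≡.trans (∫-[]-value {K = K} c Ka dim) (≡.cong (v ℤ.*_) -1^k))))
      where
      cancel : ∀ v s → v ℤ.* (ℤ.- s) ℤ.+ v ℤ.* s ℤ.+ v ℤ.* (ℤ.- s) ≡ v ℤ.* (ℤ.- s)
      cancel = ℤ-Solver.solve-∀
  ... | no ¬Z = off-case em
    where
    off-case : Dec (Satisfiable (K ∩ Pos h)) → ∫ (h ∷ []) K f ≡ ∫ [] K f
    off-case (yes (a , Ka , ha)) = ≡.trans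
      (≡.cong₂ ℤ._+_ (≡.cong₂ ℤ._+_ (∫-≐ [] {K = K ∩ Pos h} (constant-⊆ proj₁ c)
          (proj₁ , λ {x} Kx → Kx , [ id , [ (λ z → ⊥-elim (¬Z (x , Kx , z))) , (λ n → ⊥-elim (¬N (x , Kx , n))) ]′ ]′ (side h x)))
        (∫-[]-empty {K = K ∩ Zero h} f ¬Z)) (∫-[]-empty {K = K ∩ Neg h} f ¬N))
      (≡.trans (ℤₚ.+-identityʳ _) (ℤₚ.+-identityʳ _))
      where
      ¬N : ¬ Satisfiable (K ∩ Neg h)
      ¬N (b , Kb , hb) = let s , 0<s , s<1 , z = crossing h a b ha (neg⇒<0 h b hb) in
        ¬Z (line a b s , convex roc Ka Kb s 0<s s<1 , z)
    off-case (no ¬P) = ≡.trans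
      (≡.cong₂ ℤ._+_ (≡.cong₂ ℤ._+_ (∫-[]-empty {K = K ∩ Pos h} f ¬P) (∫-[]-empty {K = K ∩ Zero h} f ¬Z))
        (∫-≐ [] {K = K ∩ Neg h} (constant-⊆ proj₁ c)
          (proj₁ , λ {x} Kx → Kx , [ (λ p → ⊥-elim (¬P (x , Kx , p))) , [ (λ z → ⊥-elim (¬Z (x , Kx , z))) , id ]′ ]′ (side h x))))
      (ℤₚ.+-identityˡ _)

  -- `split` applies at the leaves of the recursion, whereas `h` cuts first. Exchanging `h` with
  -- `h′` moves it down: the sum over the nine pairs of signs is regrouped.
  ∫-∷ : ∀ {d} (h : Form d) H {K : Pred (Point d) 0ℓ} {f} → RelativelyOpenConvex K → Constant H K f →
    ∫ (h ∷ H) K f ≡ ∫ H K f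
  ∫-∷ h [] roc c = split h roc c
  ∫-∷ h (h′ ∷ H) {K} {f} roc c = ≡.trans
    (≡.cong₂ ℤ._+_ (≡.cong₂ ℤ._+_ (parts (Pos h)) (parts (Zero h))) (parts (Neg h)))
    (≡.trans (rearrange (∫ H ((K ∩ Pos h′) ∩ Pos h) f) (∫ H ((K ∩ Zero h′) ∩ Pos h) f) (∫ H ((K ∩ Neg h′) ∩ Pos h) f)
       (∫ H ((K ∩ Pos h′) ∩ Zero h) f) (∫ H ((K ∩ Zero h′) ∩ Zero h) f) (∫ H ((K ∩ Neg h′) ∩ Zero h) f)
       (∫ H ((K ∩ Pos h′) ∩ Neg h) f) (∫ H ((K ∩ Zero h′) ∩ Neg h) f) (∫ H ((K ∩ Neg h′) ∩ Neg h) f))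
     (≡.cong₂ ℤ._+_ (≡.cong₂ ℤ._+_ (∫-∷ h H (roc-Pos h′ roc) (constant-Pos c)) (∫-∷ h H (roc-Zero h′ roc) (constant-Zero c)))
       (∫-∷ h H (roc-Pos (negate h′) roc) (constant-Neg c))))
    where
    swap : ∀ L M → ((K ∩ L) ∩ M) ≐ ((K ∩ M) ∩ L)
    swap L M = (λ ((Kx , Lx) , Mx) → (Kx , Mx) , Lx) , (λ ((Kx , Mx) , Lx) → (Kx , Lx) , Mx)
    parts : ∀ (L : Pred (Point _) 0ℓ) → ∫ (h′ ∷ H) (K ∩ L) f ≡
      ∫ H ((K ∩ Pos h′) ∩ L) f ℤ.+ ∫ H ((K ∩ Zero h′) ∩ L) f ℤ.+ ∫ H ((K ∩ Neg h′) ∩ L) f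
    parts L = ≡.cong₂ ℤ._+_ (≡.cong₂ ℤ._+_
      (∫-≐ H (constant-Pos (constant-⊆ proj₁ c)) (swap L (Pos h′)))
      (∫-≐ H (constant-Zero (constant-⊆ proj₁ c)) (swap L (Zero h′))))
      (∫-≐ H (constant-Neg (constant-⊆ proj₁ c)) (swap L (Neg h′)))
    rearrange : ∀ a b c d e f g h i → (a ℤ.+ b ℤ.+ c) ℤ.+ (d ℤ.+ e ℤ.+ f) ℤ.+ (g ℤ.+ h ℤ.+ i) ≡
      (a ℤ.+ d ℤ.+ g) ℤ.+ (b ℤ.+ e ℤ.+ h) ℤ.+ (c ℤ.+ f ℤ.+ i)
    rearrange = ℤ-Solver.solve-∀

  ∫-constant : ∀ {d} H {K : Pred (Point d) 0ℓ} {f} → RelativelyOpenConvex K → Constant [] K f → ∫ H K f ≡ ∫ [] K f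
  ∫-constant [] roc c = ≡.refl
  ∫-constant (h ∷ H) roc c = ≡.trans (∫-∷ h H roc (constant-[] c)) (∫-constant H roc c)

  ∫-++ˡ : ∀ {d} H H′ {K : Pred (Point d) 0ℓ} {f} → RelativelyOpenConvex K → Constant H K f → ∫ (H ++ H′) K f ≡ ∫ H K f
  ∫-++ˡ [] H′ roc c = ∫-constant H′ roc c
  ∫-++ˡ (h ∷ H) H′ roc c = ≡.cong₂ ℤ._+_ (≡.cong₂ ℤ._+_
    (∫-++ˡ H H′ (roc-Pos h roc) (constant-Pos c)) (∫-++ˡ H H′ (roc-Zero h roc) (constant-Zero c)))
    (∫-++ˡ H H′ (roc-Pos (negate h) roc) (constant-Neg c))

  ∫-++ʳ : ∀ {d} H′ H {K : Pred (Point d) 0ℓ} {f} → RelativelyOpenConvex K → Constant H K f → ∫ (H′ ++ H) K f ≡ ∫ H K f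
  ∫-++ʳ [] H roc c = ≡.refl
  ∫-++ʳ (h ∷ H′) H roc c = ≡.trans (∫-∷ h (H′ ++ H) roc (constant-++ʳ H′ c)) (∫-++ʳ H′ H roc c)

  roc-U : ∀ {d} → RelativelyOpenConvex {d} U
  roc-U .convex _ _ _ _ _ = tt
  roc-U .prolong _ _ = small-true λ _ _ → tt

  -- Both sides are compared with the common refinement `H ++ H′`, obtained by appending forms to
  -- `H` or prepending forms to `H′`.
  ∫-independent : ∀ {d} (H H′ : List (Form d)) {f} → Constant H U f → Constant H′ U f → ∫ H U f ≡ ∫ H′ U f
  ∫-independent H H′ c c′ = ≡.trans (≡.sym (∫-++ˡ H H′ roc-U c)) (∫-++ʳ H H′ roc-U c′)

  -- By constancy each cell lies in `A` or misses it; a cell that misses `A` contributes 0 on both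
  -- sides.
  ∫-restrict : ∀ {d} H (K A : Pred (Point d) 0ℓ) → Constant H K (𝟏 A) → ∫ H K (𝟏 A) ≡ ∫ H (K ∩ A) (const ℤ.1ℤ)
  ∫-restrict [] K A c with em {Satisfiable (K ∩ A)}
  ... | yes (x , Kx , Ax) = ≡.trans (∫-≐ [] {K = K} c (K⊆K∩A , proj₁)) one
    where
    K⊆K∩A : K ⊆ (K ∩ A)
    K⊆K∩A {y} Ky with em {A y}
    ... | yes Ay = Ky , Ay
    ... | no ¬Ay with () ← ≡.trans (≡.sym (𝟏-yes A Ax)) (≡.trans (value c Kx Ky []) (𝟏-no A ¬Ay))
    one : ∫ [] (K ∩ A) (𝟏 A) ≡ ∫ [] (K ∩ A) (const ℤ.1ℤ)
    one with em {Satisfiable (K ∩ A) × ∃ (Dimension (K ∩ A))}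
    ... | yes ((y , Ky , Ay) , k , _) = ≡.cong (ℤ._* -1^ k) (𝟏-yes A Ay)
    ... | no _ = ≡.refl
  ... | no ¬KA = ≡.trans zeros (≡.sym (∫-[]-empty {K = K ∩ A} _ ¬KA))
    where
    zeros : ∫ [] K (𝟏 A) ≡ ℤ.0ℤ
    zeros with em {Satisfiable K × ∃ (Dimension K)}
    ... | yes ((y , Ky) , k , _) = ≡.cong (ℤ._* -1^ k) (𝟏-no A (λ Ay → ¬KA (y , Ky , Ay)))
    ... | no _ = ≡.refl
  ∫-restrict (h ∷ H) K A c = ≡.cong₂ ℤ._+_ (≡.cong₂ ℤ._+_
    (≡.trans (∫-restrict H (K ∩ Pos h) A (constant-Pos c)) (∫-≐ H (constant λ _ _ _ → ≡.refl) (swap (Pos h))))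
    (≡.trans (∫-restrict H (K ∩ Zero h) A (constant-Zero c)) (∫-≐ H (constant λ _ _ _ → ≡.refl) (swap (Zero h)))))
    (≡.trans (∫-restrict H (K ∩ Neg h) A (constant-Neg c)) (∫-≐ H (constant λ _ _ _ → ≡.refl) (swap (Neg h))))
    where
    swap : ∀ L → ((K ∩ L) ∩ A) ≐ ((K ∩ A) ∩ L)
    swap L = (λ ((Kx , Lx) , Mx) → (Kx , Mx) , Lx) , (λ ((Kx , Mx) , Lx) → (Kx , Lx) , Mx)

  ∫-cell : ∀ {d} H (A : Pred (Point d) 0ℓ) {k} → Constant H U (𝟏 A) → RelativelyOpenConvex A → Satisfiable A →
    Dimension A k → ∫ H U (𝟏 A) ≡ -1^ k
  ∫-cell H A {k} c roc (x , Ax) dim = ≡.trans (∫-restrict H U A c)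
    (≡.trans (∫-≐ H {K = U ∩ A} {L = A} (constant λ _ _ _ → ≡.refl) (proj₂ , (tt ,_)))
    (≡.trans (∫-constant H roc (constant λ _ _ _ → ≡.refl))
    (≡.trans (∫-[]-value {K = A} {k = k} {x = x} (constant λ _ _ _ → ≡.refl) Ax dim) (ℤₚ.*-identityˡ _))))

-- Relative interiors and faces of polyhedra

module PolyhedralGeometry (em : ExcludedMiddle 0ℓ) (ℝ : CompleteOrderedField) where
  open CompleteOrderedField ℝ hiding (_-_)
  open EulerIntegral em ℝ public
  open RelativelyOpenConvex
  open Constant

  Nonneg : ∀ {d} → Form d → Pred (Point d) 0ℓ
  Nonneg h x = 0# ≤ eval h x

  nonneg-line : ∀ {d} (h : Form d) x y t → 0# < t → t < 1# → Nonneg h x → Nonneg h y → Nonneg h (line x y t)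
  nonneg-line h x y t 0<t t<1 hx hy = ≤-respʳ
    (trans (solve 3 (λ u v t → (con ℤ.1ℤ :- t) :* u :+ t :* v := u :+ t :* (v :- u)) refl (eval h x) (eval h y) t)
      (sym (eval-line h x y t)))
    (+-nonneg (*-nonneg (inj₁ (<⇒0<- t<1)) hx) (*-nonneg (inj₁ 0<t) hy))

  pos-convexʳ : ∀ {d} (h : Form d) x y t → 0# < t → t < 1# → Pos h x → Nonneg h y → Pos h (line x y t)
  pos-convexʳ h x y t 0<t t<1 hx hy = <-respʳ
    (trans (solve 3 (λ u v t → t :* v :+ (con ℤ.1ℤ :- t) :* u := u :+ t :* (v :- u)) refl (eval h x) (eval h y) t)
      (sym (eval-line h x y t)))
    (+-nonneg-pos (*-nonneg (inj₁ 0<t) hy) (*-pos (<⇒0<- t<1) hx))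

  Region : ∀ {d n} → (Fin n → Form d) → Pred (Point d) 0ℓ
  Region f x = ∀ i → Nonneg (f i) x

  -- For convex A this is the relative interior.
  record Ri {d} (A : Pred (Point d) 0ℓ) (x : Point d) : Set where
    constructor ri
    field
      inside  : A x
      prolong : ∀ {y} → A y → Small (λ t → A (line x y (- t)))

  ri-cong : ∀ {d} {A B : Pred (Point d) 0ℓ} → A ≐ B → ∀ {x} → Ri A x → Ri B x
  ri-cong (A⊆B , B⊆A) (ri Ax pr) = ri (A⊆B Ax) λ By → small-map (λ _ _ → A⊆B) (pr (B⊆A By))

  -- A positive value at `y` would make `h` negative just beyond `x` on the line from `y`, at points
  -- still in `A`.
  ri-support : ∀ {d} {A : Pred (Point d) 0ℓ} (h : Form d) {x y} → (∀ {y} → A y → Nonneg h y) →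
    Ri A x → Zero h x → A y → Zero h y
  ri-support h {x} {y} A⊆h (ri Ax pr) hx Ay with A⊆h Ay
  ... | inj₂ 0≈hy = sym 0≈hy
  ... | inj₁ 0<hy = ⊥-elim (let t , 0<t , At = small-witness (pr Ay) in ≤⇒≯ (A⊆h At) (<-respˡ (begin
        - (t * eval h y)                        ≈⟨ solve 2 (λ t a → :- (t :* a) := con ℤ.0ℤ :+ (:- t) :* (a :- con ℤ.0ℤ)) refl t _ ⟩
        0# + - t * (eval h y - 0#)              ≈⟨ +-cong hx (*-congˡ (+-congˡ (-‿cong hx))) ⟨
        eval h x + - t * (eval h y - eval h x)  ≈⟨ eval-line h x y (- t) ⟨
        eval h (line x y (- t))                 ∎) (neg-neg (*-pos 0<t 0<hy))))
    where open SetoidReasoning setoid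

  module _ {d n} (f : Fin n → Form d) where
    Implicit : Fin n → Set
    Implicit i = ∀ {y} → Region f y → Zero (f i) y

    -- Together with membership in the region this describes the relative interior by signs alone:
    -- every inequality is an implicit equality or strict. In this form it is visibly a union of
    -- cells.
    Strict : Pred (Point d) 0ℓ
    Strict x = ∀ i → Implicit i ⊎ Pos (f i) x

    region-line : ∀ {x y} t → 0# < t → t < 1# → Region f x → Region f y → Region f (line x y t)
    region-line {x} {y} t 0<t t<1 fx fy i = nonneg-line (f i) x y t 0<t t<1 (fx i) (fy i)

    ri⇒strict : ∀ {x} → Ri (Region f) x → Strict x
    ri⇒strict r i with Ri.inside r i
    ... | inj₁ 0<fx = inj₂ 0<fx
    ... | inj₂ 0≈fx = inj₁ (ri-support (f i) (λ fy → fy i) r (sym 0≈fx))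

    strict-prolong : ∀ {x y} → Region f x → Strict x → Region f y → Small (λ t → Region f (line x y (- t)))
    strict-prolong {x} {y} fx sx fy = small-∀ λ i → [ zero-case i , (λ fx → small-map (λ _ _ → inj₁) (pos-prolong (f i) x y fx)) ]′ (sx i)
      where
      zero-case : ∀ i → Implicit i → Small (λ t → Nonneg (f i) (line x y (- t)))
      zero-case i imp = small-true λ t _ → inj₂ (sym (eval-line-zero (f i) x y (- t) (imp fx) (imp fy)))

    strict⇒ri : ∀ {x} → Region f x → Strict x → Ri (Region f) x
    strict⇒ri fx sx = ri fx (strict-prolong fx sx)

    ri-roc : RelativelyOpenConvex (Ri (Region f))
    ri-roc .convex {x} {y} rx ry t 0<t t<1 = strict⇒ri
      (region-line t 0<t t<1 (Ri.inside rx) (Ri.inside ry))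
      λ i → [ inj₁ , (λ fx → inj₂ (pos-convexʳ (f i) x y t 0<t t<1 fx (Ri.inside ry i))) ]′ (ri⇒strict rx i)
    ri-roc .prolong {x} {y} rx ry = small-map (λ t _ (ft , st) → strict⇒ri ft st) (small-∧ (Ri.prolong rx (Ri.inside ry))
      (small-∀ λ i → [ (λ imp → small-true λ _ _ → inj₁ (λ {y} → imp {y})) ,
                       (λ fx → small-map (λ _ _ → inj₂) (pos-prolong (f i) x y fx)) ]′ (ri⇒strict rx i)))

    ri-satisfiable : Satisfiable (Region f) → Satisfiable (Ri (Region f))
    ri-satisfiable sat = let x , fx , sx = average id in x , strict⇒ri fx sx
      where
      -- Midpoints make one more constraint strict at a time.
      average : ∀ {m} (c : Fin m → Fin n) → ∃ λ x → Region f x × (∀ k → Implicit (c k) ⊎ Pos (f (c k)) x)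
      average {zero} c = let x , fx = sat in x , fx , λ ()
      average {suc m} c with average (c ∘ suc) | em {∃ λ y → Region f y × Pos (f (c zero)) y}
      ... | x , fx , sx | no none = x , fx , λ
        { zero → inj₁ λ {y} fy → [ (λ 0<fy → ⊥-elim (none (y , fy , 0<fy))) , sym ]′ (fy (c zero))
        ; (suc k) → sx k }
      ... | x , fx , sx | yes (y , fy , 0<fy) = let t , 0<t , t<1 , _ = half in
        line x y t , region-line t 0<t t<1 fx fy , λ
        { zero → inj₂ (pos-convex (f (c zero)) x y t 0<t t<1 (fx (c zero)) 0<fy)
        ; (suc k) → [ inj₁ , (λ 0<fx → inj₂ (pos-convexʳ (f (c (suc k))) x y t 0<t t<1 0<fx (fy (c (suc k))))) ]′ (sx k) }

    ri-dimension : ∀ {k} → Dimension (Region f) k → Dimension (Ri (Region f)) k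
    ri-dimension dim =
      let family p fp ind = Dimension.independent dim
          q , rq = ri-satisfiable (p zero , fp zero)
      in dimension-dense q Ri.inside (λ p fp → small-map (λ s 0<s (s<1 , ss) →
             strict⇒ri (region-line s 0<s s<1 (Ri.inside rq) fp) ss)
           (small-∧ (small-< 0<1) (small-∀ λ i → [ (λ imp → small-true λ _ _ → inj₁ (λ {y} → imp {y})) ,
              (λ 0<fq → small-map (λ _ _ → inj₂) (pos-line (f i) q p 0<fq)) ]′ (ri⇒strict rq i)))) dim

    ri-constant : Constant (List.tabulate f) U (𝟏 (Ri (Region f)))
    ri-constant = constant λ _ _ same → 𝟏-cong (Ri (Region f)) (Ri (Region f))
      (transfer (Allₚ.tabulate⁻ same)) (transfer (λ i → sameSign-sym {h = f i} (Allₚ.tabulate⁻ same i)))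
      where
      transfer : ∀ {x y} → (∀ i → SameSign x y (f i)) → Ri (Region f) x → Ri (Region f) y
      transfer {x} {y} same r = strict⇒ri fy λ i → [ inj₁ , (λ 0<fx → inj₂ (posy i 0<fx (same i))) ]′ (ri⇒strict r i)
        where
        fy : Region f y
        fy i with same i
        ... | inj₁ (_ , p) = inj₁ p
        ... | inj₂ (inj₁ (_ , z)) = inj₂ (sym z)
        ... | inj₂ (inj₂ (n , _)) = ⊥-elim (≤⇒≯ (Ri.inside r i) (neg⇒<0 (f i) x n))
        posy : ∀ i → Pos (f i) x → SameSign x y (f i) → Pos (f i) y
        posy i p (inj₁ (_ , q)) = q
        posy i p (inj₂ (inj₁ (z , _))) = ⊥-elim (pos-zero (f i) {x} p z)
        posy i p (inj₂ (inj₂ (n , _))) = ⊥-elim (pos-neg (f i) {x} p n)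

  constraint : ∀ {d} → Point d → Carrier → Form d
  constraint c β = (λ i → - c i) , β

  eval-constraint : ∀ {d} (c : Point d) β x → eval (constraint c β) x ≈ β - ⟨ c , x ⟩
  eval-constraint c β x = trans (+-congʳ (⟨⟩-neg c x)) (+-comm _ _)

  ≤⇒nonneg : ∀ {d} (c : Point d) β x → ⟨ c , x ⟩ ≤ β → Nonneg (constraint c β) x
  ≤⇒nonneg c β x p = ≤-respʳ (sym (eval-constraint c β x)) (≤⇒0≤- p)

  nonneg⇒≤ : ∀ {d} (c : Point d) β x → Nonneg (constraint c β) x → ⟨ c , x ⟩ ≤ β
  nonneg⇒≤ c β x p = by-≤ p (eval-constraint c β x)

  ≈⇒zero : ∀ {d} (c : Point d) β x → ⟨ c , x ⟩ ≈ β → Zero (constraint c β) x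
  ≈⇒zero c β x p = trans (eval-constraint c β x) (trans (+-congˡ (-‿cong p)) (solve 1 (λ β → β :- β := con ℤ.0ℤ) refl β))

  zero⇒≈ : ∀ {d} (c : Point d) β x → Zero (constraint c β) x → ⟨ c , x ⟩ ≈ β
  zero⇒≈ c β x p = by-≈ p (eval-constraint c β x)

  slack : ∀ {d} (P : Polyhedron d) → Fin (Polyhedron.size P) → Form d
  slack P i = constraint (Polyhedron.normal P i) (Polyhedron.offset P i)

  polyhedron-region : ∀ {d} (P : Polyhedron d) → ⟦ P ⟧ ≐ Region (slack P)
  polyhedron-region P = (λ {x} Px i → ≤⇒nonneg (normal i) (offset i) x (Px i)) ,
    λ {x} fx i → nonneg⇒≤ (normal i) (offset i) x (fx i)
    where open Polyhedron P

  -- Faces are defined by inequalities `⟨ c , x ⟩ ≤ β`, while the proof works with nonnegative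
  -- forms: the form `(b , a)` corresponds to `c = - b` and `β = a`.
  face-intro : ∀ {d} {F P : Pred (Point d) 0ℓ} (h : Form d) → (∀ {x} → P x → Nonneg h x) →
    (∀ {x} → F x → P x × Zero h x) → (∀ {x} → P x → Zero h x → F x) → F IsFaceOf P
  face-intro (b , a) P⊆h F⊆ ⊆F = (λ i → - b i) , a ,
    (λ {x} Px → nonneg⇒≤ _ a x (≤-respʳ (double x) (P⊆h Px))) ,
    (λ {x} Fx → proj₁ (F⊆ Fx) , zero⇒≈ _ a x (trans (sym (double x)) (proj₂ (F⊆ Fx)))) ,
    (λ {x} (Px , eq) → ⊆F Px (trans (double x) (≈⇒zero _ a x eq)))
    where
    double : ∀ x → eval (b , a) x ≈ eval (constraint (λ i → - b i) a) x
    double x = sym (trans (eval-constraint _ a x) (trans (+-congˡ (-‿cong (⟨⟩-neg b x)))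
      (solve 2 (λ B a → a :- (:- B) := B :+ a) refl _ a)))

  -- A face must be cut out by one hyperplane. Where all forms are nonnegative, their sum vanishes
  -- exactly if each of them does, so it does the work of several hyperplanes.
  sumForm : ∀ {d n} → (Fin n → Form d) → Form d
  sumForm {n = zero} f = (λ _ → 0#) , 0#
  sumForm {n = suc n} f = f zero ⊕ sumForm (f ∘ suc)

  eval-0 : ∀ {d} (x : Point d) → eval ((λ _ → 0#) , 0#) x ≈ 0#
  eval-0 x = trans (+-identityʳ _) (sum-zero λ i → zeroˡ (x i))

  sumForm-nonneg : ∀ {d n} (f : Fin n → Form d) {x} → Region f x → Nonneg (sumForm f) x
  sumForm-nonneg {n = zero} f {x} fx = inj₂ (sym (eval-0 x))
  sumForm-nonneg {n = suc n} f {x} fx = ≤-respʳ (sym (eval-⊕ (f zero) (sumForm (f ∘ suc)) x))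
    (+-nonneg (fx zero) (sumForm-nonneg (f ∘ suc) (fx ∘ suc)))

  sumForm-zero⁺ : ∀ {d n} (f : Fin n → Form d) {x} → (∀ i → Zero (f i) x) → Zero (sumForm f) x
  sumForm-zero⁺ {n = zero} f {x} z = eval-0 x
  sumForm-zero⁺ {n = suc n} f {x} z = trans (eval-⊕ (f zero) (sumForm (f ∘ suc)) x)
    (trans (+-cong (z zero) (sumForm-zero⁺ (f ∘ suc) (z ∘ suc))) (+-identityˡ 0#))

  sumForm-zero⁻ : ∀ {d n} (f : Fin n → Form d) {x} → Region f x → Zero (sumForm f) x → ∀ i → Zero (f i) x
  sumForm-zero⁻ {n = suc n} f {x} fx z zero with fx zero
  ... | inj₂ eq = sym eq
  ... | inj₁ 0<f₀ = ⊥-elim (0<⇒≉0 (+-nonneg-pos (sumForm-nonneg (f ∘ suc) (fx ∘ suc)) 0<f₀)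
    (trans (+-comm _ _) (trans (sym (eval-⊕ (f zero) (sumForm (f ∘ suc)) x)) z)))
  sumForm-zero⁻ {n = suc n} f {x} fx z (suc i) = sumForm-zero⁻ (f ∘ suc) (fx ∘ suc)
    (trans (sym (trans (+-congʳ (sumForm-zero⁻ f fx z zero)) (+-identityˡ _))) (trans (sym (eval-⊕ (f zero) (sumForm (f ∘ suc)) x)) z)) i

  -- The smallest face through x, cut out by the sum of the constraints tight at x.
  module _ {d n} (f : Fin n → Form d) (x : Point d) (fx : Region f x) where
    TightFace : Pred (Point d) 0ℓ
    TightFace y = Region f y × (∀ i → Zero (f i) x → Zero (f i) y)

    private
      tight : Fin n → Form d
      tight i with eval (f i) x ≈? 0#
      ... | yes _ = f i
      ... | no _ = (λ _ → 0#) , 0#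

      tight-nonneg : ∀ {y} → Region f y → Region tight y
      tight-nonneg {y} fy i with eval (f i) x ≈? 0#
      ... | yes _ = fy i
      ... | no _ = inj₂ (sym (eval-0 y))

      tight⇒ : ∀ {y} → (∀ i → Zero (tight i) y) → ∀ i → Zero (f i) x → Zero (f i) y
      tight⇒ ty i fxi with ty i
      ... | tyi with eval (f i) x ≈? 0#
      ...   | yes _ = tyi
      ...   | no ¬z = ⊥-elim (¬z fxi)

      ⇒tight : ∀ {y} → (∀ i → Zero (f i) x → Zero (f i) y) → ∀ i → Zero (tight i) y
      ⇒tight {y} fy i with eval (f i) x ≈? 0#
      ... | yes z = fy i z
      ... | no _ = eval-0 y

    tightFace-isFace : TightFace IsFaceOf Region f
    tightFace-isFace = face-intro (sumForm tight) (sumForm-nonneg tight ∘ tight-nonneg)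
      (λ (fy , ty) → fy , sumForm-zero⁺ tight (⇒tight ty))
      (λ fy z → fy , tight⇒ (sumForm-zero⁻ tight (tight-nonneg fy) z))

    tightFace-ri : Ri TightFace x
    tightFace-ri = ri (fx , λ _ z → z) λ {y} (fy , ty) → small-map
      (λ t _ p → (λ i → proj₁ (p i)) , λ i → proj₂ (p i)) (small-∀ λ i → prolong-at i y (fy i) (ty i) (fx i))
      where
      prolong-at : ∀ i y → Nonneg (f i) y → (Zero (f i) x → Zero (f i) y) → Nonneg (f i) x →
        Small (λ t → Nonneg (f i) (line x y (- t)) × (Zero (f i) x → Zero (f i) (line x y (- t))))
      prolong-at i y fy ty (inj₁ p) = small-map (λ t _ q → inj₁ q , λ z → ⊥-elim (pos-zero (f i) {x} p z)) (pos-prolong (f i) x y p)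
      prolong-at i y fy ty (inj₂ z) = small-true λ t _ → let w = eval-line-zero (f i) x y (- t) (sym z) (ty (sym z)) in
        inj₂ (sym w) , λ _ → w

  face-≐ : ∀ {d} {F P Q : Pred (Point d) 0ℓ} → P ≐ Q → F IsFaceOf P → F IsFaceOf Q
  face-≐ (P⊆Q , Q⊆P) (c , β , P⊆ , F⊆ , ⊆F) = c , β , P⊆ ∘ Q⊆P , (λ Fx → P⊆Q (proj₁ (F⊆ Fx)) , proj₂ (F⊆ Fx)) ,
    λ (Qx , eq) → ⊆F (Q⊆P Qx , eq)

  -- The supporting form vanishes at a relatively interior point, hence on all of `P` by
  -- `ri-support`.
  face-ri : ∀ {d} {F P : Pred (Point d) 0ℓ} {x} → F IsFaceOf P → Ri P x → F x → P ⊆ F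
  face-ri {x = x} (c , β , P⊆ , F⊆ , ⊆F) r Fx {y} Py = ⊆F (Py , zero⇒≈ c β y
    (ri-support (constraint c β) (λ {y} Py → ≤⇒nonneg c β y (P⊆ Py)) r (≈⇒zero c β x (proj₂ (F⊆ Fx))) Py))

  𝟏-disjoint : ∀ {d} {A : Set} {n} (φ : Fin n → A) (B : A → Pred (Point d) 0ℓ) x →
    (∀ i j → B (φ i) x → B (φ j) x → i ≡ j) →
    ∑ (List.tabulate φ) (λ a → 𝟏 (B a) x) ≡ 𝟏 (λ x → ∃ λ i → B (φ i) x) x
  𝟏-disjoint {n = zero} φ B x disj = ≡.sym (𝟏-no (λ x → ∃ λ i → B (φ i) x) λ ())
  𝟏-disjoint {n = suc n} φ B x disj = cases em
    where
    rest = 𝟏-disjoint (φ ∘ suc) B x λ i j Bi Bj → Finₚ.suc-injective (disj (suc i) (suc j) Bi Bj)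
    cases : Dec (B (φ zero) x) → ∑ (List.tabulate φ) (λ a → 𝟏 (B a) x) ≡ 𝟏 (λ x → ∃ λ i → B (φ i) x) x
    cases (yes B₀) = ≡.trans
      (≡.cong₂ ℤ._+_ (𝟏-yes (B (φ zero)) B₀) (≡.trans rest
        (𝟏-no (λ x → ∃ λ i → B (φ (suc i)) x) λ (i , Bi) → Finₚ.0≢1+n (disj zero (suc i) B₀ Bi))))
      (≡.sym (𝟏-yes (λ x → ∃ λ i → B (φ i) x) (zero , B₀)))
    cases (no ¬B₀) = ≡.trans
      (≡.cong₂ ℤ._+_ (𝟏-no (B (φ zero)) ¬B₀) rest)
      (≡.trans (ℤₚ.+-identityˡ _) (𝟏-cong (λ x → ∃ λ i → B (φ (suc i)) x) (λ x → ∃ λ i → B (φ i) x)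
        (λ (i , Bi) → suc i , Bi) λ { (zero , B₀) → ⊥-elim (¬B₀ B₀) ; (suc i , Bi) → i , Bi }))

  -- The Euler characteristic of a polyhedral complex as an integral

  module _ {d} (C : PolyhedralComplex d) where
    open PolyhedralComplex C

    private
      f : ∀ i → Fin (Polyhedron.size (face i)) → Form d
      f i = slack (face i)

      eq : ∀ i → ⟦ face i ⟧ ≐ Region (f i)
      eq i = polyhedron-region (face i)

      R : Fin size → Pred (Point d) 0ℓ
      R i = Ri (Region (f i))

      forms : List (Form d)
      forms = List.concat (List.tabulate λ i → List.tabulate (f i))

      -- The smallest face through `x` of a polyhedron of the complex is itself listed, and `x` is
      -- relatively interior to it.
      ri-cover : ∀ {x} → support x → ∃ λ i → R i x
      ri-cover {x} (i , Fx) =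
        let fx = proj₁ (eq i) Fx
            j , F≐ = faceClosed i (TightFace (f i) x fx) (face-≐ (proj₂ (eq i) , proj₁ (eq i)) (tightFace-isFace (f i) x fx))
              (x , fx , λ _ z → z)
        in j , ri-cong ((λ {y} Fy → proj₁ (eq j) (proj₁ F≐ Fy)) , λ {y} Fy → proj₂ F≐ (proj₂ (eq j) Fy)) (tightFace-ri (f i) x fx)

      toRi : ∀ i {x} → R i x → Ri ⟦ face i ⟧ x
      toRi i = ri-cong (proj₂ (eq i) , proj₁ (eq i))

      -- The intersection of the two polyhedra is a face of each that meets its relative interior,
      -- hence equals both.
      ri-disjoint : ∀ i j {x} → R i x → R j x → i ≡ j
      ri-disjoint i j {x} rᵢ rⱼ = distinct i j
        ( (λ Fy → proj₂ (face-ri (proj₁ faces) (toRi i rᵢ) both Fy))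
        , (λ Fy → proj₁ (face-ri (proj₂ faces) (toRi j rⱼ) both Fy)) )
        where
        both = Ri.inside (toRi i rᵢ) , Ri.inside (toRi j rⱼ)
        faces = intersection i j (x , both)

      partition : ∀ x → 𝟏 support x ≡ ∑ (allFin size) λ i → 𝟏 (R i) x
      partition x = ≡.trans (𝟏-cong support (λ x → ∃ λ i → R i x) ri-cover
          λ (i , r) → i , proj₂ (eq i) (Ri.inside r))
        (≡.sym (𝟏-disjoint id R x λ i j → ri-disjoint i j))

      R-constant : ∀ i → Constant forms U (𝟏 (R i))
      R-constant i = constant λ _ _ same → value (ri-constant (f i)) tt tt (Allₚ.tabulate⁻ (Allₚ.concat⁻ {xss = List.tabulate λ i → List.tabulate (f i)} same) i)

      support-constant : Constant forms U (𝟏 support)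
      support-constant = constant λ {x} {y} _ _ same → ≡.trans (partition x)
        (≡.trans (∑-cong (allFin size) λ i → value (R-constant i) tt tt same) (≡.sym (partition y)))

    -- The right side does not mention `C`: this is the independence of the polyhedral structure.
    euler-∫ : ∀ {X : Pred (Point d) 0ℓ} H → Constant H U (𝟏 X) → support ≐ X → euler ≡ ∫ H U (𝟏 X)
    euler-∫ {X} H c (s⊆X , X⊆s) = begin
      euler
        ≡⟨ ∑-cong (upTo (suc d)) (λ k → ≡.cong (-1^ k ℤ.*_) (length-∑ (List.filter (λ i → dim i ℕₚ.≟ k) (allFin size)))) ⟩
      ∑ (upTo (suc d)) (λ k → -1^ k ℤ.* ∑ (List.filter (λ i → dim i ℕₚ.≟ k) (allFin size)) (const ℤ.1ℤ))
        -- No dimension exceeds `d`, so `upTo (suc d)` meets every face.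
        ≡⟨ ∑-fibres dim (suc d) -1^ (allFin size) (const ℤ.1ℤ) (λ i → ℕ.s≤s (dimension-≤ (toDimension {K = ⟦ face i ⟧} (hasDimension i)))) ⟩
      ∑ (allFin size) (λ i → -1^ (dim i) ℤ.* ℤ.1ℤ)
        ≡⟨ ∑-cong (allFin size) (λ i → ≡.trans (ℤₚ.*-identityʳ _) (≡.sym (cell i))) ⟩
      ∑ (allFin size) (λ i → ∫ forms U (𝟏 (R i)))
        ≡⟨ ∫-∑ forms U (allFin size) (λ i → 𝟏 (R i)) ⟨
      ∫ forms U (λ x → ∑ (allFin size) λ i → 𝟏 (R i) x)
        ≡⟨ ∫-cong forms U partition ⟨
      ∫ forms U (𝟏 support)
        ≡⟨ ∫-cong forms U same ⟩
      ∫ forms U (𝟏 X)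
        ≡⟨ ∫-independent forms H (constant λ {x} {y} _ _ s → ≡.trans (≡.sym (same x)) (≡.trans (value support-constant tt tt s) (same y))) c ⟩
      ∫ H U (𝟏 X) ∎
      where
      open ≡.≡-Reasoning
      same : ∀ x → 𝟏 support x ≡ 𝟏 X x
      same x = 𝟏-cong support X s⊆X X⊆s
      cell : ∀ i → ∫ forms U (𝟏 (R i)) ≡ -1^ (dim i)
      cell i = ∫-cell forms (R i) (R-constant i) (ri-roc (f i))
        (ri-satisfiable (f i) (let x , Fx = nonempty i in x , proj₁ (eq i) Fx))
        (ri-dimension (f i) (dimension-≐ {⟦ face i ⟧} (eq i) (toDimension {K = ⟦ face i ⟧} (hasDimension i))))
        where
        dimension-≐ : ∀ {K L : Pred (Point d) 0ℓ} {k} → K ≐ L → Dimension K k → Dimension L k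
        dimension-≐ (K⊆L , L⊆K) (dimension ind max) = dimension (hasIndependent-⊆ K⊆L ind) (max ∘ hasIndependent-⊆ L⊆K)

-- Enumeration of subfamilies of finite families

record Enumeration {n} (P : Pred (Fin n) 0ℓ) : Set where
  field
    size      : ℕ
    elem      : Fin size → Fin n
    holds     : ∀ k → P (elem k)
    injective : ∀ k l → elem k ≡ elem l → k ≡ l
    complete  : ∀ i → P i → ∃ λ k → elem k ≡ i

-- Complexes and component counts need an index set `Fin size` without repetitions, while faces and
-- regions arise by selection from all sign vectors or all terms.
enumerate : ExcludedMiddle 0ℓ → ∀ {n} (P : Pred (Fin n) 0ℓ) → Enumeration P
enumerate em {zero} P = record { size = 0 ; elem = λ () ; holds = λ () ; injective = λ () ; complete = λ () }
enumerate em {suc n} P with enumerate em (P ∘ suc) | em {P zero}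
... | E | yes P₀ = record
  { size = suc size
  ; elem = λ { zero → zero ; (suc k) → suc (elem k) }
  ; holds = λ { zero → P₀ ; (suc k) → holds k }
  ; injective = λ { zero zero _ → ≡.refl ; (suc k) (suc l) eq → ≡.cong suc (injective k l (Finₚ.suc-injective eq)) }
  ; complete = λ { zero _ → zero , ≡.refl ; (suc i) Pi → let k , eq = complete i Pi in suc k , ≡.cong suc eq } }
  where open Enumeration E
... | E | no ¬P₀ = record
  { size = size
  ; elem = suc ∘ elem
  ; holds = holds
  ; injective = λ k l eq → injective k l (Finₚ.suc-injective eq)
  ; complete = λ { zero P₀ → ⊥-elim (¬P₀ P₀) ; (suc i) Pi → let k , eq = complete i Pi in k , ≡.cong suc eq } }
  where open Enumeration E

funToFin-cong : ∀ {m n} {f g : Fin m → Fin n} → (∀ i → f i ≡ g i) → funToFin f ≡ funToFin g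
funToFin-cong {zero} eq = ≡.refl
funToFin-cong {suc m} eq = ≡.cong₂ combine (eq zero) (funToFin-cong (eq ∘ suc))

-- Complexes of closed cells of a hyperplane arrangement

module ArrangementComplex (em : ExcludedMiddle 0ℓ) (ℝ : CompleteOrderedField) where
  open CompleteOrderedField ℝ hiding (_-_)
  open PolyhedralGeometry em ℝ public

  ofForms : ∀ {d n} → (Fin n → Form d) → Polyhedron d
  ofForms {n = n} f = record { size = n ; normal = λ i → proj₁ (negate (f i)) ; offset = λ i → proj₂ (f i) }

  eval-slack-ofForms : ∀ {d n} (f : Fin n → Form d) i x → eval (slack (ofForms f) i) x ≈ eval (f i) x
  eval-slack-ofForms f i x = trans (eval-constraint _ _ x) (trans (+-congˡ (-‿cong (⟨⟩-neg (proj₁ (f i)) x)))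
    (solve 2 (λ B a → a :- (:- B) := B :+ a) refl _ _))

  ofForms-region : ∀ {d n} (f : Fin n → Form d) → ⟦ ofForms f ⟧ ≐ Region f
  ofForms-region f =
    (λ {x} Px i → ≤-respʳ (eval-slack-ofForms f i x) (proj₁ (polyhedron-region (ofForms f)) Px i)) ,
    (λ {x} fx → proj₂ (polyhedron-region (ofForms f)) λ i → ≤-respʳ (sym (eval-slack-ofForms f i x)) (fx i))

  negate-zero⁺ : ∀ {d} (h : Form d) {x} → Zero h x → Zero (negate h) x
  negate-zero⁺ h {x} z = trans (eval-negate h x) (trans (-‿cong z) (solve 0 (:- con ℤ.0ℤ := con ℤ.0ℤ) refl))

  negate-zero⁻ : ∀ {d} (h : Form d) {x} → Zero (negate h) x → Zero h x
  negate-zero⁻ h {x} z = trans (solve 1 (λ e → e := :- (:- e)) refl (eval h x))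
    (trans (-‿cong (trans (sym (eval-negate h x)) z)) (solve 0 (:- con ℤ.0ℤ := con ℤ.0ℤ) refl))

  nonneg-antisym : ∀ {d} (h : Form d) {x} → Nonneg h x → Nonneg (negate h) x → Zero h x
  nonneg-antisym h {x} (inj₂ eq) _ = sym eq
  nonneg-antisym h {x} (inj₁ _) (inj₂ eq) = negate-zero⁻ h {x} (sym eq)
  nonneg-antisym h {x} (inj₁ p) (inj₁ q) = ⊥-elim (pos-neg h {x} p q)

  -- The signs +, 0, - are encoded as 0F, 1F, 2F.
  Sign : Set
  Sign = Fin 3

  Has : ∀ {d} → Sign → Form d → Pred (Point d) 0ℓ
  Has 0F = Pos
  Has 1F = Zero
  Has 2F = Neg

  Weakly : ∀ {d} → Sign → Form d → Pred (Point d) 0ℓ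
  Weakly 0F = Nonneg
  Weakly 1F = Zero
  Weakly 2F h = Nonneg (negate h)

  sign : ∀ {d} (h : Form d) x → ∃ λ s → Has s h x
  sign h x with side h x
  ... | inj₁ p = 0F , p
  ... | inj₂ (inj₁ z) = 1F , z
  ... | inj₂ (inj₂ n) = 2F , n

  has⇒weakly : ∀ {d} s (h : Form d) {x} → Has s h x → Weakly s h x
  has⇒weakly 0F h = inj₁
  has⇒weakly 1F h = id
  has⇒weakly 2F h = inj₁

  zero⇒weakly : ∀ {d} s (h : Form d) {x} → Zero h x → Weakly s h x
  zero⇒weakly 0F h z = inj₂ (sym z)
  zero⇒weakly 1F h z = z
  zero⇒weakly 2F h z = inj₂ (sym (negate-zero⁺ h z))

  -- The local rule of the face order: a cell meeting the closure of another arises from it by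
  -- replacing signs with zero.
  weakly-zero : ∀ {d} s t (h : Form d) {x} → Weakly s h x → Has t h x → s ≡ t ⊎ t ≡ 1F
  weakly-zero s 1F h w z = inj₂ ≡.refl
  weakly-zero 0F 0F h w p = inj₁ ≡.refl
  weakly-zero 1F 0F h {x} w p = ⊥-elim (pos-zero h {x} p w)
  weakly-zero 2F 0F h {x} w p = ⊥-elim (≤⇒≯ w (<-respˡ (sym (eval-negate h x)) (neg-neg p)))
  weakly-zero 0F 2F h {x} w n = ⊥-elim (≤⇒≯ w (neg⇒<0 h x n))
  weakly-zero 1F 2F h {x} w n = ⊥-elim (neg-zero h {x} n w)
  weakly-zero 2F 2F h w n = inj₁ ≡.refl

  has-line : ∀ {d} s (h : Form d) x z t → 0# < t → t < 1# → Weakly s h x → Has s h z → Has s h (line x z t)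
  has-line 0F h x z t = pos-convex h x z t
  has-line 1F h x z t _ _ = eval-line-zero h x z t
  has-line 2F h x z t = pos-convex (negate h) x z t

  weakly-prolong : ∀ {d} s (h : Form d) x y → Has s h x → Weakly s h y → Small (λ t → Weakly s h (line x y (- t)))
  weakly-prolong 0F h x y p _ = small-map (λ _ _ → inj₁) (pos-prolong h x y p)
  weakly-prolong 1F h x y z w = small-true λ t _ → eval-line-zero h x y (- t) z w
  weakly-prolong 2F h x y n _ = small-map (λ _ _ → inj₁) (pos-prolong (negate h) x y n)

  weakly-support : ∀ {d} s (h : Form d) {A : Pred (Point d) 0ℓ} {x y} → (∀ {y} → A y → Weakly s h y) →
    Ri A x → Zero h x → A y → Zero h y
  weakly-support 0F h A⊆ r z = ri-support h A⊆ r z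
  weakly-support 1F h A⊆ r z Ay = A⊆ Ay
  weakly-support 2F h A⊆ r z Ay = negate-zero⁻ h (ri-support (negate h) A⊆ r (negate-zero⁺ h z) Ay)

  -- separator s t cuts out of the closure of the side s the part lying in the closure of the side t.
  separator : ∀ {d} → Sign → Sign → Form d → Form d
  separator 0F 0F h = (λ _ → 0#) , 0#
  separator 0F _  h = h
  separator 1F _  h = (λ _ → 0#) , 0#
  separator 2F 2F h = (λ _ → 0#) , 0#
  separator 2F _  h = negate h

  separator-nonneg : ∀ {d} s t (h : Form d) {x} → Weakly s h x → Nonneg (separator s t h) x
  separator-nonneg 0F 0F h {x} w = inj₂ (sym (eval-0 x))
  separator-nonneg 0F 1F h w = w
  separator-nonneg 0F 2F h w = w
  separator-nonneg 1F t h {x} w = inj₂ (sym (eval-0 x))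
  separator-nonneg 2F 0F h w = w
  separator-nonneg 2F 1F h w = w
  separator-nonneg 2F 2F h {x} w = inj₂ (sym (eval-0 x))

  separator-zero⁺ : ∀ {d} s t (h : Form d) {x} → Weakly s h x → Weakly t h x → Zero (separator s t h) x
  separator-zero⁺ 0F 0F h {x} w v = eval-0 x
  separator-zero⁺ 0F 1F h w v = v
  separator-zero⁺ 0F 2F h {x} w v = nonneg-antisym h {x} w v
  separator-zero⁺ 1F t h {x} w v = eval-0 x
  separator-zero⁺ 2F 0F h {x} w v = negate-zero⁺ h (nonneg-antisym h {x} v w)
  separator-zero⁺ 2F 1F h w v = negate-zero⁺ h v
  separator-zero⁺ 2F 2F h {x} w v = eval-0 x

  separator-zero⁻ : ∀ {d} s t (h : Form d) {x} → Weakly s h x → Zero (separator s t h) x → Weakly t h x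
  separator-zero⁻ 0F 0F h w z = w
  separator-zero⁻ 0F 1F h w z = z
  separator-zero⁻ 0F 2F h w z = zero⇒weakly 2F h z
  separator-zero⁻ 1F t h w z = zero⇒weakly t h w
  separator-zero⁻ 2F 0F h w z = zero⇒weakly 0F h (negate-zero⁻ h z)
  separator-zero⁻ 2F 1F h w z = negate-zero⁻ h z
  separator-zero⁻ 2F 2F h w z = w

  module _ {d n} (h : Fin n → Form d) where
    Cell Closure : (Fin n → Sign) → Pred (Point d) 0ℓ
    Cell σ x = ∀ i → Has (σ i) (h i) x
    Closure σ x = ∀ i → Weakly (σ i) (h i) x

    private
      signs : Point d → Fin n → Sign
      signs x i = proj₁ (sign (h i) x)

      in-cell : ∀ x → Cell (signs x) x
      in-cell x i = proj₂ (sign (h i) x)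

      -- `ofForms` takes inequalities only, so the sign 1F needs two of them. Giving two to every
      -- sign, equal ones for 0F and 2F, keeps the index set `Fin (n ℕ.+ n)`.
      upper lower : (Fin n → Sign) → Fin n → Form d
      upper σ i with σ i
      ... | 0F = h i
      ... | 1F = h i
      ... | 2F = negate (h i)
      lower σ i with σ i
      ... | 0F = h i
      ... | 1F = negate (h i)
      ... | 2F = negate (h i)

      bounds : (Fin n → Sign) → Fin (n ℕ.+ n) → Form d
      bounds σ = upper σ F.++ lower σ

      bounds-upper : ∀ σ {x} → Region (bounds σ) x → Region (upper σ) x
      bounds-upper σ {x} r i = ≡.subst (λ f → Nonneg f x) (Fₚ.lookup-++ˡ (upper σ) (lower σ) i) (r (i ↑ˡ n))

      bounds-lower : ∀ σ {x} → Region (bounds σ) x → Region (lower σ) x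
      bounds-lower σ {x} r i = ≡.subst (λ f → Nonneg f x) (Fₚ.lookup-++ʳ (upper σ) (lower σ) i) (r (n ↑ʳ i))

      closure-region : ∀ σ → Closure σ ≐ Region (bounds σ)
      closure-region σ = (λ {x} w i → join w (splitAt n i)) , λ {x} r i → meet i (bounds-upper σ r i) (bounds-lower σ r i)
        where
        join : ∀ {x} → Closure σ x → (s : Fin n ⊎ Fin n) → Nonneg ([ upper σ , lower σ ]′ s) x
        join w (inj₁ i) with σ i | w i
        ... | 0F | wi = wi
        ... | 1F | wi = inj₂ (sym wi)
        ... | 2F | wi = wi
        join w (inj₂ i) with σ i | w i
        ... | 0F | wi = wi
        ... | 1F | wi = inj₂ (sym (negate-zero⁺ (h i) wi))
        ... | 2F | wi = wi
        meet : ∀ i {x} → Nonneg (upper σ i) x → Nonneg (lower σ i) x → Weakly (σ i) (h i) x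
        meet i {x} u l with σ i
        ... | 0F = u
        ... | 1F = nonneg-antisym (h i) {x} u l
        ... | 2F = u

      polyhedron : (Fin n → Sign) → Polyhedron d
      polyhedron σ = ofForms (bounds σ)

      toClosure : ∀ σ {x} → ⟦ polyhedron σ ⟧ x → Closure σ x
      toClosure σ Px = proj₂ (closure-region σ) (proj₁ (ofForms-region (bounds σ)) Px)

      fromClosure : ∀ σ {x} → Closure σ x → ⟦ polyhedron σ ⟧ x
      fromClosure σ w = proj₂ (ofForms-region (bounds σ)) (proj₁ (closure-region σ) w)

      cell-ri : ∀ σ {x} → Cell σ x → Ri (Closure σ) x
      cell-ri σ {x} c = ri (λ i → has⇒weakly (σ i) (h i) (c i))
        λ {y} w → small-∀ λ i → weakly-prolong (σ i) (h i) x y (c i) (w i)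

      closure-⊆ : ∀ σ τ {x} → Cell τ x → Closure σ x → ∀ {y} → Closure τ y → Closure σ y
      closure-⊆ σ τ {x} c w {y} v i with weakly-zero (σ i) (τ i) (h i) {x} (w i) (c i)
      ... | inj₁ eq = ≡.subst (λ s → Weakly s (h i) y) (≡.sym eq) (v i)
      ... | inj₂ eq = zero⇒weakly (σ i) (h i) (≡.subst (λ s → Weakly s (h i) y) eq (v i))

      -- Each cell has a point in the closure of the other, so where the signs differed both would
      -- have to be zero.
      closure-signs : ∀ σ τ {x} → Cell τ x → Closure σ x → ∀ {z} → Cell σ z → Closure τ z → ∀ i → σ i ≡ τ i
      closure-signs σ τ {x} c w {z} c′ w′ i
        with weakly-zero (σ i) (τ i) (h i) {x} (w i) (c i) | weakly-zero (τ i) (σ i) (h i) {z} (w′ i) (c′ i)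
      ... | inj₁ eq | _ = eq
      ... | inj₂ _ | inj₁ eq = ≡.sym eq
      ... | inj₂ eq | inj₂ eq′ = ≡.trans eq′ (≡.sym eq)

      -- On the closed cell of `σ` all separators vanish exactly in the closed cell of `τ`, and
      -- their sum is a single supporting form.
      intersection-face : ∀ σ τ → (⟦ polyhedron σ ⟧ ∩ ⟦ polyhedron τ ⟧) IsFaceOf ⟦ polyhedron σ ⟧
      intersection-face σ τ = face-intro (sumForm T)
        (λ Px → sumForm-nonneg T (nonneg Px))
        (λ (Px , Qx) → Px , sumForm-zero⁺ T λ i → separator-zero⁺ (σ i) (τ i) (h i) (toClosure σ Px i) (toClosure τ Qx i))
        (λ Px z → Px , fromClosure τ λ i → separator-zero⁻ (σ i) (τ i) (h i) (toClosure σ Px i) (sumForm-zero⁻ T (nonneg Px) z i))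
        where
        T : Fin n → Form d
        T i = separator (σ i) (τ i) (h i)
        nonneg : ∀ {x} → ⟦ polyhedron σ ⟧ x → Region T x
        nonneg Px i = separator-nonneg (σ i) (τ i) (h i) (toClosure σ Px i)

      -- x is a point of the relative interior of F.
      face-closure : ∀ σ F → F IsFaceOf ⟦ polyhedron σ ⟧ → Satisfiable F →
        ∃ λ x → F x × (F ≐ Closure (signs x))
      face-closure σ F (c , β , P⊆ , F⊆ , ⊆F) (w , Fw) = x , Fx , F⊆τ , τ⊆F
        where
        hF = constraint c β
        -- The equation of the supporting hyperplane, written as two inequalities, presents `F` as a
        -- region, so that `ri-satisfiable` yields `x`.
        f : Fin (suc (suc (n ℕ.+ n))) → Form d
        f = hF F.∷ negate hF F.∷ bounds σ
        F⇒region : ∀ {y} → F y → Region f y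
        F⇒region {y} Fy 0F = inj₂ (sym (≈⇒zero c β y (proj₂ (F⊆ Fy))))
        F⇒region {y} Fy 1F = inj₂ (sym (negate-zero⁺ hF (≈⇒zero c β y (proj₂ (F⊆ Fy)))))
        F⇒region Fy (suc (suc i)) = proj₁ (ofForms-region (bounds σ)) (proj₁ (F⊆ Fy)) i
        region⇒F : ∀ {y} → Region f y → F y
        region⇒F {y} r = ⊆F (proj₂ (ofForms-region (bounds σ)) (λ i → r (suc (suc i))) ,
          zero⇒≈ c β y (nonneg-antisym hF {y} (r 0F) (r 1F)))
        interior = ri-satisfiable f (w , F⇒region Fw)
        x = proj₁ interior
        x∈riF : Ri F x
        x∈riF = ri-cong {A = Region f} {B = F} (region⇒F , F⇒region) (proj₂ interior)
        Fx = Ri.inside x∈riF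
        τ = signs x
        σx : Closure σ x
        σx = toClosure σ (proj₁ (F⊆ Fx))
        -- Where `τ` differs from `σ` the form vanishes at `x`, and then on `F` because `x` is
        -- relatively interior to `F`.
        F⊆τ : F ⊆ Closure τ
        F⊆τ {y} Fy i = [ (λ eq → ≡.subst (λ s → Weakly s (h i) y) eq (toClosure σ (proj₁ (F⊆ Fy)) i))
                       , (λ eq → zero⇒weakly (τ i) (h i) (weakly-support (σ i) (h i) {A = F} {x} {y}
                           (λ {y} Fy → toClosure σ (proj₁ (F⊆ Fy)) i) x∈riF
                           (≡.subst (λ s → Has s (h i) x) eq (in-cell x i)) Fy))
                       ]′ (weakly-zero (σ i) (τ i) (h i) {x} (σx i) (in-cell x i))
        -- Here `x` is relatively interior to the closed cell of `τ`, so `hF` vanishes on all of it.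
        τ⊆F : Closure τ ⊆ F
        τ⊆F {y} τy = ⊆F (inside τy , zero⇒≈ c β y (ri-support {A = Closure τ} hF {x} {y}
            (λ {y} τy → ≤⇒nonneg c β y (P⊆ (inside τy))) (cell-ri τ (in-cell x)) (≈⇒zero c β x (proj₂ (F⊆ Fx))) τy))
          where
          inside : ∀ {y} → Closure τ y → ⟦ polyhedron σ ⟧ y
          inside τy = fromClosure σ (closure-⊆ σ τ (in-cell x) σx τy)

    -- Closedness is assumed along segments: a point of the closure of a nonempty cell is the end of
    -- a segment whose inner points lie in the cell.
    module _ (X : Pred (Point d) 0ℓ)
             (X-cells : ∀ {x y} → (∀ i → SameSign x y (h i)) → X x → X y)
             (X-closed : ∀ {x} z → (∀ t → 0# < t → t < 1# → X (line x z t)) → X x) where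
      private
        vector : Fin (3 ℕ.^ n) → Fin n → Sign
        vector = finToFun

        -- Sign vectors of empty cells are left out: their weak inequalities may still have
        -- solutions, which could repeat a face or leave `X`.
        Good : Pred (Fin (3 ℕ.^ n)) 0ℓ
        Good k = Satisfiable (Cell (vector k)) × (Cell (vector k) ⊆ X)

        open Enumeration (enumerate em Good)

        σ : Fin size → Fin n → Sign
        σ k = vector (elem k)

        P : Fin size → Polyhedron d
        P k = polyhedron (σ k)

        sat : ∀ k → Satisfiable ⟦ P k ⟧
        sat k = let x , c = proj₁ (holds k) in x , fromClosure (σ k) λ i → has⇒weakly (σ k i) (h i) (c i)

        same-cell : ∀ s t {g : Form d} {x y} → s ≡ t → Has s g x → Has t g y → SameSign x y g
        same-cell 0F _ ≡.refl p q = inj₁ (p , q)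
        same-cell 1F _ ≡.refl p q = inj₂ (inj₁ (p , q))
        same-cell 2F _ ≡.refl p q = inj₂ (inj₂ (p , q))

        index : ∀ x → X x → ∃ λ k → ∀ i → σ k i ≡ signs x i
        index x Xx =
          let code = funToFin (signs x)
              code≡ = Finₚ.finToFun-funToFin (signs x)
              decode = λ i → ≡.subst (λ s → Has s (h i) x) (≡.sym (code≡ i)) (in-cell x i)
              k , eq = complete code ((x , decode) , λ {y} c →
                X-cells (λ i → same-cell (vector code i) (vector code i) ≡.refl (decode i) (c i)) Xx)
          in k , λ i → ≡.trans (≡.cong (λ c → vector c i) eq) (code≡ i)

        closure-cong : ∀ {σ τ : Fin n → Sign} → (∀ i → σ i ≡ τ i) → ∀ {x} → Closure σ x → Closure τ x
        closure-cong eq {x} w i = ≡.subst (λ s → Weakly s (h i) x) (eq i) (w i)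

        closure⊆X : ∀ k {x} → Closure (σ k) x → X x
        closure⊆X k {x} w = let z , c = proj₁ (holds k) in X-closed z λ t 0<t t<1 →
          proj₂ (holds k) λ i → has-line (σ k i) (h i) x z t 0<t t<1 (w i) (c i)

      arrangementComplex : PolyhedralComplex d
      arrangementComplex = record
        { size = size
        ; face = P
        ; dim = λ k → proj₁ (dimension-exists (sat k))
        ; nonempty = sat
        ; hasDimension = λ k → fromDimension (proj₂ (dimension-exists (sat k)))
        ; distinct = λ k l (Pk⊆Pl , Pl⊆Pk) →
            let x , c = proj₁ (holds l)
                z , c′ = proj₁ (holds k)
                w = toClosure (σ k) (Pl⊆Pk (fromClosure (σ l) λ i → has⇒weakly (σ l i) (h i) (c i)))
                w′ = toClosure (σ l) (Pk⊆Pl (fromClosure (σ k) λ i → has⇒weakly (σ k i) (h i) (c′ i)))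
            in injective k l (≡.trans (≡.sym (Finₚ.funToFin-finToFin {n} (elem k)))
                 (≡.trans (funToFin-cong (closure-signs (σ k) (σ l) c w c′ w′)) (Finₚ.funToFin-finToFin {n} (elem l))))
        ; faceClosed = λ k F face s →
            let x , Fx , F⊆τ , τ⊆F = face-closure (σ k) F face s
                l , eq = index x (closure⊆X k (toClosure (σ k) (proj₁ (proj₁ (proj₂ (proj₂ (proj₂ face))) Fx))))
            in l , (λ Fy → fromClosure (σ l) (closure-cong (≡.sym ∘ eq) (F⊆τ Fy))) ,
                   (λ Py → τ⊆F (closure-cong eq (toClosure (σ l) Py)))
        ; intersection = λ k l _ → intersection-face (σ k) (σ l) ,
            face-swap (intersection-face (σ l) (σ k))
        }
        where
        face-swap : ∀ {A B C : Pred (Point d) 0ℓ} → (A ∩ B) IsFaceOf C → (B ∩ A) IsFaceOf C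
        face-swap (c , β , C⊆ , F⊆ , ⊆F) = c , β , C⊆ , (λ (b , a) → F⊆ (a , b)) , λ p → let a , b = ⊆F p in b , a

      arrangementComplex-support : PolyhedralComplex.support arrangementComplex ≐ X
      arrangementComplex-support =
        (λ (k , Pk) → closure⊆X k (toClosure (σ k) Pk)) ,
        λ {x} Xx → let k , eq = index x Xx in
          k , fromClosure (σ k) (closure-cong (≡.sym ∘ eq) λ i → has⇒weakly (signs x i) (h i) (in-cell x i))

lowerEM : ExcludedMiddle (Level.suc 0ℓ) → ExcludedMiddle 0ℓ
lowerEM em = map′ Level.lower lift em

least : ExcludedMiddle 0ℓ → ∀ {n} {P : Pred (Fin n) 0ℓ} → ∃ P →
  ∃ λ i → P i × (∀ j → toℕ j ℕ.< toℕ i → ¬ P j)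
least em {suc n} {P} (i , Pi) with em {P zero}
... | yes P₀ = zero , P₀ , λ _ ()
least em {suc n} {P} (zero , P₀) | no ¬P₀ = ⊥-elim (¬P₀ P₀)
least em {suc n} {P} (suc i , Pi) | no ¬P₀ =
  let j , Pj , min = least em (i , Pi) in
  suc j , Pj , λ { zero _ → ¬P₀ ; (suc k) (ℕ.s≤s k<j) → min k k<j }

-- Topology of forms, segments and convex sets

module Topology (em : ExcludedMiddle 0ℓ) (ℝ : CompleteOrderedField) where
  open CompleteOrderedField ℝ hiding (_-_)
  open ArrangementComplex em ℝ public
  open SetoidReasoning setoid

  -- `bound` yields the ℓ¹ norm `S` of `b`: on a ball of radius `ε` for the sup norm the form
  -- decreases by at most `ε * S`.
  ball-pos : ∀ {d} (h : Form d) {x} → Pos h x → Small (λ ε → ∀ {y} → Ball x ε y → Pos h y)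
  ball-pos {d} (b , a) {x} hx = let S , lower = bound b in
    small-map (λ ε 0<ε p {y} B → <-≤-trans p
        (by-≤ (≤⇒0≤- (lower ε x y B)) (solve 4 (λ X Y a E → Y :- (X :+ E) := Y :+ a :- (X :+ a :+ E)) refl _ _ a _)))
      (small-pos hx (- S))
    where
    bound : ∀ {d} (b : Point d) → ∃ λ S → ∀ ε x y → Ball x ε y → ⟨ b , x ⟩ + ε * - S ≤ ⟨ b , y ⟩
    bound {zero} b = 0# , λ ε x y _ → inj₂ (solve 1 (λ ε → con ℤ.0ℤ :+ ε :* (:- con ℤ.0ℤ) := con ℤ.0ℤ) refl ε)
    bound {suc d} b with bound (F.tail b) | ≤-total 0# (F.head b)
    ... | S , low | inj₁ 0≤b₀ = F.head b + S , λ ε x y B → by-≤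
      (+-nonneg (*-nonneg 0≤b₀ (inj₁ (<⇒0<- (proj₁ (B zero))))) (≤⇒0≤- (low ε (F.tail x) (F.tail y) (B ∘ suc))))
      (solve 7 (λ b x y ε S X Y → b :* (y :- (x :- ε)) :+ (Y :- (X :+ ε :* (:- S)))
         := b :* y :+ Y :- (b :* x :+ X :+ ε :* (:- (b :+ S)))) refl (F.head b) (F.head x) (F.head y) ε S _ _)
    ... | S , low | inj₂ b₀≤0 = - F.head b + S , λ ε x y B → by-≤
      (+-nonneg (*-nonneg (≤⇒0≤- b₀≤0) (inj₁ (<⇒0<- (proj₂ (B zero))))) (≤⇒0≤- (low ε (F.tail x) (F.tail y) (B ∘ suc))))
      (solve 7 (λ b x y ε S X Y → (con ℤ.0ℤ :- b) :* (x :+ ε :- y) :+ (Y :- (X :+ ε :* (:- S)))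
         := b :* y :+ Y :- (b :* x :+ X :+ ε :* (:- (:- b :+ S)))) refl (F.head b) (F.head x) (F.head y) ε S _ _)

  -- Predicates on points need not respect coordinatewise `≈`; open ones do, because every ball
  -- around `x` contains `y`.
  open-resp : ∀ {d} (A : Pred (Point d) 0ℓ) → Open A → ∀ {x y} → (∀ i → x i ≈ y i) → A x → A y
  open-resp A A-open {x} {y} x≈y Ax = let ε , 0<ε , ball = A-open Ax in ball λ i →
    by-< 0<ε (trans (solve 2 (λ x ε → ε := x :- (x :- ε)) refl (x i) ε) (+-congʳ (x≈y i))) ,
    by-< 0<ε (trans (solve 2 (λ x ε → ε := x :+ ε :- x) refl (x i) ε) (+-congˡ (-‿cong (x≈y i))))

  small-ball : ∀ {d} (x v : Point d) {ε} → 0# < ε →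
    Small (λ t → Ball x ε (λ i → x i + t * v i) × Ball x ε (λ i → x i + - t * v i))
  small-ball x v {ε} 0<ε = small-map
    (λ t _ p → (λ i → by-< (proj₁ (p i)) (solve 4 (λ x v ε t → ε :+ t :* v := x :+ t :* v :- (x :- ε)) refl (x i) (v i) ε t) ,
                      by-< (proj₂ (p i)) (solve 4 (λ x v ε t → ε :+ t :* (:- v) := x :+ ε :- (x :+ t :* v)) refl (x i) (v i) ε t)) ,
               (λ i → by-< (proj₂ (p i)) (solve 4 (λ x v ε t → ε :+ t :* (:- v) := x :+ (:- t) :* v :- (x :- ε)) refl (x i) (v i) ε t) ,
                      by-< (proj₁ (p i)) (solve 4 (λ x v ε t → ε :+ t :* v := x :+ ε :- (x :+ (:- t) :* v)) refl (x i) (v i) ε t)))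
    (small-∀ λ i → small-∧ (small-pos 0<ε (v i)) (small-pos 0<ε (- v i)))

  line-0 : ∀ {d} (x y : Point d) i → x i ≈ line x y 0# i
  line-0 x y i = solve 2 (λ x y → x := x :+ con ℤ.0ℤ :* (y :- x)) refl (x i) (y i)

  line-1 : ∀ {d} (x y : Point d) i → y i ≈ line x y 1# i
  line-1 x y i = solve 2 (λ x y → y := x :+ con ℤ.1ℤ :* (y :- x)) refl (x i) (y i)

  line-cong : ∀ {d} (x y : Point d) {s t} → s ≈ t → ∀ i → line x y s i ≈ line x y t i
  line-cong x y s≈t i = +-congˡ (*-congʳ s≈t)

  open-line : ∀ {d} (A : Pred (Point d) 0ℓ) → Open A → ∀ {x y s} → A (line x y s) →
    Small (λ t → A (line x y (s + t)) × A (line x y (s - t)))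
  open-line A A-open {x} {y} {s} Az = let ε , 0<ε , ball = A-open Az in small-map
    (λ t _ (B , B′) →
      open-resp A A-open (λ i → solve 4 (λ x v s t → x :+ s :* v :+ t :* v := x :+ (s :+ t) :* v) refl (x i) (y i - x i) s t) (ball B) ,
      open-resp A A-open (λ i → solve 4 (λ x v s t → x :+ s :* v :+ (:- t) :* v := x :+ (s :- t) :* v) refl (x i) (y i - x i) s t) (ball B′))
    (small-ball (line x y s) (λ i → y i - x i) 0<ε)

  -- Near the supremum of the parameters in V both V and W are reached.
  convex⇒connected : ∀ {d} (A : Pred (Point d) 0ℓ) →
    (∀ {x y} → A x → A y → ∀ t → 0# ≤ t → t ≤ 1# → A (line x y t)) → Connected A
  convex⇒connected A A-convex V W V-open W-open A⊆V∪W (x , Ax , Vx) (y , Ay , Wy) = cases (A⊆V∪W Az)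
    where
    Q : Pred Carrier 0ℓ
    Q t = (0# ≤ t) × (t ≤ 1#) × V (line x y t)
    Q0 : Q 0#
    Q0 = inj₂ refl , inj₁ 0<1 , open-resp V V-open (line-0 x y) Vx
    sup = supremum Q (0# , Q0) (1# , λ t Qt → proj₁ (proj₂ Qt))
    s = proj₁ sup
    upper = proj₁ (proj₂ sup)
    least-upper = proj₂ (proj₂ sup)
    0≤s : 0# ≤ s
    0≤s = upper 0# Q0
    s≤1 : s ≤ 1#
    s≤1 = least-upper 1# λ t Qt → proj₁ (proj₂ Qt)
    Az : A (line x y s)
    Az = A-convex Ax Ay s 0≤s s≤1
    -- Openness of `V` would give parameters beyond the supremum unless `s` is 1, and then `y` is
    -- the common point.
    V-case : V (line x y s) → s ≤ 1# → Satisfiable (A ∩ (V ∩ W))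
    V-case Vz (inj₂ s≈1) = y , Ay , open-resp V V-open (λ i → trans (line-cong x y s≈1 i) (sym (line-1 x y i))) Vz , Wy
    V-case Vz (inj₁ s<1) =
      let t , 0<t , t<1-s , Vt , _ = small-witness (small-∧ (small-< (<⇒0<- s<1)) (open-line V V-open {x} {y} {s} Vz))
          s+t≤1 = by-≤ (inj₁ (<⇒0<- t<1-s)) (solve 2 (λ s t → con ℤ.1ℤ :- s :- t := con ℤ.1ℤ :- (s :+ t)) refl s t)
      in ⊥-elim (≤⇒≯ (upper (s + t) (+-nonneg 0≤s (inj₁ 0<t) , s+t≤1 , Vt))
           (by-< 0<t (solve 2 (λ s t → t := s :+ t :- s) refl s t)))
    module _ (Wz : W (line x y s)) where
      near = open-line W W-open {x} {y} {s} Wz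
      δ = proj₁ near
      reached : ∀ t → Q t → s - δ < t → t < s ⊎ t ≈ s → Satisfiable (A ∩ (V ∩ W))
      reached t (0≤t , t≤1 , Vt) _ (inj₂ t≈s) =
        line x y t , A-convex Ax Ay t 0≤t t≤1 , Vt , open-resp W W-open (line-cong x y (sym t≈s)) Wz
      reached t (0≤t , t≤1 , Vt) s-δ<t (inj₁ t<s) =
        line x y t , A-convex Ax Ay t 0≤t t≤1 , Vt , open-resp W W-open (line-cong x y (solve 2 (λ s t → s :- (s :- t) := t) refl s t))
          (proj₂ (proj₂ (proj₂ near) (s - t) (<⇒0<- t<s)
            (by-< (<⇒0<- s-δ<t) (solve 3 (λ s δ t → t :- (s :- δ) := δ :- (s :- t)) refl s δ t))))
      approach : Dec (∃ λ t → Q t × (s - δ < t)) → Satisfiable (A ∩ (V ∩ W))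
      approach (yes (t , Qt , lt)) = reached t Qt lt (upper t Qt)
      approach (no none) = ⊥-elim (≤⇒≯ (least-upper (s - δ) (λ t Qt → ≮⇒≥ λ lt → none (t , Qt , lt)))
        (by-< (proj₁ (proj₂ near)) (solve 2 (λ s δ → δ := s :- (s :- δ)) refl s δ)))
    cases : V (line x y s) ⊎ W (line x y s) → Satisfiable (A ∩ (V ∩ W))
    cases (inj₁ Vz) = V-case Vz s≤1
    cases (inj₂ Wz) = approach Wz em

  pos-segment : ∀ {d} (h : Form d) x y t → 0# ≤ t → t ≤ 1# → Pos h x → Pos h y → Pos h (line x y t)
  pos-segment h x y t (inj₂ 0≈t) _ hx hy = <-respʳ (eval-cong h λ i → trans (line-0 x y i) (line-cong x y 0≈t i)) hx
  pos-segment h x y t (inj₁ 0<t) (inj₂ t≈1) hx hy =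
    <-respʳ (eval-cong h λ i → trans (line-1 x y i) (line-cong x y (sym t≈1) i)) hy
  pos-segment h x y t (inj₁ 0<t) (inj₁ t<1) hx hy = pos-convex h x y t 0<t t<1 (inj₁ hx) hy

  whole-dimension : ∀ {d} → Dimension {d} U d
  whole-dimension {d} = dimension (family points (λ _ → tt) points-independent) ¬family
    where
    δ : ∀ {n} → Fin n → Fin n → Carrier
    δ zero zero = 1#
    δ zero (suc k) = 0#
    δ (suc j) zero = 0#
    δ (suc j) (suc k) = δ j k
    sum-δ : ∀ {n} (t : Vector Carrier n) k → sum (λ j → t j * δ j k) ≈ t k
    sum-δ {suc n} t zero = trans (+-congˡ (sum-zero λ j → zeroʳ (t (suc j)))) (solve 1 (λ t → t :* con ℤ.1ℤ :+ con ℤ.0ℤ := t) refl (t zero))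
    sum-δ {suc n} t (suc k) = trans (+-congˡ (sum-δ (F.tail t) k)) (solve 2 (λ t u → t :* con ℤ.0ℤ :+ u := u) refl (t zero) (t (suc k)))
    points : Fin (suc d) → Point d
    points zero = λ _ → 0#
    points (suc j) = δ j
    points-independent : Independent points
    points-independent t null = λ { zero → t₀≈0 ; (suc k) → tₖ≈0 k }
      where
      tₖ≈0 : ∀ k → t (suc k) ≈ 0#
      tₖ≈0 k = begin
        t (suc k)                                           ≈⟨ sum-δ (F.tail t) k ⟨
        sum (λ j → t (suc j) * δ j k)                       ≈⟨ solve 2 (λ t s → s := t :* con ℤ.0ℤ :+ s) refl (t zero) _ ⟩
        t zero * 0# + sum (λ j → t (suc j) * δ j k)         ≈⟨ null (suc k) ⟩
        0#                                                  ∎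
      t₀≈0 : t zero ≈ 0#
      t₀≈0 = begin
        t zero                                              ≈⟨ solve 1 (λ t → t := t :* con ℤ.1ℤ :+ con ℤ.0ℤ) refl (t zero) ⟩
        t zero * 1# + 0#                                    ≈⟨ +-congˡ (sum-zero λ j → trans (*-congʳ (tₖ≈0 j)) (zeroˡ 1#)) ⟨
        t zero * 1# + sum (λ j → t (suc j) * 1#)            ≈⟨ null zero ⟩
        0#                                                  ∎

-- Linear regions of tropical polynomials

module LinearRegions (em : ExcludedMiddle (Level.suc 0ℓ)) (ℝ : CompleteOrderedField) where
  open CompleteOrderedField ℝ hiding (_-_)
  open Topology (lowerEM em) ℝ public
  open TropicalGeometry em ℝ public
    using (Function; maximum; IsTropicalPolynomial; ⨀; AffineOn; 𝒱; mComp; fComp; χ; ⋂[_])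
  open SetoidReasoning setoid
  open RelativelyOpenConvex
  open Constant

  -- A maximum is kept through its two characteristic properties, which pass to sums more readily
  -- than the fold in `IsTropicalPolynomial`: pairs of terms are the terms of the sum.
  record MaxOf {d} (g : Function d) : Set where
    field
      terms    : ℕ
      form     : Fin terms → Form d
      bound    : ∀ x i → eval (form i) x ≤ g x
      attained : ∀ x → ∃ λ i → eval (form i) x ≈ g x

  foldr-⊔ : ∀ {n} a (v : Vector Carrier n) → (a ≤ foldr _⊔_ a v) × (∀ i → v i ≤ foldr _⊔_ a v) ×
    (a ≈ foldr _⊔_ a v ⊎ ∃ λ i → v i ≈ foldr _⊔_ a v)
  foldr-⊔ {zero} a v = inj₂ refl , (λ ()) , inj₁ refl
  foldr-⊔ {suc n} a v = let a≤m , v≤m , attained = foldr-⊔ a (F.tail v) in cases a≤m v≤m attained (≤-total v₀ m)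
    where
    v₀ = F.head v
    m = foldr _⊔_ a (F.tail v)
    open Max totalOrder using (x≤y⇒x⊔y≈y; x≤y⇒y⊔x≈y)
    cases : a ≤ m → (∀ i → v (suc i) ≤ m) → (a ≈ m ⊎ ∃ λ i → v (suc i) ≈ m) → v₀ ≤ m ⊎ m ≤ v₀ →
      (a ≤ v₀ ⊔ m) × (∀ i → v i ≤ v₀ ⊔ m) × (a ≈ v₀ ⊔ m ⊎ ∃ λ i → v i ≈ v₀ ⊔ m)
    cases a≤m v≤m attained (inj₁ v₀≤m) = let eq = sym (x≤y⇒x⊔y≈y v₀≤m) in
      ≤-respʳ eq a≤m , (λ { zero → ≤-respʳ eq v₀≤m ; (suc i) → ≤-respʳ eq (v≤m i) }) ,
      [ (λ a≈m → inj₁ (trans a≈m eq)) , (λ (i , vᵢ≈m) → inj₂ (suc i , trans vᵢ≈m eq)) ]′ attained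
    cases a≤m v≤m attained (inj₂ m≤v₀) = let eq = sym (x≤y⇒y⊔x≈y m≤v₀) in
      ≤-respʳ eq (≤-trans a≤m m≤v₀) , (λ { zero → inj₂ eq ; (suc i) → ≤-respʳ eq (≤-trans (v≤m i) m≤v₀) }) , inj₂ (zero , eq)

  tropical⇒maxOf : ∀ {d} {g : Function d} → IsTropicalPolynomial g → MaxOf g
  tropical⇒maxOf {g = g} (n , a , b , g≈) = record
    { terms = suc n
    ; form = λ i → b i , a i
    ; bound = λ x → λ
        { zero → ≤-respʳ (sym (g≈ x)) (proj₁ (foldr-⊔ _ (F.tail (values x))))
        ; (suc i) → ≤-respʳ (sym (g≈ x)) (proj₁ (proj₂ (foldr-⊔ (F.head (values x)) (F.tail (values x)))) i) }
    ; attained = λ x → [ (λ eq → zero , trans eq (sym (g≈ x))) , (λ (i , eq) → suc i , trans eq (sym (g≈ x))) ]′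
        (proj₂ (proj₂ (foldr-⊔ (F.head (values x)) (F.tail (values x)))))
    }
    where
    values : ∀ x → Vector Carrier (suc n)
    values x i = ⟨ b i , x ⟩ + a i

  Coincide : ∀ {d} → Form d → Form d → Set
  Coincide h k = ∀ x → eval h x ≈ eval k x

  -- The combinatorial counterpart of lying off `𝒱 g`. Different indices may carry the same affine
  -- function, so uniqueness is required of the maximal function and not of its index.
  Regular : ∀ {d} {g : Function d} → MaxOf g → Pred (Point d) 0ℓ
  Regular {g = g} M x = ∀ i j → eval (form i) x ≈ g x → eval (form j) x ≈ g x → Coincide (form i) (form j)
    where open MaxOf M

  maxOf-0 : ∀ {d} → MaxOf {d} (λ _ → 0#)
  maxOf-0 = record
    { terms = 1 ; form = λ _ → (λ _ → 0#) , 0#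
    ; bound = λ x _ → inj₂ (eval-0 x) ; attained = λ x → zero , eval-0 x }

  module _ {d} {g h : Function d} (M : MaxOf g) (N : MaxOf h) where
    private
      module M = MaxOf M
      module N = MaxOf N

      sum-form : Fin M.terms × Fin N.terms → Form d
      sum-form (i , j) = M.form i ⊕ N.form j

      sum-value : ∀ x i j → eval (sum-form (i , j)) x ≈ eval (M.form i) x + eval (N.form j) x
      sum-value x i j = eval-⊕ (M.form i) (N.form j) x

      combined : ∀ x i j → eval (sum-form (remQuot N.terms (combine i j))) x ≈ eval (M.form i) x + eval (N.form j) x
      combined x i j = trans (reflexive (≡.cong (λ p → eval (sum-form p) x) (Finₚ.remQuot-combine i j))) (sum-value x i j)

    maxOf-+ : MaxOf (λ x → g x + h x)
    maxOf-+ = record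
      { terms = M.terms ℕ.* N.terms
      ; form = sum-form ∘ remQuot N.terms
      ; bound = λ x k → let i , j = remQuot {M.terms} N.terms k in ≤-respˡ (sym (sum-value x i j)) (by-≤
          (+-nonneg (≤⇒0≤- (M.bound x i)) (≤⇒0≤- (N.bound x j)))
          (solve 4 (λ a b u v → a :- u :+ (b :- v) := a :+ b :- (u :+ v)) refl _ _ _ _))
      ; attained = λ x → let i , p = M.attained x ; j , q = N.attained x in
          combine i j , trans (combined x i j) (+-cong p q)
      }

    -- A sum of two terms attains the maximum only if each summand does.
    regular-+ : ∀ {x} → Regular M x → Regular N x → Regular maxOf-+ x
    regular-+ {x} rM rN k l pk pl y =
      let i , j = remQuot {M.terms} N.terms k
          i′ , j′ = remQuot {M.terms} N.terms l
          p , q = summands i j (trans (sym (sum-value x i j)) pk)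
          p′ , q′ = summands i′ j′ (trans (sym (sum-value x i′ j′)) pl)
      in trans (sum-value y i j) (trans (+-cong (rM i i′ p p′ y) (rN j j′ q q′ y)) (sym (sum-value y i′ j′)))
      where
      summands : ∀ i j → eval (M.form i) x + eval (N.form j) x ≈ g x + h x →
        (eval (M.form i) x ≈ g x) × (eval (N.form j) x ≈ h x)
      summands i j eq =
        ≤-antisym (M.bound x i) (by-≤ (≤⇒0≤- (N.bound x j))
          (trans (solve 3 (λ a b v → b :- v := a :+ b :- a :- v) refl (g x) (h x) _)
            (trans (+-congʳ (+-congʳ (sym eq))) (solve 3 (λ u v a → u :+ v :- a :- v := u :- a) refl _ _ _)))) ,
        ≤-antisym (N.bound x j) (by-≤ (≤⇒0≤- (M.bound x i))
          (trans (solve 3 (λ a b u → a :- u := a :+ b :- b :- u) refl (g x) (h x) _)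
            (trans (+-congʳ (+-congʳ (sym eq))) (solve 3 (λ u v b → u :+ v :- b :- u := v :- b) refl _ _ _))))

    -- A maximal term of `h` added to two maximal terms of `g` gives two maximal terms of the sum,
    -- and then cancels.
    regular-+ˡ : ∀ {x} → Regular maxOf-+ x → Regular M x
    regular-+ˡ {x} r i i′ p p′ y = let j , q = N.attained x in cancel
      (trans (sym (combined y i j)) (trans
        (r (combine i j) (combine i′ j) (trans (combined x i j) (+-cong p q)) (trans (combined x i′ j) (+-cong p′ q)) y)
        (combined y i′ j)))
      where
      cancel : ∀ {a b c} → a + c ≈ b + c → a ≈ b
      cancel {a} {b} {c} eq = trans (solve 2 (λ a c → a := a :+ c :- c) refl a c)
        (trans (+-congʳ eq) (solve 2 (λ b c → b :+ c :- c := b) refl b c))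

    regular-+ʳ : ∀ {x} → Regular maxOf-+ x → Regular N x
    regular-+ʳ {x} r j j′ q q′ y = let i , p = M.attained x in cancel
      (trans (sym (combined y i j)) (trans
        (r (combine i j) (combine i j′) (trans (combined x i j) (+-cong p q)) (trans (combined x i j′) (+-cong p q′)) y)
        (combined y i j′)))
      where
      cancel : ∀ {a b c} → c + a ≈ c + b → a ≈ b
      cancel {a} {b} {c} eq = trans (solve 2 (λ a c → a := c :+ a :- c) refl a c)
        (trans (+-congʳ eq) (solve 2 (λ b c → c :+ b :- c := b) refl b c))

  maxOf-⨀ : ∀ {d m} {g : Fin m → Function d} → (∀ i → MaxOf (g i)) → MaxOf (⨀ g)
  maxOf-⨀ {m = zero} M = maxOf-0
  maxOf-⨀ {m = suc m} M = maxOf-+ (M zero) (maxOf-⨀ (M ∘ suc))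

  regular-⨀ : ∀ {d m} {g : Fin m → Function d} (M : ∀ i → MaxOf (g i)) {x} →
    (∀ i → Regular (M i) x) → Regular (maxOf-⨀ M) x
  regular-⨀ {m = zero} M r i j _ _ y = refl
  regular-⨀ {m = suc m} M r = regular-+ (M zero) (maxOf-⨀ (M ∘ suc)) (r zero) (regular-⨀ (M ∘ suc) (r ∘ suc))

  regular-⨀⁻ : ∀ {d m} {g : Fin m → Function d} (M : ∀ i → MaxOf (g i)) {x} →
    Regular (maxOf-⨀ M) x → ∀ i → Regular (M i) x
  regular-⨀⁻ {m = suc m} M r zero = regular-+ˡ (M zero) (maxOf-⨀ (M ∘ suc)) r
  regular-⨀⁻ {m = suc m} M r (suc i) = regular-⨀⁻ (M ∘ suc) (regular-+ʳ (M zero) (maxOf-⨀ (M ∘ suc)) r) i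

  -- For small `t` the points of `line x y` at parameters `t` and `- t` both lie in the ball, and
  -- their values are opposite.
  vanishing : ∀ {d} (h : Form d) {x ε} → 0# < ε → (∀ {y} → Ball x ε y → Nonneg h y) → Zero h x → ∀ y → Zero h y
  vanishing h {x} {ε} 0<ε h≥0 hx y = trichotomy (side h y)
    where
    near = small-witness (small-ball x (λ i → y i - x i) 0<ε)
    t = proj₁ near
    0<t = proj₁ (proj₂ near)
    B = proj₁ (proj₂ (proj₂ near))
    B′ = proj₂ (proj₂ (proj₂ near))
    along : ∀ s → eval h (line x y s) ≈ s * eval h y
    along s = trans (eval-line h x y s) (trans (+-cong hx (*-congˡ (+-congˡ (-‿cong hx))))
      (solve 2 (λ s e → con ℤ.0ℤ :+ s :* (e :- con ℤ.0ℤ) := s :* e) refl s _))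
    trichotomy : Pos h y ⊎ Zero h y ⊎ Neg h y → Zero h y
    trichotomy (inj₂ (inj₁ z)) = z
    trichotomy (inj₁ p) = ⊥-elim (≤⇒≯ (h≥0 B′) (<-respˡ
      (trans (solve 2 (λ t e → :- (t :* e) := (:- t) :* e) refl t _) (sym (along (- t)))) (neg-neg (*-pos 0<t p))))
    trichotomy (inj₂ (inj₂ n)) = ⊥-elim (≤⇒≯ (h≥0 B) (<-respˡ
      (trans (solve 2 (λ t e → :- (t :* (:- e)) := t :* e) refl t _) (sym (along t)))
      (neg-neg (*-pos 0<t (neg-pos (neg⇒<0 h y n))))))

  centre : ∀ {d} (x : Point d) {ε} → 0# < ε → Ball x ε x
  centre x {ε} 0<ε i = by-< 0<ε (solve 2 (λ x ε → ε := x :- (x :- ε)) refl (x i) ε) ,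
    by-< 0<ε (solve 2 (λ x ε → ε := x :+ ε :- x) refl (x i) ε)

  module Regions {d} {g : Function d} (M : MaxOf g) where
    open MaxOf M

    -- The affine function minus a term maximal at `x` is nonnegative on the ball and zero at `x`,
    -- so by `vanishing` every such term coincides with the affine function.
    regular-affine : ∀ {x ε} → 0# < ε → AffineOn g (Ball x ε) → Regular M x
    regular-affine {x} {ε} 0<ε (c , a , g≈) i j pi pj y = trans (coincides i pi y) (sym (coincides j pj y))
      where
      ℓ : Form d
      ℓ = c , a
      coincides : ∀ i → eval (form i) x ≈ g x → ∀ y → eval (form i) y ≈ eval ℓ y
      coincides i pi y = by-≈ (vanishing (ℓ ⊖ form i) 0<ε
        (λ {y} B → ≤-respʳ (sym (eval-⊖ ℓ (form i) y)) (≤⇒0≤- (≤-respʳ (g≈ y B) (bound y i))))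
        (trans (eval-⊖ ℓ (form i) x) (trans (+-cong (sym (g≈ x (centre x 0<ε))) (-‿cong pi))
          (solve 1 (λ g → g :- g := con ℤ.0ℤ) refl (g x)))) y)
        (eval-⊖ ℓ (form i) y)

    -- The region of term `i`, by sign conditions on differences of terms and without `g`: it is
    -- visibly open, convex and a union of cells.
    Reg : Fin terms → Pred (Point d) 0ℓ
    Reg i x = ∀ j → Coincide (form i) (form j) ⊎ Pos (form i ⊖ form j) x

    reg-max : ∀ i {x} → Reg i x → eval (form i) x ≈ g x
    reg-max i {x} r = let j , p = attained x in [ (λ eq → trans (eq x) p) , (λ pos → ⊥-elim (≤⇒≯ (bound x i)
      (<-respˡ p (0<-⇒< (<-respʳ (eval-⊖ (form i) (form j) x) pos))))) ]′ (r j)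

    reg-coincide : ∀ i j {x} → Reg i x → eval (form j) x ≈ g x → Coincide (form i) (form j)
    reg-coincide i j {x} r p = [ id , (λ pos → ⊥-elim (irrefl (sym (trans (eval-⊖ (form i) (form j) x)
      (trans (+-cong (reg-max i r) (-‿cong p)) (solve 1 (λ g → g :- g := con ℤ.0ℤ) refl (g x))))) pos)) ]′ (r j)

    reg-regular : ∀ i {x} → Reg i x → Regular M x
    reg-regular i r k l pk pl y = trans (sym (reg-coincide i k r pk y)) (reg-coincide i l r pl y)

    max-reg : ∀ {x} → Regular M x → ∀ i → eval (form i) x ≈ g x → Reg i x
    max-reg {x} r i p j with bound x j
    ... | inj₂ q = inj₁ (r i j p q)
    ... | inj₁ q = inj₂ (<-respʳ (sym (eval-⊖ (form i) (form j) x)) (<⇒0<- (<-respʳ (sym p) q)))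

    -- `P t` stands for the ball of radius `t` or for the single point at a parameter `t` or `- t`
    -- of a line; openness, prolongation and dimension all rest on this one statement.
    reg-near : ∀ i {x} {P : Carrier → Pred (Point d) 0ℓ} →
      (∀ j → Pos (form i ⊖ form j) x → Small (λ t → ∀ y → P t y → Pos (form i ⊖ form j) y)) →
      Reg i x → Small (λ t → ∀ y → P t y → Reg i y)
    reg-near i {x} {P} near r = small-map (λ t _ f y Py j → f j y Py) (small-∀ λ j → at j (r j))
      where
      at : ∀ j → Coincide (form i) (form j) ⊎ Pos (form i ⊖ form j) x →
        Small (λ t → ∀ y → P t y → Coincide (form i) (form j) ⊎ Pos (form i ⊖ form j) y)
      at j (inj₁ eq) = small-true λ _ _ _ _ → inj₁ eq
      at j (inj₂ p) = small-map (λ _ _ f y Py → inj₂ (f y Py)) (near j p)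

    reg-open : ∀ i → Open (Reg i)
    reg-open i {x} r =
      let ε , 0<ε , ball = small-witness (reg-near i {x} {λ ε → Ball x ε} (λ j p → small-map (λ _ _ f y → f {y}) (ball-pos (form i ⊖ form j) p)) r)
      in ε , 0<ε , λ {y} → ball y

    reg-affine : ∀ i {x} → Reg i x → ∃ λ ε → (0# < ε) × AffineOn g (Ball x ε)
    reg-affine i r = let ε , 0<ε , ball = reg-open i r in
      ε , 0<ε , proj₁ (form i) , proj₂ (form i) , λ y B → sym (reg-max i (ball B))

    reg-convex : ∀ i {x y} → Reg i x → Reg i y → ∀ t → 0# ≤ t → t ≤ 1# → Reg i (line x y t)
    reg-convex i {x} {y} rx ry t 0≤t t≤1 j with rx j | ry j
    ... | inj₁ eq | _ = inj₁ eq
    ... | inj₂ _ | inj₁ eq = inj₁ eq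
    ... | inj₂ p | inj₂ q = inj₂ (pos-segment (form i ⊖ form j) x y t 0≤t t≤1 p q)

    reg-roc : ∀ i → RelativelyOpenConvex (Reg i)
    reg-roc i .convex rx ry t 0<t t<1 = reg-convex i rx ry t (inj₁ 0<t) (inj₁ t<1)
    reg-roc i .prolong {x} {y} rx ry = small-map (λ t _ f → f _ ≡.refl)
      (reg-near i {x} {λ t → _≡ line x y (- t)} (λ j p → small-map (λ { _ _ q _ ≡.refl → q }) (pos-prolong (form i ⊖ form j) x y p)) rx)

    reg-dimension : ∀ i → Satisfiable (Reg i) → Dimension (Reg i) d
    reg-dimension i (x , r) = dimension-dense x (λ _ → tt) (λ y _ → small-map (λ t _ f → f _ ≡.refl)
      (reg-near i {x} {λ t → _≡ line x y t} (λ j p → small-map (λ { _ _ q _ ≡.refl → q }) (pos-line (form i ⊖ form j) x y p)) r))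
      whole-dimension

    -- Coincident terms have the same region, to be counted once: the least index stands for it.
    -- Terms with empty region drop out.
    Representative : Pred (Fin terms) 0ℓ
    Representative i = Satisfiable (Reg i) × (∀ j → toℕ j ℕ.< toℕ i → ¬ Coincide (form j) (form i))

    open Enumeration (enumerate (lowerEM em) Representative) public renaming (size to regions)

    component : Fin regions → Pred (Point d) 0ℓ
    component k = Reg (elem k)

    component-disjoint : ∀ k l {x} → component k x → component l x → k ≡ l
    component-disjoint k l {x} rk rl = injective k l (Finₚ.toℕ-injective (compare-indices (ℕₚ.<-cmp (toℕ (elem k)) (toℕ (elem l)))))
      where
      eq : Coincide (form (elem k)) (form (elem l))
      eq = reg-coincide (elem k) (elem l) rk (reg-max (elem l) rl)
      compare-indices : Tri (toℕ (elem k) ℕ.< toℕ (elem l)) (toℕ (elem k) ≡ toℕ (elem l)) (toℕ (elem l) ℕ.< toℕ (elem k)) →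
        toℕ (elem k) ≡ toℕ (elem l)
      compare-indices (tri< lt _ _) = ⊥-elim (proj₂ (holds l) (elem k) lt eq)
      compare-indices (tri≈ _ e _) = e
      compare-indices (tri> _ _ gt) = ⊥-elim (proj₂ (holds k) (elem l) gt (sym ∘ eq))

    component-cover : ∀ {x} → Regular M x → ∃ λ k → component k x
    component-cover {x} r =
      let i , p = attained x
          j , eq , minimal = least (lowerEM em) {P = λ j → Coincide (form j) (form i)} (i , λ _ → refl)
          rj = max-reg r j (trans (eq x) p)
          k , e = complete j ((x , rj) , λ l l<j eq′ → minimal l l<j (λ y → trans (eq′ y) (eq y)))
      in k , ≡.subst (λ j → Reg j x) (≡.sym e) rj

    regular⇒∁𝒱 : ∀ {x} → Regular M x → ∁ (𝒱 g) x
    regular⇒∁𝒱 {x} r v = let i , p = attained x in v (reg-affine i (max-reg r i p))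

    ∁𝒱⇒regular : ∀ {x} → ∁ (𝒱 g) x → Regular M x
    ∁𝒱⇒regular ¬v i j pi pj y = ¬¬-elim λ ¬eq → ¬v λ (ε , 0<ε , aff) → ¬eq (regular-affine 0<ε aff i j pi pj y)

    component-connected : ∀ k → Connected (component k)
    component-connected k = convex⇒connected (component k) (reg-convex (elem k))

    -- `C` is covered by two disjoint open sets, the component and the remaining regular points; a
    -- point of `C` in the latter would, by connectedness, give a point common to both.
    connected-in-component : ∀ (C : Pred (Point d) 0ℓ) → C ⊆ ∁ (𝒱 g) → Connected C → ∀ k {x} → C x → component k x →
      C ⊆ component k
    connected-in-component C C⊆ conn k {x} Cx rx {y} Cy = ¬¬-elim λ ¬ry →
      let z , _ , rz , _ , ¬rz = conn (component k) Others (λ {x} → reg-open (elem k) {x}) others-open cover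
            (x , Cx , rx) (y , Cy , ∁𝒱⇒regular (C⊆ Cy) , ¬ry)
      in ¬rz rz
      where
      Others : Pred (Point d) 0ℓ
      Others x = Regular M x × ¬ component k x
      others-open : Open Others
      others-open {z} (r , ¬rz) =
        let l , rl = component-cover r
            ε , 0<ε , ball = reg-open (elem l) rl
        in ε , 0<ε , λ {w} B → reg-regular (elem l) (ball B) ,
             λ rw → ¬rz (≡.subst (λ k → component k z) (component-disjoint l k (ball B) rw) rl)
      cover : C ⊆ component k ∪ Others
      cover {z} Cz with lowerEM em {component k z}
      ... | yes rz = inj₁ rz
      ... | no ¬rz = inj₂ (∁𝒱⇒regular (C⊆ Cz) , ¬rz)

    component-regular : ∀ k {x} → component k x → ∁ (𝒱 g) x
    component-regular k r = regular⇒∁𝒱 (reg-regular (elem k) r)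

    component-isComponent : ∀ k → IsComponent (∁ (𝒱 g)) (component k)
    component-isComponent k = record
      { nonempty = proj₁ (holds k)
      ; inside = component-regular k
      ; connected = component-connected k
      ; maximal = λ D D⊆ conn C⊆D → connected-in-component D D⊆ conn k
          (C⊆D (proj₂ (proj₁ (holds k)))) (proj₂ (proj₁ (holds k)))
      }

    component-exhaustive : ∀ C → IsComponent (∁ (𝒱 g)) C → ∃ λ k → C ≐ component k
    component-exhaustive C isC = k , C⊆k , C.maximal (component k) (component-regular k) (component-connected k) C⊆k
      where
      module C = IsComponent isC
      covered : ∃ λ k → component k (proj₁ C.nonempty)
      covered = component-cover (∁𝒱⇒regular (C.inside (proj₂ C.nonempty)))
      k = proj₁ covered
      C⊆k : C ⊆ component k
      C⊆k = connected-in-component C C.inside C.connected k (proj₂ C.nonempty) (proj₂ covered)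

    componentCount : HasComponentCount (∁ (𝒱 g)) regions
    componentCount = record
      { component = component
      ; isComponent = component-isComponent
      ; distinct = λ k l (k⊆l , _) → component-disjoint k l (proj₂ (proj₁ (holds k))) (k⊆l (proj₂ (proj₁ (holds k))))
      ; exhaustive = component-exhaustive
      }

    -- Excluded middle may return any count, so it is compared with `componentCount`: exhaustiveness
    -- matches components injectively in both directions.
    mComp-regions : mComp g ≡ regions
    mComp-regions = count em
      where
      injects : ∀ {m n} → HasComponentCount (∁ (𝒱 g)) m → HasComponentCount (∁ (𝒱 g)) n → m ℕ.≤ n
      injects A B = Finₚ.injective⇒≤ {f = λ i → proj₁ (match i)} λ {i} {j} eq → A.distinct i j
          ( (λ Ai → proj₂ (proj₂ (match j)) (≡.subst (λ k → B.component k _) eq (proj₁ (proj₂ (match i)) Ai)))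
          , (λ Aj → proj₂ (proj₂ (match i)) (≡.subst (λ k → B.component k _) (≡.sym eq) (proj₁ (proj₂ (match j)) Aj))))
        where
        module A = HasComponentCount A
        module B = HasComponentCount B
        match : ∀ i → ∃ λ k → A.component i ≐ B.component k
        match i = B.exhaustive (A.component i) (A.isComponent i)
      count : ∀ (D : Dec (∃ (HasComponentCount (∁ (𝒱 g))))) → maybe′ proj₁ 0 (dec⇒maybe D) ≡ regions
      count (yes (n , H)) = ℕₚ.≤-antisym (injects H componentCount) (injects componentCount H)
      count (no none) = ⊥-elim (none (regions , componentCount))

    forms : List (Form d)
    forms = List.concat (List.tabulate λ i → List.tabulate λ j → form i ⊖ form j)

    sameSign-forms : ∀ {x y} → All (SameSign x y) forms → ∀ i j → SameSign x y (form i ⊖ form j)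
    sameSign-forms same i j = Allₚ.tabulate⁻ (Allₚ.tabulate⁻ (Allₚ.concat⁻ {xss = List.tabulate λ i → List.tabulate λ j → form i ⊖ form j} same) i) j

    reg-sameSign : ∀ i {x y} → (∀ j → SameSign x y (form i ⊖ form j)) → Reg i x → Reg i y
    reg-sameSign i {x} {y} same r j with r j | same j
    ... | inj₁ eq | _ = inj₁ eq
    ... | inj₂ p | inj₁ (_ , q) = inj₂ q
    ... | inj₂ p | inj₂ (inj₁ (z , _)) = ⊥-elim (pos-zero (form i ⊖ form j) {x} p z)
    ... | inj₂ p | inj₂ (inj₂ (n , _)) = ⊥-elim (pos-neg (form i ⊖ form j) {x} p n)

    regular-sameSign : ∀ {x y} → (∀ i j → SameSign x y (form i ⊖ form j)) → Regular M x → Regular M y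
    regular-sameSign same r = let k , rk = component-cover r in reg-regular (elem k) (reg-sameSign (elem k) (same (elem k)) rk)

    regular-line : ∀ {x} z → Regular M x → Small (λ t → Regular M (line x z t))
    regular-line {x} z r = let k , rk = component-cover r in small-map (λ t _ f → reg-regular (elem k) (f _ ≡.refl))
      (reg-near (elem k) {x} {λ t → _≡ line x z t} (λ j p → small-map (λ { _ _ q _ ≡.refl → q }) (pos-line (form (elem k) ⊖ form j) x z p)) rk)

    -- Computed with the arrangement `forms` of this polynomial, but stated for every `H` that
    -- resolves `∁ (𝒱 g)`, so that all hypersurfaces can share one arrangement.
    ∫-∁𝒱 : ∀ H → Constant H U (𝟏 (∁ (𝒱 g))) → ∫ H U (𝟏 (∁ (𝒱 g))) ≡ ℤ.+ mComp g ℤ.* -1^ d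
    ∫-∁𝒱 H c = ≡.trans (∫-independent H forms c (constant λ {x} {y} _ _ same → ≡.trans (partition x)
          (≡.trans (∑-cong ks λ i → value (reg-constant i) tt tt same) (≡.sym (partition y)))))
      (≡.trans (∫-cong forms U partition)
      (≡.trans (∫-∑ forms U ks (λ i → 𝟏 (Reg i)))
      (≡.trans (∑-constant elem (λ i → ∫ forms U (𝟏 (Reg i))) (-1^ d) λ k →
          ∫-cell forms (component k) (reg-constant (elem k)) (reg-roc (elem k)) (proj₁ (holds k)) (reg-dimension (elem k) (proj₁ (holds k))))
        (≡.cong (λ n → ℤ.+ n ℤ.* -1^ d) (≡.sym mComp-regions)))))
      where
      ks = List.tabulate elem
      reg-constant : ∀ i → Constant forms U (𝟏 (Reg i))
      reg-constant i = constant λ {x} {y} _ _ same → 𝟏-cong (Reg i) (Reg i) (reg-sameSign i (sameSign-forms same i))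
        (reg-sameSign i λ j → sameSign-sym {h = form i ⊖ form j} (sameSign-forms same i j))
      partition : ∀ x → 𝟏 (∁ (𝒱 g)) x ≡ ∑ ks λ i → 𝟏 (Reg i) x
      partition x = ≡.trans (𝟏-cong (∁ (𝒱 g)) (λ x → ∃ λ k → component k x)
          (component-cover ∘ ∁𝒱⇒regular) (λ (k , r) → regular⇒∁𝒱 (reg-regular (elem k) r)))
        (≡.sym (𝟏-disjoint elem Reg x λ k l → component-disjoint k l))

open import Data.Integer.Base using (ℤ; +_; -1ℤ; _+_; _*_; _^_)

-- Sums over subsets of a given size

module SubsetSums where
  open FiniteSums

  ∑-subsets : ∀ m (F : Subset (suc m) → ℤ) →
    ∑ (subsets (suc m)) F ≡ ∑ (subsets m) (λ S → F (true Vec.∷ S)) + ∑ (subsets m) (λ S → F (false Vec.∷ S))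
  ∑-subsets m F = ≡.trans (∑-++ (List.map (true Vec.∷_) (subsets m)) _ F)
    (≡.cong₂ _+_ (∑-map (true Vec.∷_) (subsets m) F) (∑-map (false Vec.∷_) (subsets m) F))

  [suc≟suc] : ∀ n k → [ suc n ℕₚ.≟ suc k ]ℤ ≡ [ n ℕₚ.≟ k ]ℤ
  [suc≟suc] n k with n ℕₚ.≟ k | suc n ℕₚ.≟ suc k
  ... | yes _ | yes _ = ≡.refl
  ... | no _ | no _ = ≡.refl
  ... | yes n≡k | no ¬eq = ⊥-elim (¬eq (≡.cong suc n≡k))
  ... | no n≢k | yes eq = ⊥-elim (n≢k (ℕₚ.suc-injective eq))

  ∑-size-0 : ∀ m (F : Subset m → ℤ) → ∑ (subsets m) (λ S → [ ∣ S ∣ ℕₚ.≟ 0 ]ℤ * F S) ≡ F ⊥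
  ∑-size-0 zero F = ≡.trans (ℤₚ.+-identityʳ _) (ℤₚ.*-identityˡ _)
  ∑-size-0 (suc m) F = ≡.trans (∑-subsets m _) (≡.trans (≡.cong₂ _+_
    (∑-zero (subsets m) λ S → ≡.refl) (∑-size-0 m (F ∘ (false Vec.∷_)))) (ℤₚ.+-identityˡ _))

  ∑-size-1 : ∀ m (F : Subset m → ℤ) → ∑ (subsets m) (λ S → [ ∣ S ∣ ℕₚ.≟ 1 ]ℤ * F S) ≡ ∑ (allFin m) (F ∘ ⁅_⁆)
  ∑-size-1 zero F = ≡.refl
  ∑-size-1 (suc m) F = ≡.trans (∑-subsets m _) (≡.cong₂ _+_
    (≡.trans (∑-cong (subsets m) λ S → ≡.cong (_* F (true Vec.∷ S)) ([suc≟suc] ∣ S ∣ 0)) (∑-size-0 m (F ∘ (true Vec.∷_))))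
    (≡.trans (∑-size-1 m (F ∘ (false Vec.∷_))) (≡.trans (≡.sym (∑-map suc (allFin m) (F ∘ ⁅_⁆)))
      (≡.cong (λ xs → ∑ xs (F ∘ ⁅_⁆)) (Listₚ.map-tabulate id suc)))))

-- Inclusion-exclusion and the region count

module RegionCounting (em : ExcludedMiddle (Level.suc 0ℓ)) (ℝ : CompleteOrderedField) where
  open CompleteOrderedField ℝ using (0#; 1#; _<_; 0<1)
  open LinearRegions em ℝ
  open SubsetSums
  open Constant

  -- Subsets are paired by membership of `zero`. If `x` lies in `X zero`, the two terms of a pair
  -- cancel; otherwise the terms containing `zero` vanish and the induction hypothesis remains.
  inclusion-exclusion : ∀ {d m} (X : Fin m → Pred (Point d) 0ℓ) x →
    ∑ (subsets m) (λ S → -1^ ∣ S ∣ * 𝟏 (⋂[ S ] X) x) ≡ 𝟏 (λ x → ∀ i → ¬ X i x) x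
  inclusion-exclusion {m = zero} X x = ≡.trans
    (≡.cong (λ z → ℤ.1ℤ * z + ℤ.0ℤ) (𝟏-yes (⋂[ Vec.[] ] X) λ ()))
    (≡.sym (𝟏-yes (λ x → ∀ i → ¬ X i x) λ ()))
  inclusion-exclusion {d} {m = suc m} X x = ≡.trans (∑-subsets m _) (cases (lowerEM em))
    where
    X′ = X ∘ suc
    Σ′ = ∑ (subsets m) (λ S → -1^ ∣ S ∣ * 𝟏 (⋂[ S ] X′) x)
    without : ∀ S → 𝟏 (⋂[ false Vec.∷ S ] X) x ≡ 𝟏 (⋂[ S ] X′) x
    without S = 𝟏-cong (⋂[ false Vec.∷ S ] X) (⋂[ S ] X′) (λ f i i∈S → f (suc i) (Vec.there i∈S))
      λ { f (suc i) (Vec.there i∈S) → f i i∈S }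
    cases : Dec (X zero x) →
      ∑ (subsets m) (λ S → -1^ ∣ true Vec.∷ S ∣ * 𝟏 (⋂[ true Vec.∷ S ] X) x) +
      ∑ (subsets m) (λ S → -1^ ∣ false Vec.∷ S ∣ * 𝟏 (⋂[ false Vec.∷ S ] X) x) ≡ 𝟏 (λ x → ∀ i → ¬ X i x) x
    cases (yes X₀) = ≡.trans (≡.cong₂ _+_
        (≡.trans (∑-cong (subsets m) λ S → ≡.trans (≡.cong₂ _*_ (-1^suc ∣ S ∣) (with₀ S)) (negate-left (-1^ ∣ S ∣) _))
          (∑-* (subsets m) -1ℤ λ S → -1^ ∣ S ∣ * 𝟏 (⋂[ S ] X′) x))
        (∑-cong (subsets m) λ S → ≡.cong (-1^ ∣ S ∣ *_) (without S)))
      (≡.trans (cancel Σ′) (≡.sym (𝟏-no (λ x → ∀ i → ¬ X i x) λ f → f zero X₀)))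
      where
      with₀ : ∀ S → 𝟏 (⋂[ true Vec.∷ S ] X) x ≡ 𝟏 (⋂[ S ] X′) x
      with₀ S = 𝟏-cong (⋂[ true Vec.∷ S ] X) (⋂[ S ] X′) (λ f i i∈S → f (suc i) (Vec.there i∈S))
        λ { f zero _ → X₀ ; f (suc i) (Vec.there i∈S) → f i i∈S }
      negate-left : ∀ a b → (ℤ.- a) * b ≡ -1ℤ * (a * b)
      negate-left = ℤ-Solver.solve-∀
      cancel : ∀ s → -1ℤ * s + s ≡ ℤ.0ℤ
      cancel = ℤ-Solver.solve-∀
    cases (no ¬X₀) = ≡.trans (≡.cong₂ _+_
        (∑-zero (subsets m) λ S → ≡.trans (≡.cong (-1^ ∣ true Vec.∷ S ∣ *_) (𝟏-no (⋂[ true Vec.∷ S ] X) λ f → ¬X₀ (f zero Vec.here)))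
          (ℤₚ.*-zeroʳ (-1^ ∣ true Vec.∷ S ∣)))
        (∑-cong (subsets m) λ S → ≡.cong (-1^ ∣ S ∣ *_) (without S)))
      (≡.trans (ℤₚ.+-identityˡ Σ′) (≡.trans (inclusion-exclusion X′ x)
        (𝟏-cong (λ x → ∀ i → ¬ X′ i x) (λ x → ∀ i → ¬ X i x) (λ { f zero → ¬X₀ ; f (suc i) → f i }) (λ f i → f (suc i)))))

  all-lookup : ∀ {A : Set} {P : Pred A 0ℓ} (xs : List A) → (∀ i → P (List.lookup xs i)) → All P xs
  all-lookup [] p = []
  all-lookup (x ∷ xs) p = p zero ∷ all-lookup xs (p ∘ suc)

  module _ {d m} (g : Fin m → Function d) (M : ∀ i → MaxOf (g i)) where
    private
      module R i = Regions (M i)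

      -- One arrangement for all hypersurfaces, which also resolves their intersections and the
      -- hypersurface of the product.
      H : List (Form d)
      H = List.concat (List.tabulate λ i → R.forms i)

      X : Subset m → Pred (Point d) 0ℓ
      X S = ⋂[ S ] (λ i → 𝒱 (g i))

      H-forms : ∀ {x y} → All (SameSign x y) H → ∀ i → All (SameSign x y) (R.forms i)
      H-forms same = Allₚ.tabulate⁻ (Allₚ.concat⁻ {xss = List.tabulate λ i → R.forms i} same)

      H-sym : ∀ {x y} → All (SameSign x y) H → All (SameSign y x) H
      H-sym {x} {y} = All.map λ {h} → sameSign-sym {x = x} {y} {h}

      𝒱-cells : ∀ {x y} → All (SameSign x y) H → ∀ i → 𝒱 (g i) x → 𝒱 (g i) y
      𝒱-cells {x} {y} same i v (ε , 0<ε , aff) = R.regular⇒∁𝒱 i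
        (R.regular-sameSign i (R.sameSign-forms i (H-forms (H-sym same) i)) (R.regular-affine i 0<ε aff)) v

      X-cells : ∀ S {x y} → All (SameSign x y) H → X S x → X S y
      X-cells S same Xx i i∈S = 𝒱-cells same i (Xx i i∈S)

      -- If `x` were off `𝒱 (g i)`, so would be the points near `x` on the segment.
      X-closed : ∀ S {x} z → (∀ t → 0# < t → t < 1# → X S (line x z t)) → X S x
      X-closed S {x} z Xt i i∈S (ε , 0<ε , aff) =
        let t , 0<t , t<1 , reg = small-witness (small-∧ (small-< 0<1) (R.regular-line i z (R.regular-affine i 0<ε aff)))
        in R.regular⇒∁𝒱 i reg (Xt t 0<t t<1 i i∈S)

      X-constant : ∀ S → Constant H U (𝟏 (X S))
      X-constant S = constant λ _ _ same → 𝟏-cong (X S) (X S) (X-cells S same) (X-cells S (H-sym same))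

      -- `euler-∫` copes with an arbitrary choice of complex, and `arrangementComplex` rules out the
      -- default value.
      χ-∫ : ∀ S → χ (X S) ≡ ∫ H U (𝟏 (X S))
      χ-∫ S = evaluate em
        where
        evaluate : ∀ (D : Dec (Σ (PolyhedralComplex d) λ C → PolyhedralComplex.support C ≐ X S)) →
          maybe′ (λ (C , _) → PolyhedralComplex.euler C) ℤ.0ℤ (dec⇒maybe D) ≡ ∫ H U (𝟏 (X S))
        evaluate (yes (C , eq)) = euler-∫ C H (X-constant S) eq
        evaluate (no none) = ⊥-elim (none
          (arrangementComplex (List.lookup H) (X S) (λ same → X-cells S (all-lookup H same)) (X-closed S) ,
           arrangementComplex-support (List.lookup H) (X S) (λ same → X-cells S (all-lookup H same)) (X-closed S)))

      e : ℤ
      e = -1^ d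

      N : Fin m → ℤ
      N i = + mComp (g i)

      I : Subset m → ℤ
      I S = ∫ H U (𝟏 (X S))

      ∫-U : ∫ H U (𝟏 U) ≡ e
      ∫-U = ∫-cell H U (constant λ _ _ _ → 𝟏-cong U U id id) roc-U ((λ _ → 0#) , tt) whole-dimension

      I-⊥ : I ⊥ ≡ e
      I-⊥ = ≡.trans (∫-cong H U λ x → 𝟏-cong (X ⊥) U (λ _ → tt) λ _ i i∈⊥ → ⊥-elim (Subsetₚ.∉⊥ i∈⊥)) ∫-U

      ∁𝒱-constant : ∀ i → Constant H U (𝟏 (∁ (𝒱 (g i))))
      ∁𝒱-constant i = constant λ _ _ same → 𝟏-cong (∁ (𝒱 (g i))) (∁ (𝒱 (g i)))
        (λ ¬v v → ¬v (𝒱-cells (H-sym same) i v)) (λ ¬v v → ¬v (𝒱-cells same i v))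

      I-⁅⁆ : ∀ i → I ⁅ i ⁆ ≡ e + -1ℤ * (N i * e)
      I-⁅⁆ i = ≡.trans (∫-cong H U complement) (≡.trans (∫-+ H U (𝟏 U) _) (≡.cong₂ _+_ ∫-U
        (≡.trans (∫-* H U -1ℤ (𝟏 (∁ (𝒱 (g i))))) (≡.cong (-1ℤ *_) (R.∫-∁𝒱 i H (∁𝒱-constant i))))))
        where
        complement : ∀ x → 𝟏 (X ⁅ i ⁆) x ≡ 𝟏 U x + -1ℤ * 𝟏 (∁ (𝒱 (g i))) x
        complement x = ≡.trans (𝟏-cong (X ⁅ i ⁆) (𝒱 (g i)) (λ f → f i (Subsetₚ.x∈⁅x⁆ i))
            λ v j j∈ → ≡.subst (λ k → 𝒱 (g k) x) (≡.sym (Subsetₚ.x∈⁅y⁆⇒x≡y i j∈)) v)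
          (≡.trans (cases (lowerEM em)) (≡.cong (λ u → u + -1ℤ * 𝟏 (∁ (𝒱 (g i))) x) (≡.sym (𝟏-yes U {x} tt))))
          where
          cases : Dec (𝒱 (g i) x) → 𝟏 (𝒱 (g i)) x ≡ ℤ.1ℤ + -1ℤ * 𝟏 (∁ (𝒱 (g i))) x
          cases (yes v) = ≡.trans (𝟏-yes (𝒱 (g i)) v) (≡.cong (λ z → ℤ.1ℤ + -1ℤ * z) (≡.sym (𝟏-no (∁ (𝒱 (g i))) λ ¬v → ¬v v)))
          cases (no ¬v) = ≡.trans (𝟏-no (𝒱 (g i)) ¬v) (≡.cong (λ z → ℤ.1ℤ + -1ℤ * z) (≡.sym (𝟏-yes (∁ (𝒱 (g i))) ¬v)))

      I-alternating : ∑ (subsets m) (λ S → -1^ ∣ S ∣ * I S) ≡ + mComp (⨀ g) * e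
      I-alternating = ≡.trans (∑-cong (subsets m) λ S → ≡.sym (∫-* H U (-1^ ∣ S ∣) (𝟏 (X S))))
        (≡.trans (≡.sym (∫-∑ H U (subsets m) λ S x → -1^ ∣ S ∣ * 𝟏 (X S) x))
        (≡.trans (∫-cong H U pointwise) (Regions.∫-∁𝒱 (maxOf-⨀ M) H ⨀-constant)))
        where
        pointwise : ∀ x → ∑ (subsets m) (λ S → -1^ ∣ S ∣ * 𝟏 (X S) x) ≡ 𝟏 (∁ (𝒱 (⨀ g))) x
        pointwise x = ≡.trans (inclusion-exclusion (λ i → 𝒱 (g i)) x)
          (𝟏-cong (λ x → ∀ i → ¬ 𝒱 (g i) x) (∁ (𝒱 (⨀ g)))
            (λ ¬v → Regions.regular⇒∁𝒱 (maxOf-⨀ M) (regular-⨀ M λ i → R.∁𝒱⇒regular i (¬v i)))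
            (λ ¬v i → R.regular⇒∁𝒱 i (regular-⨀⁻ M (Regions.∁𝒱⇒regular (maxOf-⨀ M) ¬v) i)))
        -- The forms of `maxOf-⨀ M` need not occur in `H`, so constancy on the cells of `H` is
        -- inherited from the left side of `pointwise`.
        ⨀-constant : Constant H U (𝟏 (∁ (𝒱 (⨀ g))))
        ⨀-constant = constant λ {x} {y} _ _ same → ≡.trans (≡.sym (pointwise x))
          (≡.trans (∑-cong (subsets m) λ S → ≡.cong (-1^ ∣ S ∣ *_) (value (X-constant S) tt tt same)) (pointwise y))

      -- The condition `2 ≤ n` is traded for corrections at sizes 0 and 1, where `-1^ n` is 1 and
      -- -1; the full alternating sum can then be used.
      coefficient : ∀ n → [ 2 ≤? n ]ℤ * -1^ (n ℕ.+ d) ≡ e * (-1^ n + -1ℤ * [ n ℕₚ.≟ 0 ]ℤ + [ n ℕₚ.≟ 1 ]ℤ)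
      coefficient zero = ≡.sym (ℤₚ.*-zeroʳ e)
      coefficient (suc zero) = ≡.sym (ℤₚ.*-zeroʳ e)
      coefficient n@(suc (suc k)) = ≡.trans (ℤₚ.*-identityˡ _) (≡.trans (ℤₚ.^-distribˡ-+-* -1ℤ n d) (commute (-1^ n) e))
        where
        commute : ∀ a b → a * b ≡ b * (a + -1ℤ * ℤ.0ℤ + ℤ.0ℤ)
        commute = ℤ-Solver.solve-∀

      e² : e * e ≡ ℤ.1ℤ
      e² = square d
        where
        square : ∀ n → -1^ n * -1^ n ≡ ℤ.1ℤ
        square zero = ≡.refl
        square (suc n) = ≡.trans (≡.cong₂ _*_ (-1^suc n) (-1^suc n)) (≡.trans (neg² (-1^ n)) (square n))
          where
          neg² : ∀ a → (ℤ.- a) * (ℤ.- a) ≡ a * a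
          neg² = ℤ-Solver.solve-∀

    regionCount : + mComp (⨀ g) ≡ fComp g +
      (∑[ k ← filter (2 ≤?_) (upTo (suc m)) ] (-1ℤ ^ (k ℕ.+ d) * (∑[ S ← subsetsOfSize k m ] χ (X S))))
    regionCount = ≡.sym (≡.trans (≡.cong (λ z → fComp g + z) corrections) total)
      where
      open ≡.≡-Reasoning
      ΣN = ∑ (allFin m) N
      B = + mComp (⨀ g)
      expand : ∀ e a b c i → e * (a + -1ℤ * b + c) * i ≡ e * (a * i + -1ℤ * (b * i) + c * i)
      expand = ℤ-Solver.solve-∀
      singles : ∑ (allFin m) (λ i → I ⁅ i ⁆) ≡ + m * e + -1ℤ * (ΣN * e)
      singles = begin
        ∑ (allFin m) (λ i → I ⁅ i ⁆)                                         ≡⟨ ∑-cong (allFin m) I-⁅⁆ ⟩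
        ∑ (allFin m) (λ i → e + -1ℤ * (N i * e))                             ≡⟨ ∑-+ (allFin m) (const e) _ ⟩
        ∑ (allFin m) (const e) + ∑ (allFin m) (λ i → -1ℤ * (N i * e))        ≡⟨ ≡.cong₂ _+_ (∑-constant {n = m} id (const e) e λ _ → ≡.refl) (∑-* (allFin m) -1ℤ λ i → N i * e) ⟩
        + m * e + -1ℤ * ∑ (allFin m) (λ i → N i * e)                         ≡⟨ ≡.cong (λ z → + m * e + -1ℤ * z) (≡.trans (∑-cong (allFin m) λ i → ℤₚ.*-comm (N i) e) (≡.trans (∑-* (allFin m) e N) (ℤₚ.*-comm e ΣN))) ⟩
        + m * e + -1ℤ * (ΣN * e)                                             ∎
      corrections : (∑[ k ← filter (2 ≤?_) (upTo (suc m)) ] (-1ℤ ^ (k ℕ.+ d) * (∑[ S ← subsetsOfSize k m ] χ (X S)))) ≡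
        e * (B * e + -1ℤ * e + (+ m * e + -1ℤ * (ΣN * e)))
      corrections = begin
        ∑ (filter (2 ≤?_) (upTo (suc m))) (λ k → -1^ (k ℕ.+ d) * ∑ (subsetsOfSize k m) (λ S → χ (X S)))
          ≡⟨ ∑-filter (2 ≤?_) (upTo (suc m)) _ ⟩
        ∑ (upTo (suc m)) (λ k → [ 2 ≤? k ]ℤ * (-1^ (k ℕ.+ d) * ∑ (subsetsOfSize k m) (λ S → χ (X S))))
          ≡⟨ ∑-cong (upTo (suc m)) (λ k → ≡.trans (≡.sym (ℤₚ.*-assoc [ 2 ≤? k ]ℤ _ _))
               (≡.cong ([ 2 ≤? k ]ℤ * -1^ (k ℕ.+ d) *_) (∑-cong (subsetsOfSize k m) χ-∫))) ⟩
        ∑ (upTo (suc m)) (λ k → [ 2 ≤? k ]ℤ * -1^ (k ℕ.+ d) * ∑ (subsetsOfSize k m) I)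
          -- No subset has more than `m` elements, so `upTo (suc m)` meets every size.
          ≡⟨ ∑-fibres ∣_∣ (suc m) (λ k → [ 2 ≤? k ]ℤ * -1^ (k ℕ.+ d)) (subsets m) I (λ S → ℕ.s≤s (Subsetₚ.∣p∣≤n S)) ⟩
        ∑ (subsets m) (λ S → [ 2 ≤? ∣ S ∣ ]ℤ * -1^ (∣ S ∣ ℕ.+ d) * I S)
          ≡⟨ ∑-cong (subsets m) (λ S → ≡.trans (≡.cong (_* I S) (coefficient ∣ S ∣))
               (expand e (-1^ ∣ S ∣) [ ∣ S ∣ ℕₚ.≟ 0 ]ℤ [ ∣ S ∣ ℕₚ.≟ 1 ]ℤ (I S))) ⟩
        ∑ (subsets m) (λ S → e * (-1^ ∣ S ∣ * I S + -1ℤ * ([ ∣ S ∣ ℕₚ.≟ 0 ]ℤ * I S) + [ ∣ S ∣ ℕₚ.≟ 1 ]ℤ * I S))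
          ≡⟨ ∑-* (subsets m) e _ ⟩
        e * ∑ (subsets m) (λ S → -1^ ∣ S ∣ * I S + -1ℤ * ([ ∣ S ∣ ℕₚ.≟ 0 ]ℤ * I S) + [ ∣ S ∣ ℕₚ.≟ 1 ]ℤ * I S)
          ≡⟨ ≡.cong (e *_) (≡.trans (∑-+ (subsets m) _ _) (≡.cong₂ _+_ (∑-+ (subsets m) _ _) (∑-size-1 m I))) ⟩
        e * (∑ (subsets m) (λ S → -1^ ∣ S ∣ * I S) + ∑ (subsets m) (λ S → -1ℤ * ([ ∣ S ∣ ℕₚ.≟ 0 ]ℤ * I S)) + ∑ (allFin m) (λ i → I ⁅ i ⁆))
          ≡⟨ ≡.cong (e *_) (≡.cong₂ _+_ (≡.cong₂ _+_ I-alternating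
               (≡.trans (∑-* (subsets m) -1ℤ _) (≡.cong (-1ℤ *_) (≡.trans (∑-size-0 m I) I-⊥)))) singles) ⟩
        e * (B * e + -1ℤ * e + (+ m * e + -1ℤ * (ΣN * e))) ∎
      -- With `e * e` equal to 1 the corrections at sizes 0 and 1 amount to `-1 + m - ΣN`, the
      -- negative of `fComp g`.
      total : fComp g + e * (B * e + -1ℤ * e + (+ m * e + -1ℤ * (ΣN * e))) ≡ B
      total = begin
        ΣN ℤ.- (+ m ℤ.- ℤ.1ℤ) + e * (B * e + -1ℤ * e + (+ m * e + -1ℤ * (ΣN * e)))
          ≡⟨ collect ΣN (+ m) e B ⟩
        ΣN ℤ.- (+ m ℤ.- ℤ.1ℤ) + e * e * (B + -1ℤ + (+ m + -1ℤ * ΣN))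
          ≡⟨ ≡.cong (λ z → ΣN ℤ.- (+ m ℤ.- ℤ.1ℤ) + z * (B + -1ℤ + (+ m + -1ℤ * ΣN))) e² ⟩
        ΣN ℤ.- (+ m ℤ.- ℤ.1ℤ) + ℤ.1ℤ * (B + -1ℤ + (+ m + -1ℤ * ΣN))
          ≡⟨ simplify ΣN (+ m) B ⟩
        B ∎
        where
        collect : ∀ s m e b → s ℤ.- (m ℤ.- ℤ.1ℤ) + e * (b * e + -1ℤ * e + (m * e + -1ℤ * (s * e))) ≡
          s ℤ.- (m ℤ.- ℤ.1ℤ) + e * e * (b + -1ℤ + (m + -1ℤ * s))
        collect = ℤ-Solver.solve-∀
        simplify : ∀ s m b → s ℤ.- (m ℤ.- ℤ.1ℤ) + ℤ.1ℤ * (b + -1ℤ + (m + -1ℤ * s)) ≡ b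
        simplify = ℤ-Solver.solve-∀

theorem11 : (em : ExcludedMiddle (Level.suc 0ℓ)) (ℝ : CompleteOrderedField) →
    let open TropicalGeometry em ℝ in
    ∀ (d m : ℕ) (g : Fin m → Function d) → (∀ i → IsTropicalPolynomial (g i)) →
    + mComp (⨀ g) ≡
    fComp g +
    (∑[ k ← filter (2 ≤?_) (upTo (suc m)) ]
    (-1ℤ ^ (k ℕ.+ d) * (∑[ S ← subsetsOfSize k m ] χ (⋂[ S ] (λ i → 𝒱 (g i))))))
theorem11 em ℝ d m g trop = regionCount g (λ i → tropical⇒maxOf (trop i))
  where
  open LinearRegions em ℝ using (tropical⇒maxOf)
  open RegionCounting em ℝ
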